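{- For every even integer $n\ge 8$, $R(W_n,W_n) \le 6n-10$.
   Context: For graphs $G_1,G_2$, the Ramsey number $R(G_1,G_2)$ is the smallest positive integer $N$ such that every red-blue edge-coloring of $K_N$ contains a red copy of $G_1$ or a blue copy of $G_2$. The wheel $W_n$ is the graph on $n$ vertices obtained by adding a new vertex adjacent to every vertex of the cycle $C_{n-1}$. -}

module Defs where

open import Data.Nat using (ℕ; zero; suc)
open import Data.Nat.DivMod using (_%_)
open import Data.Fin using (Fin; zero; suc; toℕ)
open import Data.Bool using (Bool; true; false)
open import Data.Sum using (_⊎_)
open import Data.Product using (Σ; _×_)
open import Data.Empty using (⊥)
open import Data.Unit using (⊤)
open import Function.Definitions using (Injective)
open import Relation.Binary.PropositionalEquality using (_≡_)

Graph : ℕ → Set₁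
Graph k = Fin k → Fin k → Set

-- The cycle C_m on vertices 0,…,m-1 (i ~ i+1 mod m); meaningful for m ≥ 3.
CycleAdj : (m : ℕ) → Graph m
CycleAdj zero    i j = ⊥
CycleAdj (suc k) i j =
  (toℕ j ≡ suc (toℕ i) % suc k) ⊎ (toℕ i ≡ suc (toℕ j) % suc k)

Wheel : (n : ℕ) → Graph n
Wheel zero    ()      _
Wheel (suc m) zero    zero    = ⊥
Wheel (suc m) zero    (suc j) = ⊤
Wheel (suc m) (suc i) zero    = ⊤
Wheel (suc m) (suc i) (suc j) = CycleAdj m i j

-- A red-blue edge-colouring of K_N: a symmetric colour function on pairs
-- (true = red, false = blue; values on the diagonal are irrelevant).
record Colouring (N : ℕ) : Set where
  field
    colour    : Fin N → Fin N → Bool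
    symmetric : ∀ i j → colour i j ≡ colour j i
open Colouring public

HasCopy : ∀ {N k} → Colouring N → Bool → Graph k → Set
HasCopy {N} {k} c b G =
  Σ (Fin k → Fin N) λ f → Injective _≡_ _≡_ f × (∀ u v → G u v → colour c (f u) (f v) ≡ b)

RamseyProp : ∀ {k l} → Graph k → Graph l → ℕ → Set
RamseyProp G₁ G₂ N = (c : Colouring N) → HasCopy c true G₁ ⊎ HasCopy c false G₂

{-# OPTIONS --safe #-}
module Submission where

-- Write n = 2q + 2 and colour the edges of K_N, N = 12q + 2. Some vertex has a set A of 6q + 1 neighbours in one colour, say red.
-- If there is no monochromatic wheel, A contains no red cycle of length 2q + 1 and no blue one in a blue neighbourhood.
-- Suppose that h in A has at least 3q + 2 blue neighbours in A. They span a monochromatic cycle longer than 2q + 1, and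
-- such cycles can be shortened by one vertex at a time down to length 2q + 2. As length 2q + 1 is excluded, a cycle of
-- length 2q + 2 splits into two cliques of size q + 1 in the other colour. Blue cliques yield a blue wheel, and
-- red ones extend to two disjoint red cliques of size q + 2 in the blue neighbourhood of h.
-- Three such cliques that are disjoint yield a blue wheel; two of them connected by two disjoint red links of length
-- at most two yield a red cycle of length 2q + 1, and counting degrees shows that one of these cases occurs.
-- Hence all red degrees in A are at least 3q − 1. Then a red cycle of odd length 2p + 1 < 2q + 1 can be lengthened by
-- two, so A contains no red triangle, and the red neighbourhood of any vertex of A is a blue clique, which contains
-- a wheel.

open import Defs
open import Data.Bool using (Bool; true; false; not; _∧_; _∨_) renaming (T to So)
import Data.Bool.Properties as Bool
open import Data.Empty using (⊥; ⊥-elim)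
import Data.Fin as Fin
open import Data.Fin using (Fin; toℕ)
import Data.Fin.Properties as Fin
open import Data.List using (List; []; _∷_; _++_; length; [_]; take; drop; lookup; tabulate)
open import Data.List.Membership.Propositional using (_∈_)
open import Data.List.Membership.Propositional.Properties using (∈-∃++; ∈-++⁺ˡ; ∈-++⁺ʳ; ∈-++⁻; ∈-lookup)
open import Data.List.Properties using (length-++; length-take; length-tabulate; take++drop≡id) renaming (++-assoc to ++-assoc≡; ++-identityʳ to ++-identityʳ≡)
import Data.List.Relation.Binary.Permutation.Propositional as Perm
open import Data.List.Relation.Binary.Permutation.Propositional using (_↭_; ↭-refl; ↭-sym; ↭-trans; ↭-reflexive; prep; swap)
open import Data.List.Relation.Binary.Permutation.Propositional.Properties using (↭-length; ∈-resp-↭; shift; ++⁺; ++⁺ˡ; ++⁺ʳ; All-resp-↭; ++-commutativeMonoid)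
import Data.List.Relation.Unary.All as All
import Data.List.Relation.Unary.All.Properties as All
import Data.List.Relation.Unary.AllPairs as AllPairs
open import Data.List.Relation.Unary.Any using (here; there)
open import Data.List.Relation.Unary.Unique.Propositional using (Unique)
open import Data.List.Relation.Unary.Unique.Propositional.Properties using (allFin⁺)
open import Data.Maybe using (Maybe; just; nothing)
open import Data.Maybe.Properties using (just-injective)
open import Data.Nat using (ℕ; zero; suc; _+_; _*_; _∸_; _≤_; _<_; z≤n; s≤s; s≤s⁻¹; _≤?_; _≤ᵇ_)
open import Data.Nat.Divisibility using (_∣_; divides)
open import Data.Nat.DivMod using (_%_; m<n⇒m%n≡m; n%n≡0)
import Data.Nat.Properties as ℕ
open import Data.Nat.Properties using (≤-refl; ≤-trans; ≤-reflexive; ≤-antisym; ≰⇒>; +-mono-≤; +-monoˡ-≤; +-cancelˡ-≤; *-monoʳ-≤; *-cancelˡ-≤; m≤m+n; m≤n+m; m≤n⇒m≤1+n; +-assoc; +-comm; +-identityʳ; +-suc; *-comm; *-assoc; *-zeroʳ; *-distribˡ-+; *-distribʳ-+; *-monoˡ-≤; 1+n≰n; ≤ᵇ⇒≤; m≤n⇒m⊓n≡m; m∸n+n≡m; m+n∸m≡n; m+[n∸m]≡n; suc-injective)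
open import Algebra.Properties.CommutativeSemigroup ℕ.+-commutativeSemigroup using (interchange)
open import Data.Product using (Σ; ∃; ∃₂; _×_; _,_; proj₁; proj₂)
open import Data.Sum using (_⊎_; inj₁; inj₂; [_,_]′)
open import Data.Unit using (⊤; tt)
open import Data.Vec using (Vec)
import Data.Vec as Vec
open import Data.Vec.Properties using (lookup∘tabulate; lookup-++ˡ; lookup-++ʳ; lookup-map)
open import Function using (_∘_; id; case_of_)
open import Relation.Binary.Definitions using (DecidableEquality)
open import Relation.Binary.PropositionalEquality using (_≡_; _≢_; refl; sym; trans; cong; cong₂; subst)
open import Relation.Nullary using (Dec; does; yes; no; ¬_)
open import Relation.Nullary.Decidable using (map′; _×-dec_; _⊎-dec_; _→-dec_)
open import Relation.Unary using (Decidable)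
import Algebra.Solver.CommutativeMonoid.Normal as Normal

-- The two colours play unequal parts. All of A is red to the chosen vertex, so red cycles of length
-- 2q + 1 are excluded throughout A, while blue ones are excluded only where a common blue neighbour
-- serves as hub. This forces the detour through blue neighbourhoods. The threshold 3q + 2 comes
-- from the fact that a longest monochromatic cycle covers about two thirds of the vertices: on 3q +
-- 2 vertices its length exceeds 2q. A vertex with fewer blue neighbours has at least 6q - (3q + 1)
-- = 3q - 1 red ones. Shortening meets a parity obstacle: to exclude an odd length it is enough that
-- the length before it is excluded, but an even length needs the two before it. At 2q + 2 only 2q +
-- 1 is known to be excluded, and the complete bipartite graph with q + 1 vertices on each side
-- shows that the step can fail. This is the origin of the two cliques. A third clique arises when
-- the roles of h and of a vertex in its cliques are exchanged.

infixr 5 _⊕_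
infixr 6 _·_
_⊕_ : ∀ {a b c d} → a ≤ b → c ≤ d → a + c ≤ b + d
_⊕_ = +-mono-≤

_·_ : ∀ {a b} k → a ≤ b → k * a ≤ k * b
k · h = *-monoʳ-≤ k h

1≰0 : {A : Set} → 1 ≤ 0 → A
1≰0 ()

≢-not : ∀ {c} → c ≢ not c
≢-not {true}  ()
≢-not {false} ()

bool-third : ∀ {x y z : Bool} → x ≢ y → x ≢ z → y ≡ z
bool-third {true}  {true}          n _ = ⊥-elim (n refl)
bool-third {true}  {false} {true}  _ m = ⊥-elim (m refl)
bool-third {true}  {false} {false} _ _ = refl
bool-third {false} {false}         n _ = ⊥-elim (n refl)
bool-third {false} {true}  {false} _ m = ⊥-elim (m refl)
bool-third {false} {true}  {true}  _ _ = refl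

does-true : {P : Set} (d : Dec P) → does d ≡ true → P
does-true (yes p) _ = p

does-false : {P : Set} (d : Dec P) → does d ≡ false → ¬ P
does-false (no n) _ = n

-- Linear inequalities proved by certificates

module LinearArithmetic where

  infixl 7 _:*_
  infixl 6 _:+_
  infix  4 _:≤_ _:=_
  infix  3 ⊢_
  infixr 2 _:⇒_

  data Expr (n : ℕ) : Set where
    var  : Fin n → Expr n
    con  : ℕ → Expr n
    _:+_ : Expr n → Expr n → Expr n
    _:*_ : ℕ → Expr n → Expr n

  data Relation (n : ℕ) : Set where
    _:≤_ _:=_ : Expr n → Expr n → Relation n

  data Claim (n : ℕ) : Set where
    _:⇒_ : Relation n → Claim n → Claim n
    ⊢_   : Relation n → Claim n
    ⊢⊥   : Claim n

  value : ∀ {n} → Expr n → Vec ℕ n → ℕ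
  value (var i)  ρ = Vec.lookup ρ i
  value (con k)  ρ = k
  value (a :+ b) ρ = value a ρ + value b ρ
  value (k :* a) ρ = k * value a ρ

  Holds : ∀ {n} → Relation n → Vec ℕ n → Set
  Holds (a :≤ b) ρ = value a ρ ≤ value b ρ
  Holds (a := b) ρ = value a ρ ≡ value b ρ

  Meaning : ∀ {n} → Claim n → Vec ℕ n → Set
  Meaning (r :⇒ c) ρ = Holds r ρ → Meaning c ρ
  Meaning (⊢ r)    ρ = Holds r ρ
  Meaning ⊢⊥       ρ = ⊥

  Linear : ℕ → Set
  Linear n = ℕ × Vec ℕ n

  dot : ∀ {n} → Vec ℕ n → Vec ℕ n → ℕ
  dot Vec.[]       Vec.[]       = 0
  dot (a Vec.∷ as) (x Vec.∷ xs) = a * x + dot as xs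

  unit : ∀ {n} → Fin n → Vec ℕ n
  unit Fin.zero    = 1 Vec.∷ Vec.replicate _ 0
  unit (Fin.suc i) = 0 Vec.∷ unit i

  normal : ∀ {n} → Expr n → Linear n
  normal (var i)  = 0 , unit i
  normal (con k)  = k , Vec.replicate _ 0
  normal (a :+ b) = proj₁ (normal a) + proj₁ (normal b) , Vec.zipWith _+_ (proj₂ (normal a)) (proj₂ (normal b))
  normal (k :* a) = k * proj₁ (normal a) , Vec.map (k *_) (proj₂ (normal a))

  dot-zero : ∀ {n} (ρ : Vec ℕ n) → dot (Vec.replicate n 0) ρ ≡ 0
  dot-zero Vec.[]       = refl
  dot-zero (_ Vec.∷ xs) = dot-zero xs

  dot-unit : ∀ {n} i (ρ : Vec ℕ n) → dot (unit i) ρ ≡ Vec.lookup ρ i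
  dot-unit Fin.zero    (x Vec.∷ xs) = trans (cong₂ _+_ (+-identityʳ x) (dot-zero xs)) (+-identityʳ x)
  dot-unit (Fin.suc i) (x Vec.∷ xs) = dot-unit i xs

  dot-+ : ∀ {n} (as bs ρ : Vec ℕ n) → dot (Vec.zipWith _+_ as bs) ρ ≡ dot as ρ + dot bs ρ
  dot-+ Vec.[]       Vec.[]       Vec.[]       = refl
  dot-+ (a Vec.∷ as) (b Vec.∷ bs) (x Vec.∷ xs) = trans (cong₂ _+_ (*-distribʳ-+ x a b) (dot-+ as bs xs)) (interchange (a * x) (b * x) (dot as xs) (dot bs xs))

  dot-* : ∀ {n} k (as ρ : Vec ℕ n) → dot (Vec.map (k *_) as) ρ ≡ k * dot as ρ
  dot-* k Vec.[]       Vec.[]       = sym (*-zeroʳ k)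
  dot-* k (a Vec.∷ as) (x Vec.∷ xs) = trans (cong₂ _+_ (*-assoc k a x) (dot-* k as xs)) (sym (*-distribˡ-+ k (a * x) (dot as xs)))

  value-normal : ∀ {n} (e : Expr n) ρ → proj₁ (normal e) + dot (proj₂ (normal e)) ρ ≡ value e ρ
  value-normal (var i)  ρ = dot-unit i ρ
  value-normal (con k)  ρ = trans (cong (k +_) (dot-zero ρ)) (+-identityʳ k)
  value-normal (a :+ b) ρ = trans (cong (k + l +_) (dot-+ (proj₂ (normal a)) (proj₂ (normal b)) ρ))
    (trans (interchange k l (dot (proj₂ (normal a)) ρ) (dot (proj₂ (normal b)) ρ)) (cong₂ _+_ (value-normal a ρ) (value-normal b ρ)))
    where
    k = proj₁ (normal a)
    l = proj₁ (normal b)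
  value-normal (k :* a) ρ = trans (cong (k * proj₁ (normal a) +_) (dot-* k (proj₂ (normal a)) ρ))
    (trans (sym (*-distribˡ-+ k (proj₁ (normal a)) _)) (cong (k *_) (value-normal a ρ)))

  dominated : ∀ {n} → Vec ℕ n → Vec ℕ n → Bool
  dominated Vec.[]       Vec.[]       = true
  dominated (a Vec.∷ as) (b Vec.∷ bs) = (a ≤ᵇ b) ∧ dominated as bs

  So-∧ : ∀ {a b} → So (a ∧ b) → So a × So b
  So-∧ {true} t = tt , t

  dominated-dot : ∀ {n} (as bs ρ : Vec ℕ n) → So (dominated as bs) → dot as ρ ≤ dot bs ρ
  dominated-dot Vec.[]       Vec.[]       Vec.[]       _ = z≤n
  dominated-dot (a Vec.∷ as) (b Vec.∷ bs) (x Vec.∷ xs) t =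
    *-monoˡ-≤ x (≤ᵇ⇒≤ a b (proj₁ (So-∧ t))) ⊕ dominated-dot as bs xs (proj₂ (So-∧ {a ≤ᵇ b} t))

  below : ∀ {n} → Expr n → Expr n → Bool
  below a b = (proj₁ (normal a) ≤ᵇ proj₁ (normal b)) ∧ dominated (proj₂ (normal a)) (proj₂ (normal b))

  below-≤ : ∀ {n} (a b : Expr n) ρ → So (below a b) → value a ρ ≤ value b ρ
  below-≤ a b ρ t = ≤-trans (≤-reflexive (sym (value-normal a ρ))) (≤-trans
    (≤ᵇ⇒≤ (proj₁ (normal a)) (proj₁ (normal b)) (proj₁ (So-∧ t)) ⊕ dominated-dot (proj₂ (normal a)) (proj₂ (normal b)) ρ (proj₂ (So-∧ {proj₁ (normal a) ≤ᵇ proj₁ (normal b)} t)))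
    (≤-reflexive (value-normal b ρ)))

  -- `s` and `t` collect the weighted left and right sides of the hypotheses. Adding them crosswise
  -- to the conclusion, t + (k + 1)x against s + (k + 1)y, avoids subtraction, so natural
  -- coefficients suffice.
  check : ∀ {n} → Claim n → ℕ → List ℕ → Expr n → Expr n → Bool
  check ((a :≤ b) :⇒ c) k (w ∷ ws)     s t = check c k ws (s :+ w :* a) (t :+ w :* b)
  check ((a := b) :⇒ c) k (v ∷ w ∷ ws) s t = check c k ws (s :+ (v :* a :+ w :* b)) (t :+ (v :* b :+ w :* a))
  check (⊢ (x :≤ y))    k []           s t = below (t :+ suc k :* x) (s :+ suc k :* y)
  check ⊢⊥              k []           s t = below (t :+ con 1) s
  check _               _ _            _ _ = false

  conclude : ∀ {s t x y} k → s ≤ t → t + suc k * x ≤ s + suc k * y → x ≤ y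
  conclude {s} {t} {x} {y} k h e = *-cancelˡ-≤ (suc k) (+-cancelˡ-≤ t (suc k * x) (suc k * y) (≤-trans e (+-monoˡ-≤ (suc k * y) h)))

  certified : ∀ {n} (c : Claim n) k ws s t ρ → value s ρ ≤ value t ρ → So (check c k ws s t) → Meaning c ρ
  certified ((a :≤ b) :⇒ c) k (w ∷ ws)     s t ρ acc ok h = certified c k ws _ _ ρ (acc ⊕ w · h) ok
  certified ((a := b) :⇒ c) k (v ∷ w ∷ ws) s t ρ acc ok h = certified c k ws _ _ ρ (acc ⊕ (v · ≤-reflexive h ⊕ w · ≤-reflexive (sym h))) ok
  certified (⊢ (x :≤ y))    k []           s t ρ acc ok   = conclude k acc (below-≤ (t :+ suc k :* x) (s :+ suc k :* y) ρ ok)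
  certified ⊢⊥              k []           s t ρ acc ok   = n≮n′ (≤-trans (≤-reflexive (+-comm 1 (value t ρ))) (≤-trans (below-≤ (t :+ con 1) s ρ ok) acc))
    where
    n≮n′ : ∀ {m} → suc m ≤ m → ⊥
    n≮n′ h = 1+n≰n h

  -- An equation follows from equations in both directions, with the weights interchanged.
  forwards backwards : ∀ {n} → Claim n → Claim n
  forwards (r :⇒ c)       = r :⇒ forwards c
  forwards (⊢ (x := y))   = ⊢ (x :≤ y)
  forwards c              = c
  backwards (r :⇒ c)      = r :⇒ backwards c
  backwards (⊢ (x := y))  = ⊢ (y :≤ x)
  backwards c             = c

  interchanged : List ℕ → List ℕ
  interchanged (v ∷ w ∷ ws) = w ∷ v ∷ interchanged ws
  interchanged ws           = ws

  both-ways : ∀ {n} (c : Claim n) ρ → Meaning (forwards c) ρ → Meaning (backwards c) ρ → Meaning c ρ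
  both-ways (r :⇒ c)     ρ f g h = both-ways c ρ (f h) (g h)
  both-ways (⊢ (x := y)) ρ f g   = ≤-antisym f g
  both-ways (⊢ (x :≤ y)) ρ f g   = f
  both-ways ⊢⊥           ρ f g   = f
  Function : ℕ → Set → Set → Set
  Function zero    A B = B
  Function (suc m) A B = A → Function m A B

  apply : ∀ {A B} m → (Fin m → A) → Function m A B → B
  apply zero    v f = f
  apply (suc m) v f = apply m (v ∘ Fin.suc) (f (v Fin.zero))

  Universal : ∀ {A : Set} n → (Vec A n → Set) → Set
  Universal zero    P = P Vec.[]
  Universal (suc n) P = ∀ x → Universal n (λ xs → P (x Vec.∷ xs))

  universal : ∀ {A : Set} n {P : Vec A n → Set} → (∀ ρ → P ρ) → Universal n P
  universal zero    h = h Vec.[]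
  universal (suc n) h = λ x → universal n (λ xs → h (x Vec.∷ xs))

  -- A linear claim with a Farkas certificate: the weights of the hypotheses (two for an equation, one for each direction)
  -- whose combination dominates k + 1 times the conclusion coefficientwise.
  abstract
    farkas : ∀ n (f : Function n (Expr n) (Claim n)) k ws {ok : So (check (apply n var f) k ws (con 0) (con 0))} → Universal n (Meaning (apply n var f))
    farkas n f k ws {ok} = universal n λ ρ → certified (apply n var f) k ws (con 0) (con 0) ρ z≤n ok

    farkas-≡ : ∀ n (f : Function n (Expr n) (Claim n)) k ws
               {ok : So (check (forwards (apply n var f)) k ws (con 0) (con 0))} {ok′ : So (check (backwards (apply n var f)) k (interchanged ws) (con 0) (con 0))} →
               Universal n (Meaning (apply n var f))
    farkas-≡ n f k ws {ok} {ok′} = universal n λ ρ → both-ways (apply n var f) ρ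
      (certified (forwards (apply n var f)) k ws (con 0) (con 0) ρ z≤n ok) (certified (backwards (apply n var f)) k (interchanged ws) (con 0) (con 0) ρ z≤n ok′)

open LinearArithmetic using (farkas; farkas-≡; Function; apply; Universal; universal; con; _:+_; _:*_; _:≤_; _:=_; _:⇒_; ⊢_; ⊢⊥)

-- Lists up to permutation, and counting

module Lists (V : Set) where

  module Multiset = Normal (++-commutativeMonoid {A = V})

  infixr 5 _◃_ _⧺_
  infix  4 _⇄_

  -- Lists built from m variables for elements and n variables for lists.
  data Word (m n : ℕ) : Set where
    ε    : Word m n
    _◃_  : Fin m → Word m n → Word m n
    list : Fin n → Word m n
    _⧺_  : Word m n → Word m n → Word m n

  spell : ∀ {m n} → Word m n → Vec V m → Vec (List V) n → List V
  spell ε        σ τ = []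
  spell (x ◃ w)  σ τ = Vec.lookup σ x ∷ spell w σ τ
  spell (list j) σ τ = Vec.lookup τ j
  spell (v ⧺ w)  σ τ = spell v σ τ ++ spell w σ τ

  -- An element becomes a variable for its singleton list. A permutation of words is then an
  -- identity in the commutative monoid of lists up to permutation, and normal forms settle it.
  multiset : ∀ {m n} → Word m n → Multiset.Expr (m + n)
  multiset         ε        = Multiset.id
  multiset {m} {n} (x ◃ w)  = Multiset.var (x Fin.↑ˡ n) Multiset.⊕ multiset w
  multiset {m}     (list j) = Multiset.var (m Fin.↑ʳ j)
  multiset         (v ⧺ w)  = multiset v Multiset.⊕ multiset w

  spell-multiset : ∀ {m n} (w : Word m n) σ τ → Multiset.⟦ multiset w ⟧ (Vec.map [_] σ Vec.++ τ) ≡ spell w σ τ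
  spell-multiset ε        σ τ = refl
  spell-multiset (x ◃ w)  σ τ = cong₂ _++_ (trans (lookup-++ˡ (Vec.map [_] σ) τ x) (lookup-map x [_] σ)) (spell-multiset w σ τ)
  spell-multiset (list j) σ τ = lookup-++ʳ (Vec.map [_] σ) τ j
  spell-multiset (v ⧺ w)  σ τ = cong₂ _++_ (spell-multiset v σ τ) (spell-multiset w σ τ)

  data Shuffle (m n : ℕ) : Set where
    _⇄_ : Word m n → Word m n → Shuffle m n

  balanced : ∀ {m n} → Shuffle m n → Bool
  balanced (v ⇄ w) = does (Multiset.normalise (multiset v) Multiset.≟ Multiset.normalise (multiset w))

  Permuted : ∀ {m n} → Shuffle m n → Vec V m → Vec (List V) n → Set
  Permuted (v ⇄ w) σ τ = spell v σ τ ↭ spell w σ τ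

  permuted : ∀ {m n} (s : Shuffle m n) σ τ → So (balanced s) → Permuted s σ τ
  permuted (v ⇄ w) σ τ ok = ↭-trans (↭-sym (at v)) (↭-trans
      (↭-reflexive (cong (λ e → Multiset.⟦ e ⟧⇓ ρ) (holds (Multiset.normalise (multiset v) Multiset.≟ Multiset.normalise (multiset w)) ok)))
      (at w))
    where
    ρ = Vec.map [_] σ Vec.++ τ
    holds : ∀ {P : Set} (d : Dec P) → So (does d) → P
    holds (yes p) _ = p
    at : ∀ u → Multiset.⟦ Multiset.normalise (multiset u) ⟧⇓ ρ ↭ spell u σ τ
    at u = ↭-trans (Multiset.correct (multiset u) ρ) (↭-reflexive (spell-multiset u σ τ))

  abstract
    shuffle : ∀ m n (f : Function m (Fin m) (Function n (Word m n) (Shuffle m n))) {ok : So (balanced (apply n list (apply m id f)))} →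
              Universal m λ σ → Universal n λ τ → Permuted (apply n list (apply m id f)) σ τ
    shuffle m n f {ok} = universal m λ σ → universal n λ τ → permuted (apply n list (apply m id f)) σ τ ok

  ⟦_⟧ : Bool → ℕ
  ⟦ true ⟧  = 1
  ⟦ false ⟧ = 0

  cnt : (V → Bool) → List V → ℕ
  cnt p []       = 0
  cnt p (x ∷ xs) = ⟦ p x ⟧ + cnt p xs

  cnt-++ : ∀ p xs ys → cnt p (xs ++ ys) ≡ cnt p xs + cnt p ys
  cnt-++ p []       ys = refl
  cnt-++ p (x ∷ xs) ys = trans (cong (⟦ p x ⟧ +_) (cnt-++ p xs ys)) (sym (+-assoc ⟦ p x ⟧ (cnt p xs) (cnt p ys)))

  cnt-↭ : ∀ p {xs ys} → xs ↭ ys → cnt p xs ≡ cnt p ys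
  cnt-↭ p Perm.refl        = refl
  cnt-↭ p (Perm.prep x h)  = cong (⟦ p x ⟧ +_) (cnt-↭ p h)
  cnt-↭ p (Perm.swap {ys = ys} x y h) = trans (cong (λ k → ⟦ p x ⟧ + (⟦ p y ⟧ + k)) (cnt-↭ p h)) (exchange ⟦ p x ⟧ ⟦ p y ⟧ (cnt p ys))
    where
    exchange = farkas-≡ 3 (λ a b c → ⊢ a :+ (b :+ c) := b :+ (a :+ c)) 0 []

  cnt-↭ p (Perm.trans h k) = trans (cnt-↭ p h) (cnt-↭ p k)

  ⟦⟧≤1 : ∀ b → ⟦ b ⟧ ≤ 1
  ⟦⟧≤1 true  = ≤-refl
  ⟦⟧≤1 false = z≤n

  ⟦⟧-true : ∀ {b} → b ≡ true → 1 ≤ ⟦ b ⟧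
  ⟦⟧-true refl = ≤-refl

  not-both : ∀ a b → ¬ (a ≡ true × b ≡ true) → ⟦ a ⟧ + ⟦ b ⟧ ≤ 1
  not-both true  true  h = ⊥-elim (h (refl , refl))
  not-both true  false h = ≤-refl
  not-both false b     h = ⟦⟧≤1 b

  cnt≤length : ∀ p xs → cnt p xs ≤ length xs
  cnt≤length p []       = z≤n
  cnt≤length p (x ∷ xs) = +-mono-≤ (⟦⟧≤1 (p x)) (cnt≤length p xs)

  cnt-mono : ∀ p q xs → (∀ {x} → x ∈ xs → p x ≡ true → q x ≡ true) → cnt p xs ≤ cnt q xs
  cnt-mono p q []       h = z≤n
  cnt-mono p q (x ∷ xs) h = +-mono-≤ (aux (h (here refl))) (cnt-mono p q xs (h ∘ there))
    where
    aux : ∀ {a b} → (a ≡ true → b ≡ true) → ⟦ a ⟧ ≤ ⟦ b ⟧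
    aux {true}  k = ⟦⟧-true (k refl)
    aux {false} k = z≤n

  pair-step = farkas 5 (λ a b l c d → a :+ b :≤ con 1 :⇒ c :+ d :≤ l :⇒ ⊢ (a :+ c) :+ (b :+ d) :≤ (con 1 :+ l)) 0 (1 ∷ 1 ∷ [])
  pair-step′ = farkas 5 (λ a b l c d → con 1 :≤ a :+ b :⇒ l :≤ c :+ d :⇒ ⊢ (con 1 :+ l) :≤ (a :+ c) :+ (b :+ d)) 0 (1 ∷ 1 ∷ [])
  triple-step = farkas 7 (λ a b c l d e f → a :+ (b :+ c) :≤ con 1 :⇒ d :+ (e :+ f) :≤ l :⇒ ⊢ (a :+ d) :+ ((b :+ e) :+ (c :+ f)) :≤ (con 1 :+ l)) 0 (1 ∷ 1 ∷ [])

  cnt-disjoint : ∀ p q xs → (∀ {x} → x ∈ xs → ⟦ p x ⟧ + ⟦ q x ⟧ ≤ 1) → cnt p xs + cnt q xs ≤ length xs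
  cnt-disjoint p q []       h = z≤n
  cnt-disjoint p q (x ∷ xs) h = pair-step ⟦ p x ⟧ ⟦ q x ⟧ (length xs) (cnt p xs) (cnt q xs) (h (here refl)) (cnt-disjoint p q xs (h ∘ there))

  cnt-cover : ∀ p q xs → (∀ {x} → x ∈ xs → 1 ≤ ⟦ p x ⟧ + ⟦ q x ⟧) → length xs ≤ cnt p xs + cnt q xs
  cnt-cover p q []       h = z≤n
  cnt-cover p q (x ∷ xs) h = pair-step′ ⟦ p x ⟧ ⟦ q x ⟧ (length xs) (cnt p xs) (cnt q xs) (h (here refl)) (cnt-cover p q xs (h ∘ there))

  cnt-disjoint₃ : ∀ p q r xs → (∀ {x} → x ∈ xs → ⟦ p x ⟧ + (⟦ q x ⟧ + ⟦ r x ⟧) ≤ 1) → cnt p xs + (cnt q xs + cnt r xs) ≤ length xs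
  cnt-disjoint₃ p q r []       h = z≤n
  cnt-disjoint₃ p q r (x ∷ xs) h = triple-step ⟦ p x ⟧ ⟦ q x ⟧ ⟦ r x ⟧ (length xs) (cnt p xs) (cnt q xs) (cnt r xs) (h (here refl)) (cnt-disjoint₃ p q r xs (h ∘ there))

  bool? : ∀ b → b ≡ true ⊎ b ≡ false
  bool? true  = inj₁ refl
  bool? false = inj₂ refl

  true≢false : ∀ {b} {A : Set} → b ≡ true → b ≡ false → A
  true≢false refl ()

  infix 4 _⊑_
  -- Inclusion of multisets with the complement as witness. Below a list without repetitions,
  -- `xs ++ ys ⊑ A` therefore also says that `xs` and `ys` are disjoint.
  _⊑_ : List V → List V → Set
  xs ⊑ ys = ∃ λ zs → ys ↭ xs ++ zs

  ∈-take : ∀ {x : V} {xs} → x ∈ xs → ∃ λ zs → xs ↭ x ∷ zs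
  ∈-take {x} h with ys , zs , refl ← ∈-∃++ h = ys ++ zs , shift x ys zs

  pick : ∀ p xs → 1 ≤ cnt p xs → ∃₂ λ x zs → p x ≡ true × xs ↭ x ∷ zs
  pick p (x ∷ xs) h with p x in e
  ... | true  = x , xs , e , ↭-refl
  ... | false with y , zs , py , π ← pick p xs h = y , x ∷ zs , py , ↭-trans (prep x π) (swap x y ↭-refl)

  find? : ∀ (p : V → Bool) xs → (∃ λ x → x ∈ xs × p x ≡ true) ⊎ (∀ {x} → x ∈ xs → p x ≡ false)
  find? p []       = inj₂ λ ()
  find? p (x ∷ xs) with p x in e
  ... | true  = inj₁ (x , here refl , e)
  ... | false with find? p xs
  ...   | inj₁ (y , y∈ , py) = inj₁ (y , there y∈ , py)
  ...   | inj₂ h             = inj₂ λ { (here refl) → e ; (there y∈) → h y∈ }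

  cnt-none : ∀ p xs → (∀ {x} → x ∈ xs → p x ≡ false) → cnt p xs ≡ 0
  cnt-none p []       h = refl
  cnt-none p (x ∷ xs) h rewrite h (here refl) = cnt-none p xs (h ∘ there)

  ⊑-refl : ∀ {xs} → xs ⊑ xs
  ⊑-refl {xs} = [] , shuffle 0 1 (λ a → a ⇄ a ⧺ ε) xs

  ↭-⊑ : ∀ {xs ys zs} → xs ↭ ys → ys ⊑ zs → xs ⊑ zs
  ↭-⊑ π (ws , σ) = ws , ↭-trans σ (++⁺ʳ ws (↭-sym π))

  ⊑-↭ : ∀ {xs ys zs} → xs ⊑ ys → zs ↭ ys → xs ⊑ zs
  ⊑-↭ (ws , σ) π = ws , ↭-trans π σ

  ⊑-trans : ∀ {xs ys zs} → xs ⊑ ys → ys ⊑ zs → xs ⊑ zs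
  ⊑-trans {xs} {ys} (us , π) (ws , σ) = us ++ ws , ↭-trans σ (↭-trans (++⁺ʳ ws π) (↭-reflexive (++-assoc≡ xs us ws)))

  ⊑-dropʳ : ∀ xs ys {zs} → xs ++ ys ⊑ zs → xs ⊑ zs
  ⊑-dropʳ xs ys (ws , σ) = ys ++ ws , ↭-trans σ (↭-reflexive (++-assoc≡ xs ys ws))

  ⊑-dropˡ : ∀ xs ys {zs} → xs ++ ys ⊑ zs → ys ⊑ zs
  ⊑-dropˡ xs ys (ws , σ) = xs ++ ws , ↭-trans σ (shuffle 0 3 (λ a b c → (a ⧺ b) ⧺ c ⇄ b ⧺ a ⧺ c) xs ys ws)

  ⊑-++ : ∀ {xs xs′ ys ys′} → xs ⊑ xs′ → ys ⊑ ys′ → xs ++ ys ⊑ xs′ ++ ys′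
  ⊑-++ {xs} {xs′} {ys} {ys′} (us , π) (ws , σ) = us ++ ws , ↭-trans (++⁺ π σ)
    (shuffle 0 4 (λ a b c d → (a ⧺ b) ⧺ (c ⧺ d) ⇄ (a ⧺ c) ⧺ (b ⧺ d)) xs us ys ws)

  ⊑-∷ : ∀ {xs ys} x → xs ⊑ ys → x ∷ xs ⊑ x ∷ ys
  ⊑-∷ x (ws , σ) = ws , prep x σ

  ⊑-∈ : ∀ {x xs ys} → xs ⊑ ys → x ∈ xs → x ∈ ys
  ⊑-∈ (ws , σ) h = ∈-resp-↭ (↭-sym σ) (∈-++⁺ˡ h)

  ∈-⊑ : ∀ {x xs} → x ∈ xs → [ x ] ⊑ xs
  ∈-⊑ h = ∈-take h

  Unique-↭ : ∀ {xs ys : List V} → xs ↭ ys → Unique xs → Unique ys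
  Unique-↭ Perm.refl         u = u
  Unique-↭ (Perm.prep x π)   (h AllPairs.∷ u) = All-resp-↭ π h AllPairs.∷ Unique-↭ π u
  Unique-↭ (Perm.swap x y π) ((x≢y All.∷ h) AllPairs.∷ (k AllPairs.∷ u)) =
    ((x≢y ∘ sym) All.∷ All-resp-↭ π k) AllPairs.∷ (All-resp-↭ π h AllPairs.∷ Unique-↭ π u)
  Unique-↭ (Perm.trans π σ)  u = Unique-↭ σ (Unique-↭ π u)

  Unique-++ˡ : ∀ (xs : List V) {ys} → Unique (xs ++ ys) → Unique xs
  Unique-++ˡ []       u                = AllPairs.[]
  Unique-++ˡ (x ∷ xs) (h AllPairs.∷ u) = All.++⁻ˡ xs h AllPairs.∷ Unique-++ˡ xs u

  Unique-⊑ : ∀ {xs ys} → Unique ys → xs ⊑ ys → Unique xs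
  Unique-⊑ {xs} u (ws , π) = Unique-++ˡ xs (Unique-↭ π u)

  Unique-≢ : ∀ {x y xs ys} → Unique ys → x ∷ xs ⊑ ys → y ∈ xs → x ≢ y
  Unique-≢ u h y∈ with Unique-⊑ u h
  ... | k AllPairs.∷ _ = All.lookup k y∈

  length-cnt : ∀ p q xs → (∀ {x} → x ∈ xs → ⟦ p x ⟧ + ⟦ q x ⟧ ≡ 1) → cnt p xs + cnt q xs ≡ length xs
  length-cnt p q xs h = ≤-antisym (cnt-disjoint p q xs (≤-reflexive ∘ h)) (cnt-cover p q xs (≤-reflexive ∘ sym ∘ h))

-- Two-coloured complete graphs, paths and cycles

record TwoColouring : Set₁ where
  field
    V      : Set
    _≟_    : DecidableEquality V
    E      : Bool → V → V → Bool
    E-sym  : ∀ {b x y} → E b x y ≡ true → E b y x ≡ true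
    E-irr  : ∀ {b x} → E b x x ≡ false
    E-dich : ∀ {a b x y} → a ≢ b → x ≢ y → E a x y ≡ true ⊎ E b x y ≡ true
    E-excl : ∀ {a b x y} → a ≢ b → E a x y ≡ true → E b x y ≡ true → ⊥

module Graph (G : TwoColouring) where
  open TwoColouring G
  open Lists V

  Adj : Bool → V → V → Set
  Adj b x y = E b x y ≡ true

  Adj-≢ : ∀ {b x y} → Adj b x y → x ≢ y
  Adj-≢ {b} {x} h refl = true≢false h (E-irr {b} {x})

  infixr 5 _◂_

  -- The list consists of the vertices after the start of the path; a cycle is a path that ends where it starts.
  data Path (b : Bool) : V → List V → V → Set where
    stop : ∀ {x} → Path b x [] x
    _◂_  : ∀ {x y z l} → Adj b x y → Path b y l z → Path b x (y ∷ l) z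

  infixr 5 _▸_
  _▸_ : ∀ {b x y z l m} → Path b x l y → Path b y m z → Path b x (l ++ m) z
  stop    ▸ q = q
  (e ◂ p) ▸ q = e ◂ (p ▸ q)

  edge : ∀ {b x y} → Adj b x y → Path b x [ y ] y
  edge e = e ◂ stop

  split : ∀ {b x z} l y m → Path b x (l ++ y ∷ m) z → Path b x (l ++ [ y ]) y × Path b y m z
  split []      y m (e ◂ p) = edge e , p
  split (_ ∷ l) y m (e ◂ p) with q , r ← split l y m p = e ◂ q , r

  unsnoc : ∀ {b x z} l y → Path b x (l ++ [ y ]) z → y ≡ z
  unsnoc []      y (e ◂ stop) = refl
  unsnoc (_ ∷ l) y (e ◂ p)    = unsnoc l y p

  last∈ : ∀ {b x y l} → Path b x l y → y ∈ x ∷ l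
  last∈ stop    = here refl
  last∈ (_ ◂ p) = there (last∈ p)

  rev : ∀ {b x y l} → Path b x l y → ∃ λ m → Path b y m x × y ∷ m ↭ x ∷ l × length m ≡ length l
  rev stop = [] , stop , ↭-refl , refl
  rev {x = x} {y} (_◂_ {y = w} {l = l} e p) with m , q , π , len ← rev p =
    m ++ [ x ] , q ▸ edge (E-sym e) ,
    ↭-trans (++⁺ʳ [ x ] π) (shuffle 2 1 (λ x w l → (w ◃ l) ⧺ x ◃ ε ⇄ x ◃ w ◃ l) x w l) ,
    trans (length-++ m) (trans (+-comm (length m) 1) (cong suc len))

  -- Distinctness of the vertices is not recorded: it follows from `inside` whenever `A` has no
  -- repetitions.
  record Cycle (b : Bool) (k : ℕ) (A : List V) : Set where
    constructor cycle
    field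
      {base}  : V
      verts   : List V
      path    : Path b base verts base
      len     : length verts ≡ k
      inside  : verts ⊑ A

  Cycle-⊑ : ∀ {b k A B} → A ⊑ B → Cycle b k A → Cycle b k B
  Cycle-⊑ h (cycle l p len k) = cycle l p len (⊑-trans k h)
  record Consecutive (b : Bool) (p q : V → Bool) (x : V) (l : List V) (y : V) : Set where
    constructor consec
    field
      {src tgt} : V
      pre post  : List V
      before    : Path b x pre src
      joint     : Adj b src tgt
      after     : Path b tgt post y
      src-p     : p src ≡ true
      tgt-q     : q tgt ≡ true
      shape     : l ≡ pre ++ tgt ∷ post
  open Consecutive public using (src; tgt; src-p; tgt-q)

  consec-∷ : ∀ {b p q x w y l} → Adj b x w → Consecutive b p q w l y → Consecutive b p q x (w ∷ l) y
  consec-∷ {w = w} e (consec pre post bf j af pu qv s) = consec (w ∷ pre) post (e ◂ bf) j af pu qv (cong (w ∷_) s)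

  scan-step = farkas 5 (λ a b c l d → a :+ b :≤ con 1 :⇒ b :+ 2 :* c :≤ l :+ d :⇒ ⊢ a :+ 2 :* (b :+ c) :≤ (con 1 :+ l) :+ d) 0 (1 ∷ 1 ∷ [])
  -- Without two consecutive vertices in `p`, every edge of the path has at most one end in `p`;
  -- summing over the edges counts inner vertices twice and the ends once. On a closed path the two
  -- end terms cancel, and at most half of the vertices are in `p`.
  scan : ∀ {b x y l} p → Path b x l y → Consecutive b p p x l y ⊎ ⟦ p x ⟧ + 2 * cnt p l ≤ length l + ⟦ p y ⟧
  scan {x = x} p stop = inj₂ (≤-reflexive (+-comm ⟦ p x ⟧ 0))
  scan {b} {x} {y} p (_◂_ {y = w} {l = l} e r) with scan p r
  ... | inj₁ s = inj₁ (consec-∷ e s)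
  ... | inj₂ h with bool? (p x) | bool? (p w)
  ...   | inj₁ px | inj₁ pw = inj₁ (consec [] l stop e r px pw refl)
  ...   | inj₂ px | _       = inj₂ (scan-step ⟦ p x ⟧ ⟦ p w ⟧ (cnt p l) (length l) ⟦ p y ⟧ (not-both (p x) (p w) (λ { (t , _) → true≢false t px })) h)
  ...   | _       | inj₂ pw = inj₂ (scan-step ⟦ p x ⟧ ⟦ p w ⟧ (cnt p l) (length l) ⟦ p y ⟧ (not-both (p x) (p w) (λ { (_ , t) → true≢false t pw })) h)
  -- The cycle opened at the edge `u v`, the form in which this edge can be replaced by a detour.
  record CycleAt (b : Bool) (u v : V) (l : List V) : Set where
    constructor at
    field
      rest  : List V
      back  : Path b v rest u
      forth : Adj b u v
      perm  : v ∷ rest ↭ l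

  rotate : ∀ {b p q x l} → (c : Consecutive b p q x l x) → CycleAt b (src c) (tgt c) l
  rotate {x = x} (consec {tgt = v} pre post bf j af _ _ refl) =
    at (post ++ pre) (af ▸ bf) j (shuffle 1 2 (λ v l m → v ◃ l ⧺ m ⇄ m ⧺ v ◃ l) v post pre)

  Clique : Bool → List V → Set
  Clique b xs = ∀ {x y} → x ∈ xs → y ∈ xs → x ≢ y → Adj b x y

  common : Bool → V → V → V → Bool
  common b x y z = E b x z ∧ E b y z

  -- A list of vertices to be visited; k of the steps go through a new vertex outside the list, where κ is a lower
  -- bound for the number of choices in the pool for such a vertex.
  data Steps (b : Bool) (κ : ℕ) (pool : List V) : V → List V → V → ℕ → Set where
    done   : ∀ {x} → Steps b κ pool x [] x 0
    direct : ∀ {x y z l k} → Adj b x y → Steps b κ pool y l z k → Steps b κ pool x (y ∷ l) z k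
    insert : ∀ {x y z l k} → κ ≤ cnt (common b x y) pool → Steps b κ pool y l z k → Steps b κ pool x (y ∷ l) z (suc k)

  ∧-true : ∀ {a b} → a ∧ b ≡ true → a ≡ true × b ≡ true
  ∧-true {true} {true} _ = refl , refl

  true-∧ : ∀ {a b} → a ≡ true → b ≡ true → a ∧ b ≡ true
  true-∧ refl refl = refl

  record Woven (b : Bool) (x : V) (l : List V) (z : V) (k : ℕ) (used pool : List V) : Set where
    constructor woven
    field
      new     : List V
      wverts  : List V
      wpath   : Path b x wverts z
      wperm   : wverts ↭ l ++ new
      wlen    : length new ≡ k
      winside : new ++ used ⊑ pool

  fresh = farkas 6 (λ κ c d f u k → κ :≤ c :⇒ c :≤ d :+ f :⇒ d :≤ u :⇒ u :+ (con 1 :+ k) :≤ κ :⇒ ⊢ con 1 :≤ f) 0 (1 ∷ 1 ∷ 1 ∷ 1 ∷ [])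

  fresh-common : ∀ {b x y} κ pool used k → κ ≤ cnt (common b x y) pool → used ⊑ pool → length used + suc k ≤ κ →
                 ∃ λ c → Adj b x c × Adj b c y × c ∷ used ⊑ pool
  fresh-common {b} {x} {y} κ pool used k h (rest , π) le
    with c , zs , pc , σ ← pick (common b x y) rest
           (fresh κ (cnt (common b x y) pool) (cnt (common b x y) used) (cnt (common b x y) rest) (length used) k h
             (≤-reflexive (trans (cnt-↭ _ π) (cnt-++ _ used rest))) (cnt≤length _ used) le)
    with xc , yc ← ∧-true {E b x c} pc
    = c , xc , E-sym yc , zs , ↭-trans π (↭-trans (++⁺ˡ used σ) (shuffle 1 2 (λ c l m → l ⧺ c ◃ m ⇄ (c ◃ l) ⧺ m) c used zs))

  weave-le = farkas 3 (λ u k κ → u :+ (con 1 :+ k) :≤ κ :⇒ ⊢ (con 1 :+ u) :+ k :≤ κ) 0 (1 ∷ [])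

  weave-perm₁ = shuffle 2 2 (λ c y l new → c ◃ y ◃ l ⧺ new ⇄ (y ◃ l) ⧺ c ◃ new)
  weave-perm₂ = shuffle 1 2 (λ c new used → (c ◃ new) ⧺ used ⇄ new ⧺ c ◃ used)

  -- Greedy choice: whenever a connecting vertex is needed, fewer than `κ` vertices of the pool are
  -- in use, so one of the common neighbours is free.
  weave : ∀ {b κ pool x l z k} used → Steps b κ pool x l z k → used ⊑ pool → length used + k ≤ κ → Woven b x l z k used pool
  weave used done h le = woven [] [] stop ↭-refl refl h
  weave used (direct {y = y} {l = l} e s) h le =
    let woven new vs p π len i = weave used s h le in
    woven new (y ∷ vs) (e ◂ p) (prep y π) len i
  weave {κ = κ} {pool} used (insert {y = y} {l = l} {k = k} m s) h le =
    let c , xc , cy , h′ = fresh-common κ pool used k m h le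
        woven new vs p π len i = weave (c ∷ used) s h′ (weave-le (length used) k κ le) in
    woven (c ∷ new) (c ∷ y ∷ vs) (xc ◂ cy ◂ p)
      (↭-trans (prep c (prep y π)) (weave-perm₁ c y l new)) (cong suc len) (↭-⊑ (weave-perm₂ c new used) i)

  mem : List V → V → Bool
  mem []       v = false
  mem (x ∷ xs) v = does (x ≟ v) ∨ mem xs v

  mem-∈ : ∀ {xs v} → mem xs v ≡ true → v ∈ xs
  mem-∈ {x ∷ xs} {v} h with x ≟ v
  ... | yes refl = here refl
  ... | no  _    = there (mem-∈ {xs} h)

  ∈-mem : ∀ {xs v} → v ∈ xs → mem xs v ≡ true
  ∈-mem {x ∷ xs} {v} h with x ≟ v | h
  ... | yes _  | _          = refl
  ... | no x≢v | here refl  = ⊥-elim (x≢v refl)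
  ... | no _   | there k    = ∈-mem k

  ∉-mem : ∀ {xs v} → ¬ v ∈ xs → mem xs v ≡ false
  ∉-mem {xs} {v} h with bool? (mem xs v)
  ... | inj₁ t = ⊥-elim (h (mem-∈ {xs} t))
  ... | inj₂ f = f

  not-true : ∀ {b} → not b ≡ true → b ≡ false
  not-true {false} _ = refl

  not-false : ∀ {b} → b ≡ false → not b ≡ true
  not-false refl = refl

  cnt-all : ∀ p xs → (∀ {x} → x ∈ xs → p x ≡ true) → cnt p xs ≡ length xs
  cnt-all p []       h = refl
  cnt-all p (x ∷ xs) h rewrite h (here refl) = cong suc (cnt-all p xs (h ∘ there))

  ⊑-disjoint : ∀ {xs ys A x} → Unique A → xs ++ ys ⊑ A → x ∈ xs → ¬ x ∈ ys
  ⊑-disjoint {x ∷ xs} u h (here refl) y∈ = Unique-≢ u h (∈-++⁺ʳ xs y∈) refl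
  ⊑-disjoint {x ∷ xs} u h (there i)   y∈ = ⊑-disjoint u (⊑-dropˡ [ x ] _ h) i y∈

  ∈-∷-⊑ : ∀ {x xs ys} → xs ⊑ ys → x ∈ ys → ¬ x ∈ xs → x ∷ xs ⊑ ys
  ∈-∷-⊑ {x} {xs} (zs , π) x∈ x∉ with ∈-++⁻ xs (∈-resp-↭ π x∈)
  ... | inj₁ i = ⊥-elim (x∉ i)
  ... | inj₂ i with ws , σ ← ∈-take i = ws , ↭-trans π (↭-trans (++⁺ˡ xs σ) (shift x xs ws))

  pair-⊑ : ∀ {x y xs} → x ∈ xs → y ∈ xs → x ≢ y → x ∷ y ∷ [] ⊑ xs
  pair-⊑ x∈ y∈ x≢y = ∈-∷-⊑ (∈-⊑ y∈) x∈ λ { (here refl) → x≢y refl }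

  Clique-⊑ : ∀ {b xs ys} → xs ⊑ ys → Clique b ys → Clique b xs
  Clique-⊑ h k x∈ y∈ = k (⊑-∈ h x∈) (⊑-∈ h y∈)

  Adj-other : ∀ {a b x y} → a ≢ b → x ≢ y → E b x y ≡ false → Adj a x y
  Adj-other a≢b x≢y f with E-dich a≢b x≢y
  ... | inj₁ e = e
  ... | inj₂ e = true≢false e f

  Adj-not : ∀ {a b x y} → a ≢ b → Adj a x y → E b x y ≡ false
  Adj-not {a} {b} {x} {y} a≢b e with bool? (E b x y)
  ... | inj₁ t = ⊥-elim (E-excl a≢b e t)
  ... | inj₂ f = f

  clique-∷ : ∀ {b x xs} → (∀ {y} → y ∈ xs → x ≢ y → Adj b x y) → Clique b xs → Clique b (x ∷ xs)
  clique-∷ h k (here refl) (here refl) x≢y = ⊥-elim (x≢y refl)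
  clique-∷ h k (here refl) (there j)   x≢y = h j x≢y
  clique-∷ h k (there i)   (here refl) x≢y = E-sym (h i (x≢y ∘ sym))
  clique-∷ h k (there i)   (there j)   x≢y = k i j x≢y

  edge-perm = shuffle 3 1 (λ x y z zs → x ◃ y ◃ z ◃ zs ⇄ y ◃ z ◃ x ◃ zs)

  edge-or-clique : ∀ {a b} → a ≢ b → ∀ xs → Unique xs →
                   (∃₂ λ x y → ∃ λ zs → Adj b x y × xs ↭ x ∷ y ∷ zs) ⊎ Clique a xs
  edge-or-clique a≢b []       u = inj₂ λ ()
  edge-or-clique {a} {b} a≢b (x ∷ xs) (_ AllPairs.∷ u) with find? (E b x) xs | edge-or-clique a≢b xs u
  ... | inj₁ (y , y∈ , e) | _ = let zs , π = ∈-take y∈ in inj₁ (x , y , zs , e , prep x π)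
  ... | inj₂ _ | inj₁ (y , z , zs , e , π) = inj₁ (y , z , x ∷ zs , e , ↭-trans (prep x π) (edge-perm x y z zs))
  ... | inj₂ none | inj₂ k = inj₂ (clique-∷ (λ j x≢y → Adj-other a≢b x≢y (none j)) k)

  half = farkas 2 (λ k c → 2 :* k :≤ 2 :* c :+ con 1 :⇒ (con 1 :+ c) :≤ k :⇒ ⊢⊥) 0 (1 ∷ 2 ∷ [])

  halve : ∀ {k c} → 2 * k ≤ 2 * c + 1 → k ≤ c
  halve {k} {c} h with k ≤? c
  ... | yes i = i
  ... | no  i = ⊥-elim (half k c h (≰⇒> i))

  parity : ∀ n → (∃ λ k → n ≡ 2 * k) ⊎ (∃ λ k → suc n ≡ 2 * k)
  parity zero = inj₁ (0 , refl)
  parity (suc n) with parity n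
  ... | inj₁ (k , e) = inj₂ (suc k , trans (cong (suc ∘ suc) e) (double k))
    where
    double = farkas-≡ 1 (λ k → ⊢ con 2 :+ 2 :* k := 2 :* (con 1 :+ k)) 0 []

  ... | inj₂ (k , e) = inj₁ (k , e)

  cycle-at-perm₁ = shuffle 2 2 (λ y x post pre → y ◃ post ⧺ pre ⧺ x ◃ ε ⇄ pre ⧺ x ◃ y ◃ post)

  cycle-at : ∀ {b x₀ l x} → Path b x₀ l x₀ → x ∈ l → ∃ λ x′ → CycleAt b x x′ l
  cycle-at {x₀ = x₀} {l} {x} p x∈ with ∈-∃++ x∈
  ... | pre , [] , refl with refl ← unsnoc pre x p = first p
    where
    first : ∀ {l} → Path _ x (l ++ [ x ]) x → ∃ λ x′ → CycleAt _ x x′ (l ++ [ x ])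
    first {[]}    (e ◂ q) = _ , at [] q e ↭-refl
    first {_ ∷ _} (e ◂ q) = _ , at _ q e ↭-refl
  ... | pre , y ∷ post , refl with p₁ , e ◂ p₂ ← split pre x (y ∷ post) p =
    y , at (post ++ pre ++ [ x ]) (p₂ ▸ p₁) e (cycle-at-perm₁ y x post pre)

  2+ : ∀ {k} → 2 ≤ k → ∃ λ j → k ≡ 2 + j
  2+ (s≤s (s≤s {n = j} z≤n)) = j , refl

  3+ : ∀ {k} → 3 ≤ k → ∃ λ j → k ≡ 3 + j
  3+ (s≤s (s≤s (s≤s {n = j} z≤n))) = j , refl

  -- Lengthening monochromatic cycles

  outside-perm₁ = shuffle 1 2 (λ u C U → C ⧺ u ◃ U ⇄ (u ◃ C) ⧺ U)
  outside-perm₂ = shuffle 2 2 (λ u v C U → C ⧺ u ◃ v ◃ U ⇄ (u ◃ v ◃ C) ⧺ U)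
  cross-perm = shuffle 4 2 (λ u x u′ z l m → (u ◃ (x ◃ l)) ⧺ u′ ◃ z ◃ m ⇄ u ◃ u′ ◃ (x ◃ l) ⧺ z ◃ m)
  grow-perm = shuffle 1 2 (λ x Us D → x ◃ Us ⧺ D ⇄ Us ⧺ x ◃ D)

  union-count = farkas 3 (λ l o c → 2 :* o :≤ l :⇒ l :≤ o :+ c :⇒ ⊢ l :≤ 2 :* c) 0 (1 ∷ 2 ∷ [])
  out-pairs₁ = farkas 2 (λ c r → 2 :* c :≤ r :⇒ ⊢ 2 :* (con 1 :+ c) :≤ (con 1 :+ r) :+ con 1) 0 (1 ∷ [])
  out-pairs₂ = farkas 4 (λ c d r s → 2 :* c :≤ r :⇒ 2 :* d :≤ s :⇒ ⊢ 2 :* ((con 1 :+ c) :+ (con 1 :+ d)) :≤ (con 1 :+ r) :+ (con 1 :+ s) :+ con 2) 0 (1 ∷ 1 ∷ [])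
  le₂ = farkas 2 (λ a l → a :≤ l :⇒ ⊢ a :≤ l :+ con 2) 0 (1 ∷ [])
  le₁₂ = farkas 2 (λ a l → a :≤ l :+ con 1 :⇒ ⊢ a :≤ l :+ con 2) 0 (1 ∷ [])
  open-slot = farkas 4 (λ c l k u → 2 :* c :≤ k :⇒ u :≤ c :⇒ k :≤ l :⇒ l :+ con 3 :≤ 2 :* u :⇒ ⊢⊥) 0 (1 ∷ 2 ∷ 1 ∷ 1 ∷ [])
  too-few-out = farkas 6
    (λ o l d z u k → 2 :* o :≤ l :+ con 2 :⇒ z :≤ o :⇒ l := d :+ z :⇒ k := u :+ d :⇒ k :≤ l :⇒ l :+ con 3 :≤ 2 :* u :⇒ ⊢⊥)
    0 (1 ∷ 2 ∷ 2 ∷ 0 ∷ 0 ∷ 2 ∷ 2 ∷ 1 ∷ [])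
  fuel-step = farkas 3 (λ l k n → l :≤ k :+ (con 1 :+ n) :⇒ ⊢ l :≤ (con 1 :+ k) :+ n) 0 (1 ∷ [])
  fuel-zero = farkas 2 (λ l k → l :≤ k :+ con 0 :⇒ ⊢ (con 1 :+ l) :≤ (con 1 :+ k)) 0 (1 ∷ [])

  ∨-true : ∀ {a b} → a ∨ b ≡ true → a ≡ true ⊎ b ≡ true
  ∨-true {true}  _ = inj₁ refl
  ∨-true {false} h = inj₂ h

  module LongestCycle
    {a b : Bool} (a≢b : a ≢ b) {S : List V} (unique : Unique S) {ℓ : ℕ} (ℓ≥3 : 3 ≤ ℓ)
    (longest : ∀ c {k} → suc ℓ ≤ k → Cycle c k S → ⊥)
    {x₀ : V} {C U : List V} (C-path : Path a x₀ C x₀) (C-length : length C ≡ ℓ) (S-split : S ↭ C ++ U)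
    where

    longer : ∀ {c x L} → Path c x L x → suc ℓ ≤ length L → L ⊑ S → ⊥
    longer {L = L} p le h = longest _ le (cycle L p refl h)

    outside₁ : ∀ {u L} → u ∈ U → L ↭ C → u ∷ L ⊑ S
    outside₁ {u} u∈ π = let zs , σ = ∈-take u∈ in
      ↭-⊑ (prep u π) (zs , ↭-trans S-split (↭-trans (++⁺ˡ C σ) (outside-perm₁ u C zs)))

    outside₂ : ∀ {u v L} → u ∷ v ∷ [] ⊑ U → L ↭ C → u ∷ v ∷ L ⊑ S
    outside₂ {u} {v} (zs , σ) π =
      ↭-⊑ (prep u (prep v π)) (zs , ↭-trans S-split (↭-trans (++⁺ˡ C σ) (outside-perm₂ u v C zs)))

    C⊑S : C ⊑ S
    C⊑S = U , S-split

    C-unique : Unique C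
    C-unique = Unique-⊑ unique C⊑S

    U-unique : Unique U
    U-unique = Unique-⊑ unique (⊑-dropˡ C U ([] , ↭-trans S-split (↭-reflexive (sym (++-identityʳ≡ (C ++ U))))))

    ∉C : ∀ {u} → u ∈ U → ¬ u ∈ C
    ∉C u∈ u∈C = ⊑-disjoint unique ([] , ↭-trans S-split (↭-reflexive (sym (++-identityʳ≡ (C ++ U))))) u∈C u∈

    longer-perm : ∀ {x L} → x ∷ L ↭ C → length (x ∷ L) ≡ ℓ
    longer-perm π = trans (↭-length π) C-length

    F₁ : ∀ {u x x′} → CycleAt a x x′ C → u ∈ U → Adj a u x → Adj a u x′ → ⊥
    F₁ (at rest back forth perm) u∈ ux ux′ =
      longer (E-sym ux ◂ ux′ ◂ back) (≤-reflexive (cong suc (sym (longer-perm perm)))) (outside₁ u∈ perm)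

    F₂ : ∀ {u u′ x x′} → CycleAt a x x′ C → u ∷ u′ ∷ [] ⊑ U → Adj a u u′ → Adj a u x → Adj a u′ x′ → ⊥
    F₂ (at rest back forth perm) h uu′ ux ux′ =
      longer (E-sym ux ◂ uu′ ◂ ux′ ◂ back) (≤-trans (≤-reflexive (cong suc (sym (longer-perm perm)))) (m≤n⇒m≤1+n ≤-refl))
        (outside₂ h perm)

    -- The vertex `w` is given up for `u` and `u′`, a net gain of one.
    F₂′ : ∀ {u u′ x w x″ rest} → Path a x″ rest x → w ∷ x″ ∷ rest ↭ C → u ∷ u′ ∷ [] ⊑ U →
          Adj a u u′ → Adj a u x → Adj a u′ x″ → ⊥
    F₂′ {u} {u′} {w = w} {x″} {rest} back perm h uu′ ux ux″ =
      longer (E-sym ux ◂ uu′ ◂ ux″ ◂ back) (≤-reflexive (cong suc (sym (longer-perm perm))))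
        (let zs , σ = outside₂ h ↭-refl in
         w ∷ zs , ↭-trans σ (↭-trans (++⁺ʳ zs (prep u (prep u′ (↭-sym perm)))) (drop-mid₂ u u′ w x″ rest zs)))
      where
      drop-mid₂ = shuffle 4 2 (λ u u′ w x rest zs → (u ◃ u′ ◃ w ◃ x ◃ rest) ⧺ zs ⇄ (u ◃ u′ ◃ x ◃ rest) ⧺ w ◃ zs)

    -- Two edges of the cycle that lie parallel to the pair u, u′: exchanging them for the four edges to u and u′
    -- reverses one arc and gains two vertices.
    F₃ : ∀ {u u′ x x′ z z′ l m} → Path a x′ l z → Adj a z z′ → Path a z′ m x → Adj a x x′ → (x′ ∷ l) ++ z′ ∷ m ↭ C →
         u ∷ u′ ∷ [] ⊑ U → Adj a u x → Adj a u′ x′ → Adj a u z → Adj a u′ z′ → ⊥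
    F₃ {u} {u′} {x} {x′} {z} {z′} {l} {m} P zz′ Q xx′ perm h ux u′x′ uz u′z′ =
      let r , R , ρ , _ = rev P
          π : (u ∷ (z ∷ r)) ++ u′ ∷ z′ ∷ m ↭ u ∷ u′ ∷ ((x′ ∷ l) ++ z′ ∷ m)
          π = ↭-trans (++⁺ʳ (u′ ∷ z′ ∷ m) (prep u ρ)) (cross-perm u x′ u′ z′ l m)
      in longer (E-sym ux ◂ uz ◂ R ▸ E-sym u′x′ ◂ u′z′ ◂ Q)
           (≤-trans (≤-trans (≤-reflexive (cong suc (sym (longer-perm perm)))) (m≤n⇒m≤1+n ≤-refl)) (≤-reflexive (sym (↭-length π))))
           (↭-⊑ (↭-trans π (prep u (prep u′ perm))) (outside₂ h ↭-refl))

    seen : V → V → V → Bool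
    seen u u′ x = E a u x ∨ E a u′ x

    seen-clash : ∀ {u u′ x x′} → u ∷ u′ ∷ [] ⊑ U → Adj a u u′ → CycleAt a x x′ C → seen u u′ x ≡ true → seen u u′ x′ ≡ true → ⊥
    seen-clash {u} {u′} h uu′ c s s′ with ∨-true {E a u _} s | ∨-true {E a u _} s′
    ... | inj₁ p | inj₁ q = F₁ c (⊑-∈ h (here refl)) p q
    ... | inj₁ p | inj₂ q = F₂ c h uu′ p q
    ... | inj₂ p | inj₁ q = F₂ c (↭-⊑ (swap u′ u ↭-refl) h) (E-sym uu′) p q
    ... | inj₂ p | inj₂ q = F₁ c (⊑-∈ h (there (here refl))) p q

    -- Between two consecutive seen vertices `u`, `u′` or both could be inserted, so no two
    -- consecutive vertices of `C` are seen.
    seen-sparse : ∀ {u u′} → u ∷ u′ ∷ [] ⊑ U → Adj a u u′ → 2 * cnt (seen u u′) C ≤ ℓ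
    seen-sparse {u} {u′} h uu′ with scan (seen u u′) C-path
    ... | inj₂ le = ≤-trans (cancel ⟦ seen u u′ x₀ ⟧ (cnt (seen u u′) C) (length C) le) (≤-reflexive C-length)
      where
      cancel = farkas 3 (λ p c l → p :+ 2 :* c :≤ l :+ p :⇒ ⊢ 2 :* c :≤ l) 0 (1 ∷ [])
    ... | inj₁ s = ⊥-elim (seen-clash h uu′ (rotate s) (src-p s) (tgt-q s))

    seen-or-common : ∀ {u u′} → u ∷ u′ ∷ [] ⊑ U → ℓ ≤ cnt (seen u u′) C + cnt (common b u u′) C
    seen-or-common {u} {u′} h = ≤-trans (≤-reflexive (sym C-length)) (cnt-cover (seen u u′) (common b u u′) C cover)
      where
      cover : ∀ {x} → x ∈ C → 1 ≤ ⟦ seen u u′ x ⟧ + ⟦ common b u u′ x ⟧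
      cover {x} x∈ with bool? (E a u x) | bool? (E a u′ x)
      ... | inj₁ p | _      rewrite p = s≤s z≤n
      ... | inj₂ p | inj₁ q rewrite p | q = s≤s z≤n
      ... | inj₂ p | inj₂ q
        rewrite p | q
              | Adj-other (a≢b ∘ sym) (λ { refl → ∉C (⊑-∈ h (here refl)) x∈ }) p
              | Adj-other (a≢b ∘ sym) (λ { refl → ∉C (⊑-∈ h (there (here refl))) x∈ }) q = ≤-refl

    slot₁ = shuffle 2 2 (λ x z l m → z ◃ m ⧺ x ◃ l ⇄ x ◃ l ⧺ z ◃ m)
    slot₂ = shuffle 3 3 (λ x z t l k m → t ◃ k ⧺ z ◃ m ⧺ x ◃ l ⇄ x ◃ (l ⧺ t ◃ k) ⧺ z ◃ m)
    slot₃ = shuffle 3 3 (λ x z t l k m → (x ◃ l) ⧺ t ◃ k ⧺ z ◃ m ⇄ x ◃ (l ⧺ t ◃ k) ⧺ z ◃ m)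
    slot₄ = shuffle 3 3 (λ x z t l k m → t ◃ m ⧺ x ◃ l ⧺ z ◃ k ⇄ x ◃ l ⧺ z ◃ k ⧺ t ◃ m)
    slot₅ = shuffle 3 3 (λ x z t l k m → (x ◃ l ⧺ z ◃ k) ⧺ t ◃ m ⇄ x ◃ l ⧺ z ◃ k ⧺ t ◃ m)
    slot₆ = shuffle 3 3 (λ x z t l k m → (z ◃ k) ⧺ t ◃ m ⧺ x ◃ l ⇄ x ◃ l ⧺ z ◃ k ⧺ t ◃ m)

    cancel₁ = farkas 2 (λ c l → con 1 :+ 2 :* c :≤ l :+ con 1 :⇒ ⊢ 2 :* c :≤ l) 0 (1 ∷ [])

    -- The blue cycles with vertices Us outside C and D on C.
    module Extend {Us : List V} (Us⊑U : Us ⊑ U) (many : ℓ + 3 ≤ 2 * length Us) where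

      module Slot {u u′ D} (D⊑C : D ⊑ C) (h : u ∷ u′ ∷ [] ⊑ U)
                  (blocked : ∀ {x} → x ∈ C → not (mem D x) ≡ true → Adj a u x ⊎ Adj a u′ x) where

        out : V → Bool
        out x = not (mem D x)

        out-∈ : ∀ {x x′} → CycleAt a x x′ C → x ∈ C × x′ ∈ C
        out-∈ (at rest back forth perm) = ∈-resp-↭ perm (last∈ back) , ∈-resp-↭ perm (here refl)

        -- The orientation of an edge of C whose ends are both outside D.
        orient : ∀ {x x′} → CycleAt a x x′ C → out x ≡ true → out x′ ≡ true →
                 (Adj a u x × Adj a u′ x′) ⊎ (Adj a u′ x × Adj a u x′)
        orient c ox ox′ with blocked (proj₁ (out-∈ c)) ox | blocked (proj₂ (out-∈ c)) ox′
        ... | inj₁ p | inj₁ q = ⊥-elim (F₁ c (⊑-∈ h (here refl)) p q)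
        ... | inj₁ p | inj₂ q = inj₁ (p , q)
        ... | inj₂ p | inj₁ q = inj₂ (p , q)
        ... | inj₂ p | inj₂ q = ⊥-elim (F₁ c (⊑-∈ h (there (here refl))) p q)

        half-out : ∀ {x y l} → Path a x l y → out x ≡ true → out y ≡ true → Consecutive a out out x l y ⊎ 2 * cnt out l ≤ length l
        half-out {l = l} p ox oy with scan out p
        ... | inj₁ s = inj₁ s
        ... | inj₂ le rewrite ox | oy = inj₂ (cancel₁ (cnt out l) (length l) le)

        cnt-out : ∀ {x l} → x ∷ l ↭ C → out x ≡ true → cnt out C ≡ suc (cnt out l)
        cnt-out {x} {l} π ox = trans (sym (cnt-↭ out π)) (cong (λ t → ⟦ t ⟧ + cnt out l) ox)

        Orient : V → V → Set
        Orient w w′ = ∀ {x x′} → CycleAt a x x′ C → out x ≡ true → out x′ ≡ true →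
                      (Adj a w x × Adj a w′ x′) ⊎ (Adj a w′ x × Adj a w x′)

        -- A pair of consecutive vertices outside `D` is joined to `w` and `w′` in one of two
        -- orientations, and `F₃` forbids two pairs with the same one. So there are at most two such
        -- pairs, and each raises the bound on twice the count above `ℓ` by one.
        oriented : ∀ {w w′} → w ∷ w′ ∷ [] ⊑ U → w′ ∷ w ∷ [] ⊑ U → Orient w w′ →
                   ∀ {x x′ rest} → Path a x′ rest x → Adj a x x′ → x′ ∷ rest ↭ C → out x ≡ true → out x′ ≡ true →
                   Adj a w x → Adj a w′ x′ → 2 * cnt out C ≤ ℓ + 2
        oriented hw hw′ or {x} {x′} {rest} P xx′ perm ox ox′ wx w′x′ with half-out P ox′ ox
        ... | inj₂ le = le₁₂ _ ℓ (≤-trans (≤-reflexive (cong (2 *_) (cnt-out perm ox′)))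
                          (≤-trans (out-pairs₁ (cnt out rest) (length rest) le) (≤-reflexive (cong (_+ 1) (longer-perm perm)))))
        ... | inj₁ (consec {z} {z′} l m P₁ zz′ P₂ oz oz′ refl)
          with or (at (m ++ x′ ∷ l) (P₂ ▸ xx′ ◂ P₁) zz′ (↭-trans (slot₁ x′ z′ l m) perm)) oz oz′
        ...   | inj₁ (wz , w′z′) = ⊥-elim (F₃ P₁ zz′ P₂ xx′ perm hw wx w′x′ wz w′z′)
        ...   | inj₂ (w′z , wz′) with half-out P₁ ox′ oz | half-out P₂ oz′ ox
        ...     | inj₁ (consec {t} {t′} k₁ k₂ Q₁ tt′ Q₂ ot ot′ refl) | _
          with or (at (k₂ ++ z′ ∷ m ++ x′ ∷ k₁) (Q₂ ▸ zz′ ◂ P₂ ▸ xx′ ◂ Q₁) tt′ (↭-trans (slot₂ x′ z′ t′ k₁ k₂ m) perm)) ot ot′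
        ...       | inj₁ (wt , w′t′) =
          ⊥-elim (F₃ Q₁ tt′ (Q₂ ▸ zz′ ◂ P₂) xx′ (↭-trans (slot₃ x′ z′ t′ k₁ k₂ m) perm) hw wx w′x′ wt w′t′)
        ...       | inj₂ (w′t , wt′) =
          ⊥-elim (F₃ Q₂ zz′ (P₂ ▸ xx′ ◂ Q₁) tt′ (↭-trans (slot₂ x′ z′ t′ k₁ k₂ m) perm) hw′ w′t wt′ w′z wz′)
        oriented hw hw′ or {x} {x′} {rest} P xx′ perm ox ox′ wx w′x′
                | inj₁ (consec {z} {z′} l m P₁ zz′ P₂ oz oz′ refl) | inj₂ (w′z , wz′)
                | _ | inj₁ (consec {t} {t′} k₁ k₂ Q₁ tt′ Q₂ ot ot′ refl)
          with or (at (k₂ ++ x′ ∷ l ++ z′ ∷ k₁) (Q₂ ▸ xx′ ◂ P₁ ▸ zz′ ◂ Q₁) tt′ (↭-trans (slot₄ x′ z′ t′ l k₁ k₂) perm)) ot ot′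
        ...       | inj₁ (wt , w′t′) =
          ⊥-elim (F₃ (P₁ ▸ zz′ ◂ Q₁) tt′ Q₂ xx′ (↭-trans (slot₅ x′ z′ t′ l k₁ k₂) perm) hw wx w′x′ wt w′t′)
        ...       | inj₂ (w′t , wt′) =
          ⊥-elim (F₃ Q₁ tt′ (Q₂ ▸ xx′ ◂ P₁) zz′ (↭-trans (slot₆ x′ z′ t′ l k₁ k₂) perm) hw′ w′z wz′ w′t wt′)
        oriented hw hw′ or {x} {x′} {rest} P xx′ perm ox ox′ wx w′x′
                | inj₁ (consec {z} {z′} l m P₁ zz′ P₂ oz oz′ refl) | inj₂ (w′z , wz′)
                | inj₂ le₁ | inj₂ le₂ =
          ≤-trans (≤-reflexive (cong (2 *_) count))
            (≤-trans (out-pairs₂ (cnt out l) (cnt out m) (length l) (length m) le₁ le₂)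
              (≤-reflexive (cong (_+ 2) (trans (sym (length-++ (x′ ∷ l))) (longer-perm perm)))))
          where
          count : cnt out C ≡ suc (cnt out l) + suc (cnt out m)
          count = trans (sym (cnt-↭ out perm)) (trans (cnt-++ out (x′ ∷ l) (z′ ∷ m))
            (cong₂ (λ s t → (⟦ s ⟧ + cnt out l) + (⟦ t ⟧ + cnt out m)) ox′ oz′))

        few-out : 2 * cnt out C ≤ ℓ + 2
        few-out with scan out C-path
        ... | inj₂ le = le₂ _ ℓ (≤-trans (cancel₀ ⟦ out x₀ ⟧ (cnt out C) (length C) le) (≤-reflexive C-length))
          where
          cancel₀ = farkas 3 (λ p c l → p :+ 2 :* c :≤ l :+ p :⇒ ⊢ 2 :* c :≤ l) 0 (1 ∷ [])
        ... | inj₁ s with rotate s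
        ...   | c@(at rest back forth perm) with orient c (src-p s) (tgt-q s)
        ...     | inj₁ (p , q) = oriented h h′ orient back forth perm (src-p s) (tgt-q s) p q
          where
          h′ : u′ ∷ u ∷ [] ⊑ U
          h′ = ↭-⊑ (swap u′ u ↭-refl) h
        ...     | inj₂ (p , q) = oriented h′ h orient′ back forth perm (src-p s) (tgt-q s) p q
          where
          h′ : u′ ∷ u ∷ [] ⊑ U
          h′ = ↭-⊑ (swap u′ u ↭-refl) h
          orient′ : Orient u′ u
          orient′ c ox ox′ with orient c ox ox′
          ... | inj₁ i = inj₂ i
          ... | inj₂ i = inj₁ i

      -- More than half of a blue cycle with at most `ℓ` vertices lies in `Us`, so two consecutive
      -- vertices lie outside `C`. A common blue neighbour in `C` but not in `D` is inserted between
      -- them; if there is none, `few-out` makes `D` so large that the cycle has more than `ℓ`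
      -- vertices already. `n` is fuel: when it is used up, the length is at least `ℓ` and one
      -- further insertion is too much.
      extend : ∀ n {D u₀ L} → D ⊑ C → Path b u₀ L u₀ → L ↭ Us ++ D → ℓ ≤ length L + n → ⊥
      extend n {D} {u₀} {L} D⊑C p π le with length L ≤? ℓ
      ... | no  i = longer p (≰⇒> i) (↭-⊑ π Us++D⊑S)
        where
        Us++D⊑S : Us ++ D ⊑ S
        Us++D⊑S = ⊑-↭ (⊑-++ Us⊑U D⊑C) (↭-trans S-split (swap-perm C U))
          where
          swap-perm = shuffle 0 2 (λ C U → C ⧺ U ⇄ U ⧺ C)
      ... | yes L≤ℓ with scan (λ v → not (mem C v)) p
      ... | inj₂ h = open-slot (cnt off L) ℓ (length L) (length Us) (cancel ⟦ off u₀ ⟧ (cnt off L) (length L) h) Us≤ L≤ℓ many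
        where
        off : V → Bool
        off v = not (mem C v)
        Us≤ : length Us ≤ cnt off L
        Us≤ = ≤-trans (≤-reflexive (sym (cnt-all off Us λ i → not-false (∉-mem {C} (∉C (⊑-∈ Us⊑U i))))))
                (≤-trans (m≤m+n _ (cnt off D)) (≤-reflexive (sym (trans (cnt-↭ off π) (cnt-++ off Us D)))))
        cancel = farkas 3 (λ p c l → p :+ 2 :* c :≤ l :+ p :⇒ ⊢ 2 :* c :≤ l) 0 (1 ∷ [])
      ... | inj₁ s = slot n (rotate s) (src-p s) (tgt-q s) le
        where
        in-U : ∀ {v} → v ∈ L → not (mem C v) ≡ true → v ∈ U
        in-U {v} v∈ o with ∈-++⁻ Us (∈-resp-↭ π v∈)
        ... | inj₁ i = ⊑-∈ Us⊑U i
        ... | inj₂ i = true≢false (∈-mem (⊑-∈ D⊑C i)) (not-true o)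

        slot : ∀ n {u u′} → CycleAt b u u′ L → not (mem C u) ≡ true → not (mem C u′) ≡ true → ℓ ≤ length L + n → ⊥
        slot n {u} {u′} (at rest back forth perm) ou ou′ le with find? (λ x → not (mem D x) ∧ (E b u x ∧ E b u′ x)) C
        ... | inj₁ (x , x∈ , px) = grow n le (∧-true px)
          where
          cyc : Adj b u x → Adj b u′ x → Path b u (x ∷ u′ ∷ rest) u
          cyc ux u′x = ux ◂ E-sym u′x ◂ back
          perm′ : x ∷ u′ ∷ rest ↭ Us ++ x ∷ D
          perm′ = ↭-trans (prep x (↭-trans perm π)) (grow-perm x Us D)
          len′ : length (x ∷ u′ ∷ rest) ≡ suc (length L)
          len′ = cong suc (↭-length perm)
          D′⊑C : not (mem D x) ≡ true → x ∷ D ⊑ C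
          D′⊑C o = ∈-∷-⊑ D⊑C x∈ λ i → true≢false (∈-mem i) (not-true o)
          grow : ∀ n → ℓ ≤ length L + n → not (mem D x) ≡ true × E b u x ∧ E b u′ x ≡ true → ⊥
          grow zero le (o , e) = longer (cyc (proj₁ (∧-true e)) (proj₂ (∧-true {E b u x} e)))
            (≤-trans (fuel-zero ℓ (length L) le) (≤-reflexive (sym len′)))
            (↭-⊑ perm′ (⊑-↭ (⊑-++ Us⊑U (D′⊑C o)) (↭-trans S-split (swap-perm C U))))
            where
            swap-perm = shuffle 0 2 (λ C U → C ⧺ U ⇄ U ⧺ C)
          grow (suc n) le (o , e) = extend n (D′⊑C o) (cyc (proj₁ (∧-true e)) (proj₂ (∧-true {E b u x} e))) perm′
            (≤-trans (fuel-step ℓ (length L) n le) (≤-reflexive (cong (_+ n) (sym len′))))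
        ... | inj₂ none =
          too-few-out (cnt out C) ℓ (length D) (length Z) (length Us) (length L) few-out Z≤
            (trans (sym C-length) (trans (↭-length σ) (length-++ D))) (trans (↭-length π) (length-++ Us)) L≤ℓ many
          where
          Z = proj₁ D⊑C
          σ = proj₂ D⊑C
          u∈ : u ∈ U
          u∈ = in-U (∈-resp-↭ perm (last∈ back)) ou
          u′∈ : u′ ∈ U
          u′∈ = in-U (∈-resp-↭ perm (here refl)) ou′
          blocked : ∀ {x} → x ∈ C → not (mem D x) ≡ true → Adj a u x ⊎ Adj a u′ x
          blocked {x} x∈ o with bool? (E b u x) | bool? (E b u′ x)
          ... | inj₁ p  | inj₁ q = true≢false (true-∧ o (true-∧ p q)) (none x∈)
          ... | inj₂ p  | _      = inj₁ (Adj-other a≢b (λ { refl → ∉C u∈ x∈ }) p)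
          ... | inj₁ _  | inj₂ q = inj₂ (Adj-other a≢b (λ { refl → ∉C u′∈ x∈ }) q)
          open Slot {D = D} D⊑C (pair-⊑ u∈ u′∈ (Adj-≢ forth)) blocked
          Z≤ : length Z ≤ cnt out C
          Z≤ = ≤-trans (≤-reflexive (sym (cnt-all out Z λ i → not-false (∉-mem {D} λ j → ⊑-disjoint C-unique ([] , ↭-trans σ (↭-reflexive (sym (++-identityʳ≡ (D ++ Z))))) j i))))
                 (≤-trans (m≤n+m _ (cnt out D)) (≤-reflexive (sym (trans (cnt-↭ out σ) (cnt-++ out D Z)))))

    -- The first two bounds say that `κ` is half of `ℓ`, rounded up.
    module Parity {κ} (κ≤ : 2 * κ ≤ ℓ + 1) (≤κ : ℓ ≤ 2 * κ) (room : κ + 2 ≤ length U) where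

      κ-common = farkas 3 (λ k l c → 2 :* k :≤ l :+ con 1 :⇒ l :≤ 2 :* c :⇒ ⊢ 2 :* k :≤ 2 :* c :+ con 1) 0 (1 ∷ 1 ∷ [])
      -- The ends of a red edge see at most half of `C`; the remaining vertices of `C` are common
      -- blue neighbours.
      step : ∀ {x y} → x ∷ y ∷ [] ⊑ U → Adj b x y ⊎ Adj a x y × κ ≤ cnt (common b x y) C
      step {x} {y} h with E-dich a≢b (Unique-≢ U-unique h (here refl))
      ... | inj₂ e = inj₁ e
      ... | inj₁ e = inj₂ (e , halve (κ-common κ ℓ (cnt (common b x y) C) κ≤
                       (union-count ℓ (cnt (seen x y) C) (cnt (common b x y) C) (seen-sparse h e) (seen-or-common h))))

      walk : ∀ x us t {tail z k′} → x ∷ us ++ [ t ] ⊑ U → Steps b κ C t tail z k′ →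
             ∃ λ k → k ≤ suc (length us) × Steps b κ C x (us ++ t ∷ tail) z (k + k′)
      walk x [] t h s with step h
      ... | inj₁ e       = 0 , z≤n , direct e s
      ... | inj₂ (_ , m) = 1 , ≤-refl , insert m s
      walk x (u ∷ us) t h s with step (⊑-dropʳ (x ∷ u ∷ []) _ h) | walk u us t (⊑-dropˡ [ x ] _ h) s
      ... | inj₁ e       | k , le , r = k , m≤n⇒m≤1+n le , direct e r
      ... | inj₂ (_ , m) | k , le , r = suc k , s≤s le , insert m r

      -- The same walk along a red clique; each step needs a new vertex.
      walk-clique : ∀ x us t {tail z k′} → x ∷ us ++ [ t ] ⊑ U → Clique a (x ∷ us ++ [ t ]) → Steps b κ C t tail z k′ →
                    Steps b κ C x (us ++ t ∷ tail) z (suc (length us) + k′)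
      walk-clique x [] t h c s with step h
      ... | inj₁ e       = ⊥-elim (E-excl a≢b (c (here refl) (there (here refl)) (Adj-≢ e)) e)
      ... | inj₂ (_ , m) = insert m s
      walk-clique x (u ∷ us) t h c s with step (⊑-dropʳ (x ∷ u ∷ []) _ h)
      ... | inj₁ e       = ⊥-elim (E-excl a≢b (c (here refl) (there (here refl)) (Adj-≢ e)) e)
      ... | inj₂ (_ , m) = insert m (walk-clique u us t (⊑-dropˡ [ x ] _ h) (Clique-⊑ (⊑-dropˡ [ x ] _ ⊑-refl) c) s)

      many-le = farkas 3 (λ l k n → l :≤ 2 :* k :⇒ n := k :+ con 2 :⇒ ⊢ l :+ con 3 :≤ 2 :* n) 0 (1 ∷ 0 ∷ 2 ∷ [])
      -- With at most `κ` insertions the connecting vertices can be chosen distinct, and κ + 2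
      -- vertices outside `C` are enough for `Extend` to lengthen the resulting blue cycle beyond
      -- `ℓ`.
      closed : ∀ {us u₀ k} → us ⊑ U → Steps b κ C u₀ us u₀ k → k ≤ κ → length us ≡ κ + 2 → ⊥
      closed {us} {u₀} {k} h s le len =
        let woven new vs p π wl wi = weave [] s (C , ↭-refl) le in
        Extend.extend {Us = us} h (many-le ℓ κ (length us) ≤κ len) ℓ {D = new} (⊑-dropʳ new [] wi) p π (m≤n+m ℓ (length vs))

      len-take : ∀ n (xs : List V) → n ≤ length xs → length (take n xs) ≡ n
      len-take n xs h = trans (length-take n xs) (m≤n⇒m⊓n≡m h)

      room₁ = farkas 3 (λ k u r → k :+ con 2 :≤ u :⇒ u := con 3 :+ r :⇒ ⊢ k :≤ con 1 :+ r) 0 (1 ∷ 1 ∷ 0 ∷ [])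
      room₂ = farkas 3 (λ k u r → k :+ con 2 :≤ u :⇒ u := con 4 :+ r :⇒ ⊢ k :≤ con 2 :+ r) 0 (1 ∷ 1 ∷ 0 ∷ [])
      three-perm₁ = shuffle 3 2 (λ p q r T D → p ◃ q ◃ r ◃ T ⧺ D ⇄ (r ◃ T ⧺ p ◃ ε) ⧺ q ◃ D)
      three-perm₂ = shuffle 3 2 (λ p q r T D → p ◃ q ◃ r ◃ T ⧺ D ⇄ (T ⧺ p ◃ q ◃ r ◃ ε) ⧺ D)

      take-drop : ∀ n (xs : List V) → xs ↭ take n xs ++ drop n xs
      take-drop n xs = ↭-reflexive (sym (take++drop≡id n xs))
      -- A blue cycle through κ + 2 vertices of `U` has as many steps; the two given blue edges save
      -- two insertions, which leaves at most `κ`. In `four` the two edges are disjoint.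
      three : ∀ {p q r R κ′} → κ ≡ suc κ′ → Adj b p q → Adj b q r → U ↭ p ∷ q ∷ r ∷ R → ⊥
      three {p} {q} {r} {R} {κ′} refl pq qr π =
        let k , le , s = walk r T p sub (direct pq (direct qr done)) in
        closed (D , ↭-trans π′ (three-perm₂ p q r T D)) s
          (≤-trans (≤-reflexive (+-identityʳ k)) (≤-trans le (s≤s (≤-reflexive T-length))))
          (trans (length-++ T) (trans (cong (_+ 3) T-length) (add κ′)))
        where
        T = take κ′ R
        D = drop κ′ R
        T-length : length T ≡ κ′
        T-length = len-take κ′ R (s≤s⁻¹ (room₁ κ (length U) (length R) room (↭-length π)))
        π′ : U ↭ p ∷ q ∷ r ∷ T ++ D
        π′ = ↭-trans π (prep p (prep q (prep r (take-drop κ′ R))))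
        sub : r ∷ T ++ [ p ] ⊑ U
        sub = q ∷ D , ↭-trans π′ (three-perm₁ p q r T D)
        add = farkas-≡ 1 (λ k → ⊢ k :+ con 3 := con 1 :+ k :+ con 2) 0 []

      four-perm₁ = shuffle 4 2 (λ p q r s T D → p ◃ q ◃ r ◃ s ◃ T ⧺ D ⇄ (s ◃ T ⧺ p ◃ ε) ⧺ q ◃ r ◃ D)
      four-perm₂ = shuffle 4 2 (λ p q r s T D → p ◃ q ◃ r ◃ s ◃ T ⧺ D ⇄ (r ◃ s ◃ T ⧺ p ◃ q ◃ ε) ⧺ D)
      four-perm₃ = shuffle 4 1 (λ p q r s R → p ◃ q ◃ r ◃ s ◃ R ⇄ (q ◃ r ◃ ε) ⧺ p ◃ s ◃ R)
      four : ∀ {p q r s R κ′} → κ ≡ suc (suc κ′) → Adj b p q → Adj b r s → U ↭ p ∷ q ∷ r ∷ s ∷ R → ⊥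
      four {p} {q} {r} {s} {R} {κ′} refl pq rs π =
        let k , le , w   = walk s T p sub (direct pq done)
            k′ , le′ , w′ = walk q [] r sub′ (direct rs w) in
        closed (D , ↭-trans π′ (four-perm₂ p q r s T D)) w′
          (+-mono-≤ le′ (≤-trans (≤-reflexive (+-identityʳ k)) (≤-trans le (s≤s (≤-reflexive T-length)))))
          (cong (suc ∘ suc) (trans (length-++ T) (cong (_+ 2) T-length)))
        where
        T = take κ′ R
        D = drop κ′ R
        T-length : length T ≡ κ′
        T-length = len-take κ′ R (s≤s⁻¹ (s≤s⁻¹ (room₂ κ (length U) (length R) room (↭-length π))))
        π′ : U ↭ p ∷ q ∷ r ∷ s ∷ T ++ D
        π′ = ↭-trans π (prep p (prep q (prep r (prep s (take-drop κ′ R)))))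
        sub : s ∷ T ++ [ p ] ⊑ U
        sub = q ∷ r ∷ D , ↭-trans π′ (four-perm₁ p q r s T D)
        sub′ : q ∷ [] ++ [ r ] ⊑ U
        sub′ = p ∷ s ∷ R , ↭-trans π (four-perm₃ p q r s R)

      clique-perm₁ = shuffle 2 3 (λ u u′ T D Z → (u ◃ u′ ◃ T ⧺ D) ⧺ Z ⇄ (u′ ◃ T ⧺ u ◃ ε) ⧺ D ⧺ Z)
      clique-perm₂ = shuffle 3 2 (λ c u u′ T new → ((T ⧺ u ◃ ε) ⧺ new) ⧺ c ◃ u′ ◃ ε ⇄ (u′ ◃ T ⧺ u ◃ ε) ⧺ c ◃ new)
      clique-long = farkas 3 (λ l t n → l :+ con 1 :≤ 2 :* (con 2 :+ t) :⇒ n := ((t :+ con 1) :+ (con 1 :+ t)) :+ con 2 :⇒ ⊢ con 1 :+ l :≤ n) 0 (1 ∷ 0 ∷ 1 ∷ [])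
      -- The τ + 2 clique vertices need as many distinct connecting vertices. The step between `u`
      -- and `u′` is taken last and is the only one that requires τ + 2 choices; the others manage
      -- with τ + 1.
      clique-cycle : ∀ {u u′ R} τ κ′ → u ∷ u′ ∷ R ⊑ U → Clique a (u ∷ u′ ∷ R) → τ ≤ length R → suc τ ≤ κ →
                     κ′ ≤ cnt (common b u u′) C → suc (suc τ) ≤ κ′ → ℓ + 1 ≤ 2 * (2 + τ) → ⊥
      clique-cycle {u} {u′} {R} τ κ′ (Z , σ) cl τ≤ τ<κ com τ<κ′ long =
        let s = walk-clique u′ T u sub (Clique-⊑ sub-R cl) done
            woven new vs p π wl wi = weave [] s (C , ↭-refl) (≤-trans (≤-reflexive (trans (+-identityʳ _) (cong suc T-length))) τ<κ)
            new⊑C = ⊑-dropʳ new [] wi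
            wl′ = trans wl (trans (+-identityʳ _) (cong suc T-length))
            c , uc , cu′ , c⊑C = fresh-common κ′ C new 0 com new⊑C (≤-trans (≤-reflexive (trans (+-comm (length new) 1) (cong suc wl′))) τ<κ′)
            perm = ↭-trans (++⁺ʳ (c ∷ u′ ∷ []) π) (clique-perm₂ c u u′ T new)
        in longer (p ▸ uc ◂ edge cu′)
             (clique-long ℓ τ (length (vs ++ c ∷ u′ ∷ [])) long
               (trans (length-++ vs) (cong (_+ 2) (trans (↭-length π) (trans (length-++ (T ++ [ u ]))
                 (cong₂ _+_ (trans (length-++ T) (cong (_+ 1) T-length)) wl′))))))
             (↭-⊑ perm (⊑-↭ (⊑-++ sub c⊑C) (↭-trans S-split (CU C U))))
        where
        CU = shuffle 0 2 (λ C U → C ⧺ U ⇄ U ⧺ C)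
        T = take τ R
        D = drop τ R
        T-length : length T ≡ τ
        T-length = len-take τ R τ≤
        π′ : u ∷ u′ ∷ R ↭ u ∷ u′ ∷ T ++ D
        π′ = prep u (prep u′ (take-drop τ R))
        sub : u′ ∷ T ++ [ u ] ⊑ U
        sub = D ++ Z , ↭-trans σ (↭-trans (++⁺ʳ Z π′) (clique-perm₁ u u′ T D Z))
        sub-R : u′ ∷ T ++ [ u ] ⊑ u ∷ u′ ∷ R
        sub-R = D , ↭-trans π′ (perm₃ u u′ T D)
          where
          perm₃ = shuffle 2 2 (λ u u′ T D → u ◃ u′ ◃ T ⧺ D ⇄ (u′ ◃ T ⧺ u ◃ ε) ⧺ D)
      Touch : V → V → Set
      Touch u u′ = ∀ {x x′} → CycleAt a x x′ C → (Adj a u x ⊎ Adj a u′ x) ⊎ (Adj a u x′ ⊎ Adj a u′ x′)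

      touch-sym : ∀ {u u′} → Touch u u′ → Touch u′ u
      touch-sym t c with t c
      ... | inj₁ (inj₁ p) = inj₁ (inj₂ p)
      ... | inj₁ (inj₂ p) = inj₁ (inj₁ p)
      ... | inj₂ (inj₁ p) = inj₂ (inj₂ p)
      ... | inj₂ (inj₂ p) = inj₂ (inj₁ p)

      seen-⊎ : ∀ {u u′ x} → seen u u′ x ≡ true → Adj a u x ⊎ Adj a u′ x
      seen-⊎ {u} {u′} {x} = ∨-true {E a u x}

      many-seen = farkas 4 (λ k s c l → l := 2 :* k :⇒ l :≤ s :+ c :⇒ c :≤ k :⇒ ⊢ l :≤ 2 :* s) 0 (0 ∷ 1 ∷ 2 ∷ 2 ∷ [])
      untouched = farkas 3 (λ s l r → l :≤ 2 :* s :⇒ 2 :* s :≤ r :⇒ con 1 :+ r :≤ l :⇒ ⊢⊥) 0 (1 ∷ 1 ∷ 1 ∷ [])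

      -- With at most half of `C` as common blue neighbours, at least half of `C` is seen. As no two
      -- consecutive vertices are seen, seen and unseen ones alternate.
      touch : ∀ {u u′} → ℓ ≡ 2 * κ → u ∷ u′ ∷ [] ⊑ U → Adj a u u′ → cnt (common b u u′) C ≤ κ → Touch u u′
      touch {u} {u′} ev h uu′ com {x} {x′} (at rest back forth perm) = split-cases (bool? (seen u u′ x)) (bool? (seen u u′ x′))
        where
        quiet : seen u u′ x ≡ false → seen u u′ x′ ≡ false →
                Consecutive a (seen u u′) (seen u u′) x′ rest x ⊎ ⟦ seen u u′ x′ ⟧ + 2 * cnt (seen u u′) rest ≤ length rest + ⟦ seen u u′ x ⟧ → ⊥
        quiet f f′ (inj₁ (consec {t} {t′} l m before joint after ot ot′ refl)) =
          seen-clash h uu′ (at (m ++ x′ ∷ l) (after ▸ forth ◂ before) joint (↭-trans (slot₁ x′ t′ l m) perm)) ot ot′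
        quiet f f′ (inj₂ le) = untouched (cnt (seen u u′) C) ℓ (length rest)
          (many-seen κ (cnt (seen u u′) C) (cnt (common b u u′) C) ℓ ev (seen-or-common h) com)
          (≤-trans (≤-reflexive (cong (2 *_) count)) few) (≤-reflexive (longer-perm perm))
          where
          count : cnt (seen u u′) C ≡ cnt (seen u u′) rest
          count = trans (sym (cnt-↭ _ perm)) (cong (λ t → ⟦ t ⟧ + cnt (seen u u′) rest) f′)
          few : 2 * cnt (seen u u′) rest ≤ length rest
          few = ≤-trans (subst (λ t → ⟦ t ⟧ + _ ≤ _) f′ le) (≤-trans (≤-reflexive (cong (λ t → length rest + ⟦ t ⟧) f)) (≤-reflexive (+-identityʳ _)))
        split-cases : seen u u′ x ≡ true ⊎ seen u u′ x ≡ false → seen u u′ x′ ≡ true ⊎ seen u u′ x′ ≡ false →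
                      (Adj a u x ⊎ Adj a u′ x) ⊎ (Adj a u x′ ⊎ Adj a u′ x′)
        split-cases (inj₁ s)  _         = inj₁ (seen-⊎ s)
        split-cases (inj₂ _)  (inj₁ s)  = inj₂ (seen-⊎ s)
        split-cases (inj₂ f) (inj₂ f′) = ⊥-elim (quiet f f′ (scan (seen u u′) back))

      two-steps = shuffle 2 1 (λ x′ y l → y ◃ l ⧺ x′ ◃ ε ⇄ x′ ◃ y ◃ l)

      -- Let x, x′, y be consecutive on `C`. The edge xx′ is touched by `v` or `w`: at x′ this
      -- allows an insertion together with `u`, so it happens at x. Now `u` and this second vertex
      -- both see x, and wherever they touch the edge x′y there is an insertion between x and x′ or
      -- an exchange of x′ for both of them.
      touched : ∀ {u v w x} → u ∷ v ∷ [] ⊑ U → u ∷ w ∷ [] ⊑ U → Adj a u v → Adj a u w →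
                Touch u v → Touch u w → Touch v w → x ∈ C → Adj a u x → ⊥
      touched {u} {v} {w} {x} uv uw e f tuv tuw tvw x∈ ux with cycle-at C-path x∈
      ... | x′ , at [] stop forth perm = 1≰0 (≤-trans (s≤s⁻¹ (s≤s⁻¹ (≤-trans ℓ≥3 (m≤n⇒m≤1+n (≤-reflexive (sym (longer-perm perm))))))) z≤n)
      ... | x′ , c@(at (y ∷ rest) (x′y ◂ back) forth perm) = case tvw c of λ where
          (inj₁ (inj₁ vx))  → both uv e tuv vx
          (inj₁ (inj₂ wx))  → both uw f tuw wx
          (inj₂ (inj₁ vx′)) → F₂ c uv e ux vx′
          (inj₂ (inj₂ wx′)) → F₂ c uw f ux wx′
        where
        both : ∀ {v} → u ∷ v ∷ [] ⊑ U → Adj a u v → Touch u v → Adj a v x → ⊥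
        both {v} h e t vx with t (at (rest ++ [ x′ ]) (back ▸ edge forth) x′y (↭-trans (two-steps x′ y rest) perm))
        ... | inj₁ (inj₁ ux′) = F₁ c (⊑-∈ h (here refl)) ux ux′
        ... | inj₁ (inj₂ vx′) = F₁ c (⊑-∈ h (there (here refl))) vx vx′
        ... | inj₂ (inj₁ uy)  = F₂′ back perm (↭-⊑ (swap v u ↭-refl) h) (E-sym e) vx uy
        ... | inj₂ (inj₂ vy)  = F₂′ back perm h e ux vy

      some-seen = farkas 3 (λ s k l → l :≤ 2 :* s :⇒ con 3 :≤ l :⇒ ⊢ con 2 :≤ 2 :* s :+ con 1) 2 (1 ∷ 1 ∷ [])

      even-long = farkas 2 (λ l k → l := 2 :* k :⇒ ⊢ l :+ con 1 :≤ 2 :* (con 1 :+ k)) 0 (1 ∷ 0 ∷ [])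
      odd-long = farkas 2 (λ l k → con 1 :+ l := 2 :* k :⇒ ⊢ l :+ con 1 :≤ 2 :* k) 0 (1 ∷ 0 ∷ [])

      pick₁₃ = shuffle 3 1 (λ u v w R → u ◃ v ◃ w ◃ R ⇄ u ◃ w ◃ v ◃ R)
      pick₂₃ = shuffle 3 1 (λ u v w R → u ◃ v ◃ w ◃ R ⇄ v ◃ w ◃ u ◃ R)

      -- For odd `ℓ`, κ clique vertices and κ connecting vertices make a blue cycle of length ℓ + 1.
      -- For even `ℓ` one more of each is needed, hence a pair with κ + 1 common neighbours; three
      -- clique vertices without such a pair contradict `touched`.
      red-clique : ∀ {κ′} K → κ ≡ 2 + κ′ → ℓ ≡ 2 * κ ⊎ 1 + ℓ ≡ 2 * κ → K ⊑ U → Clique a K → κ + 1 ≤ length K → ⊥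
      red-clique []           refl _ h cl ()
      red-clique (u ∷ [])     refl _ h cl (s≤s ())
      red-clique (u ∷ v ∷ []) refl _ h cl (s≤s (s≤s le)) = 1≰0 (≤-trans (m≤n+m 1 _) le)
      red-clique {κ′} (u ∷ v ∷ w ∷ R) refl (inj₂ odd) h cl (s≤s (s≤s le)) =
        clique-cycle κ′ κ h cl (≤-trans (m≤m+n κ′ 1) le) (s≤s (m≤n⇒m≤1+n ≤-refl)) (com (step (⊑-dropʳ (u ∷ v ∷ []) (w ∷ R) h))) ≤-refl (odd-long ℓ κ odd)
        where
        com : Adj b u v ⊎ Adj a u v × κ ≤ cnt (common b u v) C → κ ≤ cnt (common b u v) C
        com (inj₁ e)       = ⊥-elim (E-excl a≢b (cl (here refl) (there (here refl)) (Adj-≢ e)) e)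
        com (inj₂ (_ , m)) = m
      red-clique {κ′} (u ∷ v ∷ w ∷ R) refl (inj₁ even) h cl (s≤s (s≤s le)) = search
        where
        good : ∀ {x y R′} → u ∷ v ∷ w ∷ R ↭ x ∷ y ∷ R′ → suc κ ≤ cnt (common b x y) C → ⊥
        good {R′ = R′} π m = clique-cycle (suc κ′) (suc κ) (↭-⊑ (↭-sym π) h) (Clique-⊑ (↭-⊑ (↭-sym π) ⊑-refl) cl)
          (s≤s⁻¹ (s≤s⁻¹ (≤-trans (s≤s (s≤s (≤-trans (≤-reflexive (+-comm 1 κ′)) le))) (≤-reflexive (↭-length π))))) ≤-refl m ≤-refl (even-long ℓ κ even)
        h₁₂ : u ∷ v ∷ [] ⊑ U
        h₁₂ = ⊑-dropʳ (u ∷ v ∷ []) (w ∷ R) h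
        h₁₃ : u ∷ w ∷ [] ⊑ U
        h₁₃ = ⊑-dropʳ (u ∷ w ∷ []) (v ∷ R) (↭-⊑ (↭-sym (pick₁₃ u v w R)) h)
        h₂₃ : v ∷ w ∷ [] ⊑ U
        h₂₃ = ⊑-dropʳ (v ∷ w ∷ []) (u ∷ R) (↭-⊑ (↭-sym (pick₂₃ u v w R)) h)
        h₂₁ : v ∷ u ∷ [] ⊑ U
        h₂₁ = ↭-⊑ (swap v u ↭-refl) h₁₂
        e₁₂ : Adj a u v
        e₁₂ = cl (here refl) (there (here refl)) (Unique-≢ U-unique h₁₂ (here refl))
        e₁₃ : Adj a u w
        e₁₃ = cl (here refl) (there (there (here refl))) (Unique-≢ U-unique h₁₃ (here refl))
        e₂₃ : Adj a v w
        e₂₃ = cl (there (here refl)) (there (there (here refl))) (Unique-≢ U-unique h₂₃ (here refl))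
        search : ⊥
        search with suc κ ≤? cnt (common b u v) C | suc κ ≤? cnt (common b u w) C | suc κ ≤? cnt (common b v w) C
        ... | yes m | _     | _     = good ↭-refl m
        ... | no  _ | yes m | _     = good (pick₁₃ u v w R) m
        ... | no  _ | no  _ | yes m = good (pick₂₃ u v w R) m
        ... | no  i | no  j | no  k =
          let t₁₂ = touch even h₁₂ e₁₂ (s≤s⁻¹ (≰⇒> i))
              t₁₃ = touch even h₁₃ e₁₃ (s≤s⁻¹ (≰⇒> j))
              t₂₃ = touch even h₂₃ e₂₃ (s≤s⁻¹ (≰⇒> k))
              x , zs , ox , π = pick (seen u v) C (halve (some-seen (cnt (seen u v) C) κ ℓ
                (many-seen κ (cnt (seen u v) C) (cnt (common b u v) C) ℓ even (seen-or-common h₁₂) (s≤s⁻¹ (≰⇒> i))) ℓ≥3))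
              x∈ = ∈-resp-↭ (↭-sym π) (here refl)
          in case seen-⊎ {u} {v} ox of λ where
               (inj₁ ux) → touched h₁₂ h₁₃ e₁₂ e₁₃ t₁₂ t₁₃ t₂₃ x∈ ux
               (inj₂ vx) → touched h₂₁ h₂₃ (E-sym e₁₂) e₂₃ (touch-sym t₁₂) t₂₃ t₁₃ x∈ vx

      long₁ = farkas 2 (λ k u → k :+ con 2 :≤ u :⇒ ⊢ k :+ con 1 :≤ u) 0 (1 ∷ [])
      long₂ = farkas 3 (λ k u r → k :+ con 2 :≤ u :⇒ u := con 1 :+ r :⇒ ⊢ k :+ con 1 :≤ r) 0 (1 ∷ 1 ∷ 0 ∷ [])

      -- Two blue edges inside `U` are handled by `three` and `four`. If there are no two, then `U`
      -- is a red clique, or becomes one when a single vertex is deleted, and at least κ + 1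
      -- vertices remain.
      contradiction : ∀ {κ′} → κ ≡ 2 + κ′ → ℓ ≡ 2 * κ ⊎ 1 + ℓ ≡ 2 * κ → ⊥
      contradiction e par with edge-or-clique a≢b U U-unique
      ... | inj₂ cl = red-clique U e par ⊑-refl cl (long₁ κ (length U) room)
      ... | inj₁ (p , p′ , R , pp′ , π) with edge-or-clique a≢b (p′ ∷ R) (Unique-⊑ U-unique tail⊑U)
        where
        tail⊑U : p′ ∷ R ⊑ U
        tail⊑U = ⊑-dropˡ [ p ] (p′ ∷ R) ([] , ↭-trans π (↭-reflexive (sym (++-identityʳ≡ _))))
      ...   | inj₂ cl = red-clique (p′ ∷ R) e par (⊑-dropˡ [ p ] (p′ ∷ R) ([] , ↭-trans π (↭-reflexive (sym (++-identityʳ≡ _))))) cl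
                          (long₂ κ (length U) (length (p′ ∷ R)) room (↭-length π))
      ...   | inj₁ (r , r′ , R′ , rr′ , σ) = two-edges
        where
        π′ : U ↭ p ∷ r ∷ r′ ∷ R′
        π′ = ↭-trans π (prep p σ)
        twist₁ = shuffle 3 1 (λ p q r R → p ◃ q ◃ r ◃ R ⇄ p ◃ r ◃ q ◃ R)
        twist₂ = shuffle 4 1 (λ p q r s R → p ◃ r ◃ s ◃ q ◃ R ⇄ p ◃ q ◃ r ◃ s ◃ R)
        two-edges : ⊥
        two-edges with ∈-resp-↭ σ (here refl)
        ... | here refl             = three e pp′ rr′ π′
        ... | there (here refl)     = three e pp′ (E-sym rr′) (↭-trans π′ (twist₁ p r r′ R′))
        ... | there (there i)       = let zs , ρ = ∈-take i in
          four e pp′ rr′ (↭-trans π′ (↭-trans (prep p (prep r (prep r′ ρ))) (twist₂ p p′ r r′ zs)))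

  κ≥2 = farkas 2 (λ l k → l := 2 :* k :⇒ con 3 :≤ l :⇒ ⊢ con 4 :≤ 2 :* k :+ con 1) 0 (1 ∷ 0 ∷ 1 ∷ [])
  κ≥2′ = farkas 2 (λ l k → (con 1 :+ l) := 2 :* k :⇒ con 3 :≤ l :⇒ ⊢ con 4 :≤ 2 :* k :+ con 1) 3 (3 ∷ 0 ∷ 3 ∷ [])
  bounds₁ = farkas 2 (λ l k → l := 2 :* k :⇒ ⊢ 2 :* k :≤ l :+ con 1) 0 (0 ∷ 1 ∷ [])
  bounds₂ = farkas 2 (λ l k → (con 1 :+ l) := 2 :* k :⇒ ⊢ 2 :* k :≤ l :+ con 1) 0 (0 ∷ 1 ∷ [])
  bounds₃ = farkas 2 (λ l k → l := 2 :* k :⇒ ⊢ l :≤ 2 :* k) 0 (1 ∷ 0 ∷ [])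
  bounds₄ = farkas 2 (λ l k → (con 1 :+ l) := 2 :* k :⇒ ⊢ l :≤ 2 :* k) 0 (1 ∷ 0 ∷ [])
  enough = farkas 4 (λ l k s u → 2 :* k :≤ l :+ con 1 :⇒ 3 :* l :+ con 4 :≤ 2 :* s :⇒ s := l :+ u :⇒ ⊢ 2 :* (k :+ con 2) :≤ 2 :* u :+ con 1) 0 (1 ∷ 1 ∷ 2 ∷ 0 ∷ [])
  -- The hypotheses leave at least ℓ/2 + 2 vertices outside the cycle. Red edges among them see so
  -- little of it that a longer blue cycle can be built from these vertices and their common blue
  -- neighbours on the cycle.
  longer-cycle : ∀ {a b} → a ≢ b → ∀ {S ℓ} → Unique S → 3 ≤ ℓ → 3 * ℓ + 4 ≤ 2 * length S →
                 (∀ c {k} → suc ℓ ≤ k → Cycle c k S → ⊥) → Cycle a ℓ S → ⊥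
  longer-cycle a≢b {S} {ℓ} unique ℓ≥3 small longest (cycle C p len (U , σ)) with parity ℓ
  ... | inj₁ (κ , e) = let κ′ , e′ = 2+ (halve (κ≥2 ℓ κ e ℓ≥3)) in
    Parity.contradiction {κ} (bounds₁ ℓ κ e) (bounds₃ ℓ κ e)
      (halve (enough ℓ κ (length S) (length U) (bounds₁ ℓ κ e) small S-length)) e′ (inj₁ e)
    where
    open LongestCycle a≢b unique ℓ≥3 longest p len σ
    S-length : length S ≡ ℓ + length U
    S-length = trans (↭-length σ) (trans (length-++ C) (cong (_+ length U) len))
  ... | inj₂ (κ , e) = let κ′ , e′ = 2+ (halve (κ≥2′ ℓ κ e ℓ≥3)) in
    Parity.contradiction {κ} (bounds₂ ℓ κ e) (bounds₄ ℓ κ e)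
      (halve (enough ℓ κ (length S) (length U) (bounds₂ ℓ κ e) small S-length)) e′ (inj₂ e)
    where
    open LongestCycle a≢b unique ℓ≥3 longest p len σ
    S-length : length S ≡ ℓ + length U
    S-length = trans (↭-length σ) (trans (length-++ C) (cong (_+ length U) len))

  -- Shortening monochromatic cycles

  -- The cycle as a bare cyclic sequence that begins with its base point, so that its first few
  -- vertices can be matched and the sequence can be rotated.
  Ring : Bool → List V → Set
  Ring b []      = ⊤
  Ring b (v ∷ l) = Path b v (l ++ [ v ]) v

  ring-rotate : ∀ {b} xs ys → Ring b (xs ++ ys) → Ring b (ys ++ xs)
  ring-rotate {b} []       ys       r = subst (Ring b) (sym (++-identityʳ≡ ys)) r
  ring-rotate {b} (x ∷ xs) []       r = subst (Ring b) (++-identityʳ≡ (x ∷ xs)) r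
  ring-rotate {b} (x ∷ xs) (y ∷ ys) r =
    let p , q = split xs y (ys ++ [ x ]) (subst (λ l → Path b x l x) (++-assoc≡ xs (y ∷ ys) [ x ]) r) in
    subst (λ l → Path b y l y) (trans (++-assoc≡ ys [ x ] (xs ++ [ y ])) (sym (++-assoc≡ ys (x ∷ xs) [ y ]))) (q ▸ p)

  ring-perm = shuffle 1 1 (λ v l → l ⧺ v ◃ ε ⇄ v ◃ l)

  ring-cycle : ∀ {b v l A k} → Ring b (v ∷ l) → v ∷ l ⊑ A → length (v ∷ l) ≡ k → Cycle b k A
  ring-cycle {v = v} {l} r h e = cycle (l ++ [ v ]) r (trans (↭-length (ring-perm v l)) e) (↭-⊑ (ring-perm v l) h)

  unsnoc-list : ∀ x (l : List V) → ∃₂ λ m y → x ∷ l ≡ m ++ [ y ]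
  unsnoc-list x []      = [] , x , refl
  unsnoc-list x (y ∷ l) = let m , z , e = unsnoc-list y l in x ∷ m , z , cong (x ∷_) e

  cycle-ring : ∀ {b k A} → Cycle b (suc k) A → ∃ λ l → Ring b l × length l ≡ suc k × l ⊑ A
  cycle-ring {b} {k} {A} (cycle {x} (y ∷ l) p len h) = let m , z , e = unsnoc-list y l in closing m z e p len h
    where
    closing : ∀ m z {l} → l ≡ m ++ [ z ] → Path b x l x → length l ≡ suc k → l ⊑ A → ∃ λ l′ → Ring b l′ × length l′ ≡ suc k × l′ ⊑ A
    closing m z refl p len h with refl ← unsnoc m z p =
      z ∷ m , p , trans (sym (↭-length (ring-perm z m))) len , ↭-⊑ (↭-sym (ring-perm z m)) h

  -- Consecutive vertices of a cycle are paired, so that `firsts` and `seconds` collect alternate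
  -- positions.
  flat : List (V × V) → List V
  flat []             = []
  flat ((x , y) ∷ ps) = x ∷ y ∷ flat ps

  firsts seconds : List (V × V) → List V
  firsts  []             = []
  firsts  ((x , _) ∷ ps) = x ∷ firsts ps
  seconds []             = []
  seconds ((_ , y) ∷ ps) = y ∷ seconds ps

  lastP : V × V → List (V × V) → V × V
  lastP p []       = p
  lastP p (q ∷ ps) = lastP q ps

  initP : V × V → List (V × V) → List (V × V)
  initP p []       = []
  initP p (q ∷ ps) = p ∷ initP q ps

  flat-snoc : ∀ p ps → flat (p ∷ ps) ≡ flat (initP p ps) ++ proj₁ (lastP p ps) ∷ proj₂ (lastP p ps) ∷ []
  flat-snoc p []             = refl
  flat-snoc (x , y) (q ∷ ps) = cong (λ l → x ∷ y ∷ l) (flat-snoc q ps)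

  flat-++ : ∀ ps qs → flat (ps ++ qs) ≡ flat ps ++ flat qs
  flat-++ []             qs = refl
  flat-++ ((x , y) ∷ ps) qs = cong (λ l → x ∷ y ∷ l) (flat-++ ps qs)

  firsts-++ : ∀ ps qs → firsts (ps ++ qs) ≡ firsts ps ++ firsts qs
  firsts-++ []       qs = refl
  firsts-++ (p ∷ ps) qs = cong (proj₁ p ∷_) (firsts-++ ps qs)

  seconds-++ : ∀ ps qs → seconds (ps ++ qs) ≡ seconds ps ++ seconds qs
  seconds-++ []       qs = refl
  seconds-++ (p ∷ ps) qs = cong (proj₂ p ∷_) (seconds-++ ps qs)

  firsts-length : ∀ ps → length (firsts ps) ≡ length ps
  firsts-length []       = refl
  firsts-length (p ∷ ps) = cong suc (firsts-length ps)

  seconds-length : ∀ ps → length (seconds ps) ≡ length ps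
  seconds-length []       = refl
  seconds-length (p ∷ ps) = cong suc (seconds-length ps)

  flat-perm₁ = shuffle 2 2 (λ x y F S → x ◃ y ◃ F ⧺ S ⇄ (x ◃ F) ⧺ y ◃ S)

  flat-perm : ∀ ps → flat ps ↭ firsts ps ++ seconds ps
  flat-perm []             = ↭-refl
  flat-perm ((x , y) ∷ ps) = ↭-trans (prep x (prep y (flat-perm ps))) (flat-perm₁ x y (firsts ps) (seconds ps))

  unflat : ∀ k l → length l ≡ 2 * k → ∃ λ ps → l ≡ flat ps × length ps ≡ k
  unflat zero    []          e = [] , refl , refl
  unflat (suc k) []          ()
  unflat (suc k) (x ∷ [])    e with () ← trans (cong (λ n → n) e) (cong suc (+-suc k (k + 0)))
  unflat (suc k) (x ∷ y ∷ l) e =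
    let ps , f , n = unflat k l (cong (λ { (suc (suc n)) → n ; n → n }) (trans e (cong suc (+-suc k (k + 0))))) in
    (x , y) ∷ ps , cong (λ l → x ∷ y ∷ l) f , cong suc n
  Skip : Bool → List V → Set
  Skip b (x ∷ y ∷ z ∷ l) = Adj b x z × Skip b (y ∷ z ∷ l)
  Skip b _               = ⊤

  skip-tail : ∀ {b x} l → Skip b (x ∷ l) → Skip b l
  skip-tail []          s = tt
  skip-tail (y ∷ [])    s = tt
  skip-tail (y ∷ z ∷ l) s = proj₂ s

  skip-firsts : ∀ {b} p ps r → Skip b (flat (p ∷ ps) ++ r) → Path b (proj₁ p) (firsts ps) (proj₁ (lastP p ps))
  skip-firsts p []       r s = stop
  skip-firsts p (q ∷ ps) r s = proj₁ s ◂ skip-firsts q ps r (skip-tail _ (proj₂ s))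

  skip-seconds : ∀ {b} p ps r → Skip b (flat (p ∷ ps) ++ r) → Path b (proj₂ p) (seconds ps) (proj₂ (lastP p ps))
  skip-seconds p []       r s = stop
  skip-seconds p (q ∷ ps) r s = proj₁ (proj₂ s) ◂ skip-seconds q ps r (skip-tail _ (proj₂ s))

  skip-last : ∀ {b} p ps z → Skip b (flat (p ∷ ps) ++ [ z ]) → Adj b (proj₁ (lastP p ps)) z
  skip-last p []       z s = proj₁ s
  skip-last p (q ∷ ps) z s = skip-last q ps z (skip-tail _ (proj₂ s))

  lastP-++ : ∀ p ps q qs → lastP p (ps ++ q ∷ qs) ≡ lastP q qs
  lastP-++ p []       q qs = refl
  lastP-++ p (r ∷ ps) q qs = lastP-++ r ps q qs

  flat-tail : ∀ u w ps → ∃ λ l → w ∷ flat ps ≡ l ++ [ proj₂ (lastP (u , w) ps) ]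
  flat-tail u w []             = [] , refl
  flat-tail u w ((x , y) ∷ ps) = let l , e = flat-tail x y ps in w ∷ x ∷ l , cong (λ l → w ∷ x ∷ l) e

  ∈-firsts : ∀ {x} ps → x ∈ firsts ps → ∃₂ λ pre y → ∃ λ post → ps ≡ pre ++ (x , y) ∷ post
  ∈-firsts ((x , y) ∷ ps) (here refl) = [] , y , ps , refl
  ∈-firsts (p ∷ ps)       (there i)   = let pre , y , post , e = ∈-firsts ps i in p ∷ pre , y , post , cong (p ∷_) e

  module Rings {a b : Bool} (a≢b : a ≢ b) {S : List V} (unique : Unique S) {n : ℕ} (none : ∀ c → Cycle c n S → ⊥)
               {L : List V} (L⊑S : L ⊑ S) (L-length : length L ≡ suc n) where

    IsRing : List V → Set
    IsRing l = Ring a l × l ↭ L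

    rotate-perm = shuffle 0 2 (λ xs ys → ys ⧺ xs ⇄ xs ⧺ ys)
    rotateᵣ : ∀ xs ys → IsRing (xs ++ ys) → IsRing (ys ++ xs)
    rotateᵣ xs ys (r , π) = ring-rotate xs ys r , ↭-trans (rotate-perm xs ys) π

    shorter : ∀ c {v l w} → Ring c (v ∷ l) → w ∷ v ∷ l ↭ L → ⊥
    shorter c {v} {l} {w} r π =
      none c (ring-cycle r (⊑-dropˡ [ w ] (v ∷ l) (↭-⊑ π L⊑S)) (suc-injective (trans (↭-length π) L-length)))

    shorter-path : ∀ c {v l w} → Path c v l v → w ∷ l ↭ L → ⊥
    shorter-path c {v} {l} {w} p π =
      none c (cycle l p (suc-injective (trans (↭-length π) L-length)) (⊑-dropˡ [ w ] l (↭-⊑ π L⊑S)))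

    distinct : ∀ {x y l} → x ∷ l ↭ L → y ∈ l → x ≢ y
    distinct π = Unique-≢ unique (↭-⊑ π L⊑S)

    skip-perm = shuffle 3 1 (λ u v w l → v ◃ u ◃ w ◃ l ⇄ u ◃ v ◃ w ◃ l)
    -- A red chord past `v` would close a red cycle of length `n`.
    dist₂ : ∀ {u v w l} → IsRing (u ∷ v ∷ w ∷ l) → Adj b u w
    dist₂ {u} {v} {w} {l} (uv ◂ vw ◂ p , π) with E-dich a≢b (distinct π (there (here refl)))
    ... | inj₁ e = ⊥-elim (shorter a (e ◂ p) (↭-trans (skip-perm u v w l) π))
    ... | inj₂ e = e

    skip : ∀ l r → IsRing (l ++ r) → Skip b l
    skip []              r i = tt
    skip (x ∷ [])        r i = tt
    skip (x ∷ y ∷ [])    r i = tt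
    skip (x ∷ y ∷ z ∷ l) r i = dist₂ i ,
      skip (y ∷ z ∷ l) (r ++ [ x ]) (subst IsRing (++-assoc≡ (y ∷ z ∷ l) r [ x ]) (rotateᵣ [ x ] (y ∷ z ∷ l ++ r) i))

    skip-all : ∀ l → IsRing l → Skip b l
    skip-all l i = skip l [] (subst IsRing (sym (++-identityʳ≡ l)) i)

    module Odd {k : ℕ} (n≡ : n ≡ 2 * k) (k≥3 : 3 ≤ k) where

      odd-perm₁ = shuffle 6 1 (λ x₀ x₁ x₂ x₃ x₄ x₅ l → x₁ ◃ x₀ ◃ x₄ ◃ x₃ ◃ x₂ ◃ x₅ ◃ l ⇄ x₀ ◃ x₁ ◃ x₂ ◃ x₃ ◃ x₄ ◃ x₅ ◃ l)
      odd-perm₂ = shuffle 7 2 (λ x₀ x₁ x₂ x₃ x₄ x₅ e F T → x₂ ◃ x₄ ◃ (F ⧺ e ◃ ε) ⧺ x₁ ◃ (x₃ ◃ x₅ ◃ T) ⧺ x₀ ◃ ε ⇄ x₀ ◃ x₁ ◃ x₂ ◃ x₃ ◃ x₄ ◃ x₅ ◃ (F ⧺ T) ⧺ e ◃ ε)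

      -- If x₂x₅ were red, then x₀x₄ would give a cycle of length n in either colour.
      dist₃′ : ∀ {x₀ x₁ x₂ x₃ x₄ x₅} qs e → IsRing (x₀ ∷ x₁ ∷ x₂ ∷ x₃ ∷ x₄ ∷ x₅ ∷ flat qs ++ [ e ]) → Adj b x₂ x₅
      dist₃′ {x₀} {x₁} {x₂} {x₃} {x₄} {x₅} qs e i@(e₀ ◂ e₁ ◂ e₂ ◂ e₃ ◂ e₄ ◂ p , π)
        with E-dich a≢b (Unique-≢ unique (⊑-dropˡ (x₀ ∷ x₁ ∷ []) _ (↭-⊑ π L⊑S)) (there (there (here refl))))
           | E-dich a≢b (Unique-≢ unique (↭-⊑ π L⊑S) (there (there (there (here refl)))))
      ... | inj₂ h | _ = h
      ... | inj₁ r | inj₁ s = ⊥-elim (shorter a (s ◂ E-sym e₃ ◂ E-sym e₂ ◂ r ◂ p)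
                                (↭-trans (odd-perm₁ x₀ x₁ x₂ x₃ x₄ x₅ (flat qs ++ [ e ])) π))
      ... | inj₁ r | inj₂ s = ⊥-elim (shorter-path b
              (s ◂ (skip-firsts (x₄ , x₅) qs [ e ] skip-x₄ ▸ edge (skip-last (x₄ , x₅) qs e skip-x₄)) ▸
               dist₂ (rotateᵣ (flat all) [ e ] i) ◂ skip-seconds (x₀ , x₁) ((x₂ , x₃) ∷ (x₄ , x₅) ∷ qs) [ e ] (skip-all _ i) ▸ edge last-first)
              (↭-trans (odd-perm₂ x₀ x₁ x₂ x₃ x₄ x₅ e (firsts qs) (seconds qs))
                (↭-trans (prep x₀ (prep x₁ (prep x₂ (prep x₃ (prep x₄ (prep x₅ (++⁺ʳ [ e ] (↭-sym (flat-perm qs)))))))))  π)))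
        where
        all : List (V × V)
        all = (x₀ , x₁) ∷ (x₂ , x₃) ∷ (x₄ , x₅) ∷ qs
        skip-x₄ : Skip b (flat ((x₄ , x₅) ∷ qs) ++ [ e ])
        skip-x₄ = skip-tail _ (skip-tail _ (skip-tail _ (skip-tail _ (skip-all _ i))))
        rest : List (V × V)
        rest = (x₂ , x₃) ∷ (x₄ , x₅) ∷ qs
        s′ t′ : V
        s′ = proj₁ (lastP (x₀ , x₁) rest)
        t′ = proj₂ (lastP (x₀ , x₁) rest)
        init : List V
        init = flat (initP (x₀ , x₁) rest)
        i′ : IsRing ((init ++ [ s′ ]) ++ t′ ∷ e ∷ [])
        i′ = subst IsRing (trans (cong (_++ [ e ]) (flat-snoc (x₀ , x₁) rest)) (trans (++-assoc≡ init _ _) (sym (++-assoc≡ init [ s′ ] _)))) i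
        last-first : Adj b t′ x₀
        last-first = dist₂ (rotateᵣ (init ++ [ s′ ]) (t′ ∷ e ∷ []) i′)

      odd-rest : ∀ j l → length l ≡ suc (2 * j) → ∃₂ λ ps w → l ≡ flat ps ++ [ w ] × length ps ≡ j
      odd-rest j (x ∷ l) e = let m , w , f = unsnoc-list x l in ending m w f e
        where
        ending : ∀ m w {l} → l ≡ m ++ [ w ] → length l ≡ suc (2 * j) → ∃₂ λ ps w → l ≡ flat ps ++ [ w ] × length ps ≡ j
        ending m w refl e =
          let ps , f , g = unflat j m (suc-injective (trans (sym (trans (length-++ m) (+-comm (length m) 1))) e)) in
          ps , w , cong (_++ [ w ]) f , g

      k-3 : ∃ λ j → k ≡ 3 + j
      k-3 = 3+ k≥3

      dist₃-count = farkas-≡ 4 (λ r n k j → con 4 :+ r := con 1 :+ n :⇒ n := 2 :* k :⇒ k := con 3 :+ j :⇒ ⊢ r := con 1 :+ 2 :* (con 1 :+ j)) 0 (1 ∷ 0 ∷ 1 ∷ 0 ∷ 2 ∷ 0 ∷ [])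

      dist₃ : ∀ {x₀ x₁ x₂ x₃ rest} → IsRing (x₀ ∷ x₁ ∷ x₂ ∷ x₃ ∷ rest) → Adj b x₀ x₃
      dist₃ {x₀} {x₁} {x₂} {x₃} {rest} i@(_ , π) = let j , e = k-3 in
        from (odd-rest (suc j) rest (dist₃-count (length rest) n k j len n≡ e)) i
        where
        len : 4 + length rest ≡ 1 + n
        len = trans (↭-length π) L-length
        from : ∀ {rest j} → (∃₂ λ ps w → rest ≡ flat ps ++ [ w ] × length ps ≡ suc j) → IsRing (x₀ ∷ x₁ ∷ x₂ ∷ x₃ ∷ rest) → Adj b x₀ x₃
        from (p ∷ ps , w , refl , _) i = dist₃′ (initP p ps) s′ (rotateᵣ front (t′ ∷ w ∷ []) (subst IsRing shape i))
          where
          s′ t′ : V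
          s′ = proj₁ (lastP p ps)
          t′ = proj₂ (lastP p ps)
          front : List V
          front = x₀ ∷ x₁ ∷ x₂ ∷ x₃ ∷ flat (initP p ps) ++ [ s′ ]
          shape : x₀ ∷ x₁ ∷ x₂ ∷ x₃ ∷ flat (p ∷ ps) ++ [ w ] ≡ front ++ t′ ∷ w ∷ []
          shape = cong (λ l → x₀ ∷ x₁ ∷ x₂ ∷ x₃ ∷ l)
            (trans (cong (_++ [ w ]) (flat-snoc p ps)) (trans (++-assoc≡ (flat (initP p ps)) _ _) (sym (++-assoc≡ (flat (initP p ps)) [ s′ ] _))))

      odd-perm₃ = shuffle 7 2 (λ x₀ x₁ x₂ x₃ x₄ x₅ e F T → e ◃ x₀ ◃ (x₂ ◃ x₄ ◃ F) ⧺ (x₅ ◃ T) ⧺ x₁ ◃ x₃ ◃ ε ⇄ x₀ ◃ x₁ ◃ x₂ ◃ x₃ ◃ x₄ ◃ x₅ ◃ (F ⧺ T) ⧺ e ◃ ε)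

      -- All chords at distance two or three are blue. They form the cycle x₃, x₀, back through the
      -- even positions to x₂, then x₅ and on through the odd positions, x₁, x₃, which leaves out
      -- only `e`.
      no-odd-ring : ∀ {x₀ x₁ x₂ x₃ x₄ x₅} qs e → IsRing (x₀ ∷ x₁ ∷ x₂ ∷ x₃ ∷ x₄ ∷ x₅ ∷ flat qs ++ [ e ]) → ⊥
      no-odd-ring {x₀} {x₁} {x₂} {x₃} {x₄} {x₅} qs e i@(r , π) =
        let m , back , ρ , _ = rev (skip-firsts (x₂ , x₃) rest [ e ] (skip-tail _ (skip-tail _ (skip-all _ i)))) in
        shorter-path b
          (E-sym (dist₃ i) ◂ E-sym s-x₀ ◂ back ▸ x₂-x₅ ◂
           skip-seconds (x₄ , x₅) qs [ e ] (skip-tail _ (skip-tail _ (skip-tail _ (skip-tail _ (skip-all _ i))))) ▸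
           t-x₁ ◂ edge x₁-x₃)
          (↭-trans (prep e (prep x₀ (++⁺ʳ ((x₅ ∷ seconds qs) ++ x₁ ∷ [ x₃ ]) ρ)))
            (↭-trans (odd-perm₃ x₀ x₁ x₂ x₃ x₄ x₅ e (firsts qs) (seconds qs))
              (↭-trans (prep x₀ (prep x₁ (prep x₂ (prep x₃ (prep x₄ (prep x₅ (++⁺ʳ [ e ] (↭-sym (flat-perm qs))))))))) π)))
        where
        rest all : List (V × V)
        rest = (x₄ , x₅) ∷ qs
        all = (x₂ , x₃) ∷ rest
        s′ t′ : V
        s′ = proj₁ (lastP (x₄ , x₅) qs)
        t′ = proj₂ (lastP (x₄ , x₅) qs)
        front : List V
        front = flat (initP (x₀ , x₁) all)
        i′ : IsRing (front ++ s′ ∷ t′ ∷ e ∷ [])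
        i′ = subst IsRing (trans (cong (_++ [ e ]) (flat-snoc (x₀ , x₁) all)) (++-assoc≡ front _ _)) i
        i″ : IsRing ((front ++ [ s′ ]) ++ t′ ∷ e ∷ [])
        i″ = subst IsRing (sym (++-assoc≡ front [ s′ ] _)) i′
        s-x₀ : Adj b s′ x₀
        s-x₀ = dist₃ (rotateᵣ front (s′ ∷ t′ ∷ e ∷ []) i′)
        t-x₁ : Adj b t′ x₁
        t-x₁ = dist₃ (rotateᵣ (front ++ [ s′ ]) (t′ ∷ e ∷ []) i″)
        x₂-x₅ : Adj b x₂ x₅
        x₂-x₅ = dist₃ (rotateᵣ (x₀ ∷ x₁ ∷ []) _ i)
        x₁-x₃ : Adj b x₁ x₃
        x₁-x₃ = dist₂ (rotateᵣ [ x₀ ] _ i)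

    module Even {m : ℕ} (n≡ : n ≡ suc m) (none₂ : ∀ c → Cycle c m S → ⊥) where

      even-perm₀ = shuffle 4 1 (λ x₀ x₁ x₂ x₃ l → x₁ ◃ x₂ ◃ x₀ ◃ x₃ ◃ l ⇄ x₀ ◃ x₁ ◃ x₂ ◃ x₃ ◃ l)
      -- This chord skips two vertices; if it were red, it would close a red cycle of length n - 1.
      -- This is the reason for excluding a second length.
      dist₃ : ∀ {x₀ x₁ x₂ x₃ l} → IsRing (x₀ ∷ x₁ ∷ x₂ ∷ x₃ ∷ l) → Adj b x₀ x₃
      dist₃ {x₀} {x₁} {x₂} {x₃} {l} (_ ◂ _ ◂ _ ◂ p , π) with E-dich a≢b (distinct π (there (there (here refl))))
      ... | inj₂ e = e
      ... | inj₁ e = ⊥-elim (none₂ a (ring-cycle (e ◂ p)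
              (⊑-dropˡ (x₁ ∷ x₂ ∷ []) _ (↭-⊑ (↭-trans (even-perm₀ x₀ x₁ x₂ x₃ l) π) L⊑S))
              (suc-injective (suc-injective (trans (↭-length π) (trans L-length (cong suc n≡)))))))

      even-perm₁ = shuffle 6 2 (λ x₁ y₁ x₂ y₂ x₃ y₃ F T → x₂ ◃ (x₃ ◃ F) ⧺ y₁ ◃ (y₂ ◃ y₃ ◃ T) ⧺ x₁ ◃ ε ⇄ x₁ ◃ y₁ ◃ x₂ ◃ y₂ ◃ x₃ ◃ y₃ ◃ F ⧺ T)

      -- Chords at distance two give one blue path through the `x`, one through the `y`. The chords
      -- x₃y₁ and x₁y₂ at distance three join them to a blue cycle that leaves out only x₂.
      no-even-ring : ∀ {x₁ y₁ x₂ y₂ x₃ y₃} qs → IsRing (x₁ ∷ y₁ ∷ x₂ ∷ y₂ ∷ x₃ ∷ y₃ ∷ flat qs) → ⊥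
      no-even-ring {x₁} {y₁} {x₂} {y₂} {x₃} {y₃} qs i@(r , π) =
        let u , back , ρ , _ = rev (skip-firsts (x₃ , y₃) qs [] (skip-tail _ (skip-tail _ (skip-tail _ (skip-tail _ skips)))))
            w , back′ , σ , _ = rev (skip-seconds (x₂ , y₂) rest [] (skip-tail _ (skip-tail _ skips))) in
        shorter-path b
          (E-sym s-x₁ ◂ back ▸ E-sym (dist₃ (rotateᵣ [ x₁ ] _ i)) ◂ E-sym t-y₁ ◂ back′ ▸ edge (E-sym (dist₃ i)))
          (↭-trans (prep x₂ (++⁺ ρ (prep y₁ (++⁺ʳ [ x₁ ] σ))))
            (↭-trans (even-perm₁ x₁ y₁ x₂ y₂ x₃ y₃ (firsts qs) (seconds qs))
              (↭-trans (prep x₁ (prep y₁ (prep x₂ (prep y₂ (prep x₃ (prep y₃ (↭-sym (flat-perm qs)))))))) π)))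
        where
        rest all : List (V × V)
        rest = (x₃ , y₃) ∷ qs
        all = (x₂ , y₂) ∷ rest
        skips : Skip b (x₁ ∷ y₁ ∷ x₂ ∷ y₂ ∷ x₃ ∷ y₃ ∷ flat qs ++ [])
        skips = subst (Skip b) (sym (++-identityʳ≡ _)) (skip-all _ i)
        s′ t′ : V
        s′ = proj₁ (lastP (x₃ , y₃) qs)
        t′ = proj₂ (lastP (x₃ , y₃) qs)
        front : List V
        front = flat (initP (x₁ , y₁) all)
        i′ : IsRing (front ++ s′ ∷ t′ ∷ [])
        i′ = subst IsRing (flat-snoc (x₁ , y₁) all) i
        s-x₁ : Adj b s′ x₁
        s-x₁ = dist₂ (rotateᵣ front (s′ ∷ t′ ∷ []) i′)
        t-y₁ : Adj b t′ y₁
        t-y₁ = dist₂ (rotateᵣ (front ++ [ s′ ]) [ t′ ] (subst IsRing (sym (++-assoc≡ front [ s′ ] _)) i′))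

    chord-perm₁ = shuffle 6 2 (λ x xl yl x′ y′ u M l → y′ ◃ x′ ◃ yl ◃ M ⧺ u ◃ l ⧺ x ◃ ε ⇄ x ◃ (M ⧺ yl ◃ x′ ◃ y′ ◃ u ◃ l))
    chord-perm₂ = shuffle 6 2 (λ x xl yl x′ y′ u M l → yl ◃ x′ ◃ y′ ◃ (u ◃ l) ⧺ M ⧺ x ◃ ε ⇄ x ◃ M ⧺ yl ◃ x′ ◃ y′ ◃ u ◃ l)
    chord-perm₃ = shuffle 6 4 (λ x y x′ y′ u w F S F′ S′ → x′ ◃ (S ⧺ y′ ◃ w ◃ S′) ⧺ (x ◃ F) ⧺ (u ◃ F′) ⧺ y ◃ ε ⇄ x ◃ y ◃ (F ⧺ S) ⧺ x′ ◃ y′ ◃ u ◃ w ◃ F′ ⧺ S′)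

    module Chord {x y x′ y′ u w : V} (f : V × V) (fs bs : List (V × V))
                 (i : IsRing (flat ((x , y) ∷ (f ∷ fs) ++ (x′ , y′) ∷ (u , w) ∷ bs))) where
      xl yl xr yr : V
      xl = proj₁ (lastP f fs)
      yl = proj₂ (lastP f fs)
      xr = proj₁ (lastP (u , w) bs)
      yr = proj₂ (lastP (u , w) bs)
      F : List V
      F = flat (initP f fs)
      tail-part : List V
      tail-part = w ∷ flat bs
      shape : flat ((x , y) ∷ (f ∷ fs) ++ (x′ , y′) ∷ (u , w) ∷ bs) ≡ x ∷ y ∷ F ++ xl ∷ yl ∷ x′ ∷ y′ ∷ u ∷ tail-part
      shape = cong (λ l → x ∷ y ∷ l) (trans (flat-++ (f ∷ fs) _) (trans (cong (_++ x′ ∷ y′ ∷ u ∷ tail-part) (flat-snoc f fs)) (++-assoc≡ F _ _)))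
      i₁ : IsRing (x ∷ y ∷ F ++ xl ∷ yl ∷ x′ ∷ y′ ∷ u ∷ tail-part)
      i₁ = subst IsRing shape i
      whole : Path a x (y ∷ F ++ xl ∷ yl ∷ x′ ∷ y′ ∷ u ∷ tail-part ++ [ x ]) x
      whole = subst (λ l → Path a x (y ∷ l) x) (++-assoc≡ F _ _) (proj₁ i₁)

      red-u : Adj a x x′ → Adj a y u → ⊥
      red-u xx′ yu with whole
      ... | xy ◂ p with split F xl _ p
      ...   | p₁ , xy₁ ◂ yx′ ◂ xy′ ◂ yu′ ◂ p₂ with m , back , ρ , _ ← rev p₁ =
        shorter-path a (xx′ ◂ E-sym yx′ ◂ E-sym xy₁ ◂ back ▸ yu ◂ p₂)
          (↭-trans (prep y′ (prep x′ (prep yl (++⁺ʳ (u ∷ tail-part ++ [ x ]) ρ))))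
            (↭-trans (chord-perm₁ x xl yl x′ y′ u (y ∷ F ++ [ xl ]) tail-part)
              (↭-trans (↭-reflexive (cong (λ l → x ∷ y ∷ l) (++-assoc≡ F [ xl ] _))) (proj₂ i₁))))

      red-xl : Adj a x x′ → Adj a yr xl → ⊥
      red-xl xx′ e with whole
      ... | xy ◂ p with split F xl _ p
      ...   | p₁ , xy₁ ◂ yx′ ◂ xy′ ◂ yu′ ◂ p₂ with m , back , ρ , _ ← rev p₁ | l , ending ← flat-tail u w bs =
        shorter-path a (xx′ ◂ xy′ ◂ yu′ ◂ p₃ ▸ e ◂ back ▸ edge (E-sym xy))
          (↭-trans (prep yl (prep x′ (prep y′ (++⁺ˡ (u ∷ tail-part) (++⁺ʳ [ x ] ρ)))))
            (↭-trans (chord-perm₂ x xl yl x′ y′ u (y ∷ F ++ [ xl ]) tail-part)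
              (↭-trans (↭-reflexive (cong (λ l → x ∷ y ∷ l) (++-assoc≡ F [ xl ] _))) (proj₂ i₁))))
        where
        p₃ : Path a u tail-part yr
        p₃ = subst (λ t → Path a u t yr) (sym ending)
               (proj₁ (split l yr [ x ] (subst (λ t → Path a u t x) (trans (cong (_++ [ x ]) ending) (++-assoc≡ l [ yr ] [ x ])) p₂)))

      skips : Skip b (flat ((x , y) ∷ (f ∷ fs) ++ (x′ , y′) ∷ (u , w) ∷ bs) ++ [])
      skips = subst (Skip b) (sym (++-identityʳ≡ _)) (skip-all _ i)

      blue : Adj b y u → Adj b yr xl → ⊥
      blue yu yrxl =
        let m , back , ρ , _   = rev p-front
            m′ , back′ , σ , _ = rev p-back
            last≡ = cong proj₂ (lastP-++ (x , y) (f ∷ fs) (x′ , y′) ((u , w) ∷ bs))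
            p-seconds = subst (Path b y _) last≡ (skip-seconds (x , y) ((f ∷ fs) ++ (x′ , y′) ∷ (u , w) ∷ bs) [] skips)
        in
        shorter-path b (p-seconds ▸ yrxl ◂ back ▸ E-sym xr-x ◂ back′ ▸ edge (E-sym yu))
          (↭-trans (prep x′ (++⁺ (↭-reflexive (seconds-++ (f ∷ fs) _)) (++⁺ ρ (++⁺ʳ [ y ] σ))))
            (↭-trans (chord-perm₃ x y x′ y′ u w (firsts (f ∷ fs)) (seconds (f ∷ fs)) (firsts bs) (seconds bs))
              (↭-trans (prep x (prep y (++⁺ (↭-sym (flat-perm (f ∷ fs))) (prep x′ (prep y′ (prep u (prep w (↭-sym (flat-perm bs)))))))))
                (↭-trans (↭-reflexive (sym (flat-++ ((x , y) ∷ f ∷ fs) _))) (proj₂ i)))))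
        where
        p-front : Path b x (firsts (f ∷ fs)) xl
        p-front = skip-firsts (x , y) (f ∷ fs) (flat ((x′ , y′) ∷ (u , w) ∷ bs))
          (subst (Skip b) (flat-++ ((x , y) ∷ f ∷ fs) _) (skip-all _ i))
        i₂ : IsRing ((x ∷ y ∷ F ++ xl ∷ yl ∷ x′ ∷ y′ ∷ []) ++ u ∷ tail-part)
        i₂ = subst IsRing (cong (λ l → x ∷ y ∷ l) (sym (++-assoc≡ F _ _))) i₁
        p-back : Path b u (firsts bs) xr
        p-back = skip-firsts (u , w) bs _ (skip-all _ (rotateᵣ (x ∷ y ∷ F ++ xl ∷ yl ∷ x′ ∷ y′ ∷ []) (u ∷ tail-part) i₂))
        all : List (V × V)
        all = (f ∷ fs) ++ (x′ , y′) ∷ (u , w) ∷ bs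
        i₃ : IsRing (flat (initP (x , y) all) ++ proj₁ (lastP (x , y) all) ∷ proj₂ (lastP (x , y) all) ∷ [])
        i₃ = subst IsRing (flat-snoc (x , y) all) i
        xr-x : Adj b xr x
        xr-x = subst (λ p → Adj b (proj₁ p) x) (lastP-++ (x , y) (f ∷ fs) (x′ , y′) ((u , w) ∷ bs))
          (dist₂ (rotateᵣ (flat (initP (x , y) all)) (proj₁ (lastP (x , y) all) ∷ proj₂ (lastP (x , y) all) ∷ []) i₃))

      y≢u : y ≢ u
      y≢u = distinct (proj₂ (rotateᵣ [ x ] _ i₁)) (∈-++⁺ˡ (∈-++⁺ʳ F (there (there (there (there (here refl)))))))

      yr≢xl : yr ≢ xl
      yr≢xl e = distinct (proj₂ (rotateᵣ (x ∷ y ∷ F) _ i₁)) (∈-++⁺ˡ (there (there (there (there yr∈))))) (sym e)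
        where
        yr∈ : yr ∈ tail-part
        yr∈ = let l , f = flat-tail u w bs in subst (yr ∈_) (sym f) (∈-++⁺ʳ l (here refl))

      -- Together with the red chord xx′, either of the chords yu and `yr` `xl` gives a red cycle of
      -- length `n` if it is red. If both are blue, they link all `seconds` with all `firsts` except
      -- x′ to a blue cycle of the same length.
      no-chord : Adj a x x′ → ⊥
      no-chord xx′ with E-dich a≢b y≢u | E-dich a≢b yr≢xl
      ... | inj₁ e | _      = red-u xx′ e
      ... | inj₂ _ | inj₁ e = red-xl xx′ e
      ... | inj₂ e | inj₂ h = blue e h

    chord : ∀ {x y x′ y′} front post → IsRing (flat ((x , y) ∷ front ++ (x′ , y′) ∷ post)) → x ≢ x′ → Adj b x x′
    chord []       post i _ = dist₂ i
    chord {x} {y} {x′} {y′} (f ∷ fs) [] i _ =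
      E-sym (dist₂ (rotateᵣ (flat ((x , y) ∷ f ∷ fs)) (x′ ∷ y′ ∷ []) (subst IsRing (flat-++ ((x , y) ∷ f ∷ fs) _) i)))
    chord (f ∷ fs) ((u , w) ∷ bs) i x≢x′ with E-dich a≢b x≢x′
    ... | inj₁ e = ⊥-elim (Chord.no-chord f fs bs i e)
    ... | inj₂ e = e

    firsts-clique : ∀ ps → IsRing (flat ps) → Clique b (firsts ps)
    firsts-clique ps i {x} {x′} x∈ x′∈ x≢x′ with ∈-firsts ps x∈
    ... | pre , y , post , refl
      with ∈-firsts (post ++ pre) (in-rest (∈-++⁻ (firsts pre) (subst (x′ ∈_) (firsts-++ pre _) x′∈)))
      where
      in-rest : x′ ∈ firsts pre ⊎ x′ ∈ x ∷ firsts post → x′ ∈ firsts (post ++ pre)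
      in-rest (inj₁ j)           = subst (x′ ∈_) (sym (firsts-++ post pre)) (∈-++⁺ʳ (firsts post) j)
      in-rest (inj₂ (here refl)) = ⊥-elim (x≢x′ refl)
      in-rest (inj₂ (there j))   = subst (x′ ∈_) (sym (firsts-++ post pre)) (∈-++⁺ˡ j)
    ... | front , y′ , back , e =
      chord front back (subst (λ l → IsRing (flat ((x , y) ∷ l))) e
        (subst IsRing (sym (flat-++ ((x , y) ∷ post) pre)) (rotateᵣ (flat pre) (flat ((x , y) ∷ post)) (subst IsRing (flat-++ pre _) i)))) x≢x′

    -- The same cycle paired one position later, so that `firsts` and `seconds` change places.
    shift-pairs : V → V × V → List (V × V) → List (V × V)
    shift-pairs x (_ , y) []             = (y , x) ∷ []
    shift-pairs x (_ , y) ((u , w) ∷ ps) = (y , u) ∷ shift-pairs x (u , w) ps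

    flat-shift : ∀ x u y ps → flat (shift-pairs x (u , y) ps) ≡ y ∷ flat ps ++ [ x ]
    flat-shift x u y []             = refl
    flat-shift x u y ((v , w) ∷ ps) = cong (λ l → y ∷ v ∷ l) (flat-shift x v w ps)

    firsts-shift : ∀ x p ps → firsts (shift-pairs x p ps) ≡ seconds (p ∷ ps)
    firsts-shift x p []       = refl
    firsts-shift x p (q ∷ ps) = cong (proj₂ p ∷_) (firsts-shift x q ps)

    seconds-clique : ∀ ps → IsRing (flat ps) → Clique b (seconds ps)
    seconds-clique []             i ()
    seconds-clique ((x , y) ∷ ps) i = subst (Clique b) (firsts-shift x (x , y) ps)
      (firsts-clique (shift-pairs x (x , y) ps) (subst IsRing (sym (flat-shift x x y ps)) (rotateᵣ [ x ] _ i)))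

  -- Cliques joined by disjoint edges and paths

  select-perm = shuffle 1 2 (λ x ys zs → x ◃ ys ⧺ zs ⇄ ys ⧺ x ◃ zs)

  select : ∀ p xs → ∃₂ λ ys zs → xs ↭ ys ++ zs × (∀ {y} → y ∈ ys → p y ≡ true) × (∀ {z} → z ∈ zs → p z ≡ false) × length ys ≡ cnt p xs
  select p [] = [] , [] , ↭-refl , (λ ()) , (λ ()) , refl
  select p (x ∷ xs) with select p xs | p x in e
  ... | ys , zs , π , f , g , l | true  = x ∷ ys , zs , prep x π , (λ { (here refl) → e ; (there i) → f i }) , g , cong suc l
  ... | ys , zs , π , f , g , l | false = ys , x ∷ zs , ↭-trans (prep x π) (select-perm x ys zs) , f , (λ { (here refl) → e ; (there i) → g i }) , l

  clique-walk : ∀ {b} x us t → Unique (x ∷ us ++ [ t ]) → Clique b (x ∷ us ++ [ t ]) → Path b x (us ++ [ t ]) t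
  clique-walk x []       t (h AllPairs.∷ _) k = edge (k (here refl) (there (here refl)) (All.lookup h (here refl)))
  clique-walk x (u ∷ us) t (h AllPairs.∷ v) k =
    k (here refl) (there (here refl)) (All.lookup h (here refl)) ◂ clique-walk u us t v (λ i j → k (there i) (there j))

  length-take≡ : ∀ n (xs : List V) → n ≤ length xs → length (take n xs) ≡ n
  length-take≡ n xs h = trans (length-take n xs) (m≤n⇒m⊓n≡m h)

  take-drop : ∀ n (xs : List V) → xs ↭ take n xs ++ drop n xs
  take-drop n xs = ↭-reflexive (sym (take++drop≡id n xs))

  join-perm = shuffle 4 7 (λ x x′ y y′ R R′ T T′ W W′ Z → (((x ◃ x′ ◃ R ⧺ R′) ⧺ y ◃ y′ ◃ T ⧺ T′) ⧺ W ⧺ W′) ⧺ Z ⇄ ((W ⧺ y ◃ ε) ⧺ (T ⧺ y′ ◃ ε) ⧺ (W′ ⧺ x′ ◃ ε) ⧺ R ⧺ x ◃ ε) ⧺ R′ ⧺ T′ ⧺ Z)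
  walk-perm = shuffle 2 2 (λ x x′ R D → x ◃ x′ ◃ R ⧺ D ⇄ (x′ ◃ R ⧺ x ◃ ε) ⧺ D)
  walk-perm′ = shuffle 2 2 (λ y y′ T D → y ◃ y′ ◃ T ⧺ D ⇄ (y ◃ T ⧺ y′ ◃ ε) ⧺ D)

  -- Two cliques joined by two disjoint paths contain cycles of all lengths in a range.
  join : ∀ {b A P Q x x′ y y′ R T} W W′ i j → Unique A → Clique b P → Clique b Q → (P ++ Q) ++ W ++ W′ ⊑ A →
         P ↭ x ∷ x′ ∷ R → Q ↭ y ∷ y′ ∷ T → Path b x (W ++ [ y ]) y → Path b y′ (W′ ++ [ x′ ]) x′ →
         i ≤ length R → j ≤ length T → Cycle b ((length W + 1) + ((j + 1) + ((length W′ + 1) + (i + 1)))) A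
  join {b} {A} {P} {Q} {x} {x′} {y} {y′} {R} {T} W W′ i j unique kP kQ (Z , σ) π ρ p q i≤ j≤ =
    cycle ((W ++ [ y ]) ++ (T₁ ++ [ y′ ]) ++ (W′ ++ [ x′ ]) ++ R₁ ++ [ x ])
      (p ▸ clique-walk y T₁ y′ (Unique-⊑ unique (⊑-trans subQ (⊑-trans (⊑-dropˡ P Q ⊑-refl) PQ⊑A))) (Clique-⊑ subQ kQ) ▸ q ▸
       clique-walk x′ R₁ x (Unique-⊑ unique (⊑-trans subP (⊑-trans (⊑-dropʳ P Q ⊑-refl) PQ⊑A))) (Clique-⊑ subP kP))
      len
      (R₂ ++ T₂ ++ Z , ↭-trans σ (↭-trans (++⁺ʳ Z (++⁺ʳ (W ++ W′) (++⁺ π′ ρ′))) (join-perm x x′ y y′ R₁ R₂ T₁ T₂ W W′ Z)))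
    where
    R₁ R₂ T₁ T₂ : List V
    R₁ = take i R
    R₂ = drop i R
    T₁ = take j T
    T₂ = drop j T
    PQ⊑A : P ++ Q ⊑ A
    PQ⊑A = ⊑-dropʳ (P ++ Q) (W ++ W′) (Z , σ)
    π′ : P ↭ x ∷ x′ ∷ R₁ ++ R₂
    π′ = ↭-trans π (prep x (prep x′ (take-drop i R)))
    ρ′ : Q ↭ y ∷ y′ ∷ T₁ ++ T₂
    ρ′ = ↭-trans ρ (prep y (prep y′ (take-drop j T)))
    subP : x′ ∷ R₁ ++ [ x ] ⊑ P
    subP = R₂ , ↭-trans π′ (walk-perm x x′ R₁ R₂)
    subQ : y ∷ T₁ ++ [ y′ ] ⊑ Q
    subQ = T₂ , ↭-trans ρ′ (walk-perm′ y y′ T₁ T₂)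
    len : length ((W ++ [ y ]) ++ (T₁ ++ [ y′ ]) ++ (W′ ++ [ x′ ]) ++ R₁ ++ [ x ]) ≡ (length W + 1) + ((j + 1) + ((length W′ + 1) + (i + 1)))
    len = trans (length-++ (W ++ [ y ])) (cong₂ _+_ (length-++ W)
            (trans (length-++ (T₁ ++ [ y′ ])) (cong₂ _+_ (trans (length-++ T₁) (cong (_+ 1) (length-take≡ j T j≤)))
              (trans (length-++ (W′ ++ [ x′ ])) (cong₂ _+_ (length-++ W′) (trans (length-++ R₁) (cong (_+ 1) (length-take≡ i R i≤))))))))

  take₂ : ∀ {x y : V} {xs} → x ∈ xs → y ∈ xs → x ≢ y → ∃ λ zs → xs ↭ x ∷ y ∷ zs
  take₂ x∈ y∈ n = pair-⊑ x∈ y∈ n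

  two-edges-cycle : ∀ {b A P Q x x′ y y′} i j → Unique A → Clique b P → Clique b Q → P ++ Q ⊑ A →
                    x ∈ P → x′ ∈ P → y ∈ Q → y′ ∈ Q → x ≢ x′ → y ≢ y′ → Adj b x y → Adj b x′ y′ →
                    2 + i ≤ length P → 2 + j ≤ length Q → Cycle b (4 + (i + j)) A
  two-edges-cycle {b} {A} {P} {Q} i j unique kP kQ PQ⊑A x∈ x′∈ y∈ y′∈ x≢ y≢ e e′ i≤ j≤ with take₂ x∈ x′∈ x≢ | take₂ y∈ y′∈ y≢
  ... | R , π | T , ρ = subst (λ n → Cycle b n A) (count i j)
    (join [] [] i j unique kP kQ (↭-⊑ (↭-reflexive (++-identityʳ≡ (P ++ Q))) PQ⊑A) π ρ (edge e) (edge (E-sym e′))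
      (s≤s⁻¹ (s≤s⁻¹ (≤-trans i≤ (≤-reflexive (↭-length π))))) (s≤s⁻¹ (s≤s⁻¹ (≤-trans j≤ (≤-reflexive (↭-length ρ))))))
    where
    count = farkas-≡ 2 (λ i j → ⊢ con 1 :+ ((j :+ con 1) :+ (con 1 :+ (i :+ con 1))) := con 4 :+ (i :+ j)) 0 []

  edge? : ∀ (p q : V → Bool) b X Y →
          (∃₂ λ x y → x ∈ X × y ∈ Y × p x ≡ true × q y ≡ true × Adj b x y) ⊎
          (∀ {x y} → x ∈ X → y ∈ Y → p x ≡ true → q y ≡ true → Adj b x y → ⊥)
  edge? p q b []       Y = inj₂ λ ()
  edge? p q b (x ∷ X) Y with find? (λ y → p x ∧ (q y ∧ E b x y)) Y | edge? p q b X Y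
  ... | inj₁ (y , y∈ , e) | _ = let e₁ , e′ = ∧-true {p x} e ; e₂ , e₃ = ∧-true {q y} e′ in inj₁ (x , y , here refl , y∈ , e₁ , e₂ , e₃)
  ... | inj₂ _ | inj₁ (u , y , u∈ , rest) = inj₁ (u , y , there u∈ , rest)
  ... | inj₂ f | inj₂ g = inj₂ λ where
    (here refl) y∈ px qy e → true≢false (true-∧ px (true-∧ qy e)) (f y∈)
    (there x∈)  y∈ px qy e → g x∈ y∈ px qy e

  other-than : V → V → Bool
  other-than v x = not (does (v ≟ x))

  other-true : ∀ {v x} → v ≢ x → other-than v x ≡ true
  other-true {v} {x} h with v ≟ x
  ... | yes e = ⊥-elim (h e)
  ... | no  _ = refl

  other-≢ : ∀ {v x} → other-than v x ≡ true → v ≢ x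
  other-≢ {v} {x} h e with v ≟ x
  other-≢ {v} {x} () e | yes _
  ... | no n = n e

  Star : Bool → List V → List V → Set
  Star b X Y = ∃ λ c → (c ∈ X × (∀ {x y} → x ∈ X → y ∈ Y → Adj b x y → x ≡ c)) ⊎
                       (c ∈ Y × (∀ {x y} → x ∈ X → y ∈ Y → Adj b x y → y ≡ c))
  -- A bipartite graph without two disjoint edges is a star; `x₀` is the default centre when there
  -- are no edges.
  star : ∀ {b x₀ X Y} → x₀ ∈ X →
         (∀ {x x′ y y′} → x ∈ X → x′ ∈ X → y ∈ Y → y′ ∈ Y → x ≢ x′ → y ≢ y′ → Adj b x y → Adj b x′ y′ → ⊥) → Star b X Y
  star {b} {x₀} {X} {Y} x₀∈ h with edge? (λ _ → true) (λ _ → true) b X Y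
  ... | inj₂ none = x₀ , inj₁ (x₀∈ , λ x∈ y∈ e → ⊥-elim (none x∈ y∈ refl refl e))
  ... | inj₁ (x , y , x∈ , y∈ , _ , _ , e) with edge? (other-than x) (λ _ → true) b X Y
  ...   | inj₂ none = x , inj₁ (x∈ , centre)
    where
    centre : ∀ {u v} → u ∈ X → v ∈ Y → Adj b u v → u ≡ x
    centre {u} u∈ v∈ e with x ≟ u
    ... | yes r = sym r
    ... | no  n = ⊥-elim (none u∈ v∈ (other-true n) refl e)
  ...   | inj₁ (x′ , y′ , x′∈ , y′∈ , o , _ , e′) = y , inj₂ (y∈ , centre)
    where
    centre : ∀ {u v} → u ∈ X → v ∈ Y → Adj b u v → v ≡ y
    centre {u} {v} u∈ v∈ f with v ≟ y
    ... | yes r = r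
    ... | no  n with x ≟ u
    ...   | no  k    = ⊥-elim (h x∈ u∈ y∈ v∈ k (n ∘ sym) e f)
    ...   | yes refl with y ≟ y′
    ...     | yes refl = ⊥-elim (h x∈ x′∈ v∈ y′∈ (other-≢ o) n f e′)
    ...     | no  k    = ⊥-elim (h x∈ x′∈ y∈ y′∈ (other-≢ o) k e e′)

  -- The structure left by a cycle of length 2q + 2

  zigzag : ∀ {a} x R pool → (∀ {r p} → r ∈ x ∷ R → p ∈ pool → Adj a r p) → length R ≤ length pool →
           ∃ λ z → z ∈ x ∷ R × Woven a x R z (length R) [] pool
  zigzag {a} x R pool h le = let z , z∈ , s = steps x R h in z , z∈ , weave [] s (pool , ↭-refl) le
    where
    steps : ∀ x R → (∀ {r p} → r ∈ x ∷ R → p ∈ pool → Adj a r p) → ∃ λ z → z ∈ x ∷ R × Steps a (length pool) pool x R z (length R)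
    steps x []      h = x , here refl , done
    steps x (y ∷ R) h = let z , z∈ , s = steps y R (h ∘ there) in
      z , there z∈ , insert (≤-reflexive (sym (cnt-all _ pool λ i → true-∧ (h (here refl) i) (h (there (here refl)) i)))) s

  -- What an `a`-coloured cycle of length 2q + 2 looks like if no monochromatic cycle has length 2q
  -- + 1: alternate positions form two `b`-cliques, and every `b`-edge between them meets `z`. The
  -- neighbours of `z` on the cycle are kept as `y₁` and `y₂`.
  record Structure (a b : Bool) (q : ℕ) (S : List V) : Set where
    field
      z y₁ y₂ : V
      X Y     : List V
      X-length : length X ≡ q
      Y-length : length Y ≡ suc q
      inside   : (z ∷ X) ++ Y ⊑ S
      X-clique : Clique b (z ∷ X)
      Y-clique : Clique b Y
      cross    : ∀ {x y} → x ∈ X → y ∈ Y → Adj a x y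
      y₁∈      : y₁ ∈ Y
      y₂∈      : y₂ ∈ Y
      y₁≢y₂    : y₁ ≢ y₂
      zy₁      : Adj a z y₁
      zy₂      : Adj a z y₂

  ∈-other : ∀ {y y₁ y₂ : V} {Y} → y₁ ∈ Y → y₂ ∈ Y → y₁ ≢ y₂ → (P : V → Set) → P y₁ → P y₂ → ∃ λ y₀ → y₀ ∈ Y × y₀ ≢ y × P y₀
  ∈-other {y} {y₁} {y₂} i j n P p₁ p₂ with y₁ ≟ y
  ... | no k     = y₁ , i , k , p₁
  ... | yes refl = y₂ , j , n ∘ sym , p₂

  around-perm₁ = shuffle 3 4 (λ w x y R new D Z → (w ◃ (x ◃ R) ⧺ y ◃ new ⧺ D) ⧺ Z ⇄ (x ◃ (R ⧺ new) ⧺ y ◃ w ◃ ε) ⧺ D ⧺ Z)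
  around-perm₂ = shuffle 6 4 (λ w z x x′ y y₀ R new D Z → (w ◃ z ◃ (x ◃ x′ ◃ R) ⧺ y ◃ y₀ ◃ new ⧺ D) ⧺ Z ⇄ (z ◃ y₀ ◃ x ◃ (R ⧺ new) ⧺ y ◃ w ◃ ε) ⧺ x′ ◃ D ⧺ Z)
  around-len₁ = farkas-≡ 5
    (λ r s q v k → v := r :+ r :⇒ con 1 :+ r := q :⇒ s := con 1 :+ (v :+ con 2) :⇒ k := con 1 :+ 2 :* q :⇒ ⊢ s := k)
    0 (1 ∷ 0 ∷ 2 ∷ 0 ∷ 1 ∷ 0 ∷ 0 ∷ 1 ∷ [])
  around-len₂ = farkas-≡ 5
    (λ r s q v k → v := r :+ r :⇒ con 2 :+ r := q :⇒ s := con 3 :+ (v :+ con 2) :⇒ k := con 1 :+ 2 :* q :⇒ ⊢ s := k)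
    0 (1 ∷ 0 ∷ 2 ∷ 0 ∷ 1 ∷ 0 ∷ 0 ∷ 1 ∷ [])

  two : ∀ (xs : List V) → 2 ≤ length xs → ∃₂ λ x y → ∃ λ zs → xs ↭ x ∷ y ∷ zs
  two (x ∷ y ∷ zs) _ = x , y , zs , ↭-refl
  two (x ∷ [])     (s≤s ())

  module Around {a b q S} (st : Structure a b q S) (q≥2 : 2 ≤ q) where
    open Structure st

    -- A vertex joined to both sides of the structure closes a path with 2q vertices to a cycle.
    around-X : ∀ {A w x y} → w ∷ X ++ Y ⊑ A → x ∈ X → y ∈ Y → Adj a w x → Adj a w y → Cycle a (1 + 2 * q) A
    around-X {A} {w} {x} {y} (Z , σ) x∈ y∈ wx wy =
      let R , π  = ∈-take x∈
          Y′ , ρ = ∈-take y∈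
          R-length = trans (sym (↭-length π)) X-length
          Y′-length = trans (sym (↭-length ρ)) Y-length
          v , v∈ , woven new vs p τ nl ni = zigzag x R Y′
            (λ i j → cross (∈-resp-↭ (↭-sym π) i) (∈-resp-↭ (↭-sym ρ) (there j)))
            (≤-trans (m≤n+m _ 1) (≤-reflexive (trans R-length (sym (suc-injective Y′-length)))))
          D , δ = ⊑-dropʳ new [] ni
          path = wx ◂ p ▸ cross (∈-resp-↭ (↭-sym π) v∈) y∈ ◂ edge (E-sym wy)
          vs-length = trans (↭-length τ) (trans (length-++ R) (cong (length R +_) nl))
          len = cong suc (length-++ vs)
      in cycle (x ∷ vs ++ y ∷ [ w ]) path
           (around-len₁ (length R) _ q (length vs) (1 + 2 * q) vs-length R-length len refl)
           (↭-⊑ (prep x (++⁺ʳ (y ∷ [ w ]) τ))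
             (D ++ Z , ↭-trans σ (↭-trans (++⁺ʳ Z (prep w (++⁺ π (↭-trans ρ (prep y δ))))) (around-perm₁ w x y R new D Z))))

    -- The cycle continues from `z` to a neighbour `y₀` other than `y`; this is why two neighbours
    -- of `z` are recorded. One vertex of `X` is left out to obtain the right length.
    around-z : ∀ {A w y} → w ∷ (z ∷ X) ++ Y ⊑ A → y ∈ Y → Adj a w z → Adj a w y → Cycle a (1 + 2 * q) A
    around-z {A} {w} {y} (Z , σ) y∈ wz wy =
      let y₀ , y₀∈ , y₀≢y , zy₀ = ∈-other {y = y} y₁∈ y₂∈ y₁≢y₂ (λ t → Adj a z t) zy₁ zy₂
          x , x′ , R , π = two X (≤-trans q≥2 (≤-reflexive (sym X-length)))
          sub : ∀ {r} → r ∈ x ∷ R → r ∈ X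
          sub = λ { (here refl) → ∈-resp-↭ (↭-sym π) (here refl) ; (there i) → ∈-resp-↭ (↭-sym π) (there (there i)) }
          R-length = trans (sym (↭-length π)) X-length
          Y″ , ρ = take₂ y∈ y₀∈ (y₀≢y ∘ sym)
          Y″-length = trans (sym (↭-length ρ)) Y-length
          v , v∈ , woven new vs p τ nl ni = zigzag x R Y″
            (λ i k → cross (sub i) (∈-resp-↭ (↭-sym ρ) (there (there k))))
            (≤-trans (m≤n+m _ 1) (≤-reflexive (suc-injective (trans R-length (sym (suc-injective Y″-length))))))
          D , δ = ⊑-dropʳ new [] ni
          path = wz ◂ zy₀ ◂ E-sym (cross (sub (here refl)) y₀∈) ◂ p ▸ cross (sub v∈) y∈ ◂ edge (E-sym wy)
          vs-length = trans (↭-length τ) (trans (length-++ R) (cong (length R +_) nl))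
          len = cong (λ n → suc (suc (suc n))) (length-++ vs)
      in cycle (z ∷ y₀ ∷ x ∷ vs ++ y ∷ [ w ]) path
           (around-len₂ (length R) _ q (length vs) (1 + 2 * q) vs-length R-length len refl)
           (↭-⊑ (prep z (prep y₀ (prep x (++⁺ʳ (y ∷ [ w ]) τ))))
             (x′ ∷ D ++ Z , ↭-trans σ (↭-trans (++⁺ʳ Z (prep w (prep z (++⁺ π (↭-trans ρ (prep y (prep y₀ δ)))))))
               (around-perm₂ w z x x′ y y₀ R new D Z))))

    around : ∀ {A w x y} → w ∷ (z ∷ X) ++ Y ⊑ A → x ∈ z ∷ X → y ∈ Y → Adj a w x → Adj a w y → Cycle a (1 + 2 * q) A
    around h (here refl) y∈ wx wy = around-z h y∈ wx wy
    around {w = w} h (there x∈) y∈ wx wy = around-X (⊑-dropˡ [ z ] _ (↭-⊑ (swap z w ↭-refl) h)) x∈ y∈ wx wy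

  module FromRing {a b : Bool} (a≢b : a ≢ b) {S : List V} (unique : Unique S) {q : ℕ} (q≥1 : 1 ≤ q)
                  (none : ∀ c → Cycle c (1 + 2 * q) S → ⊥)
                  {L : List V} (L⊑S : L ⊑ S) (L-length : length L ≡ suc (1 + 2 * q)) where
    open Rings a≢b unique none L⊑S L-length

    structure-at : ∀ {c} ps → IsRing (flat ps) → length ps ≡ suc q → c ∈ firsts ps →
                   (∀ {x y} → x ∈ firsts ps → y ∈ seconds ps → Adj b x y → x ≡ c) → Structure a b q S
    structure-at {c} ps i len c∈ centre with ∈-firsts ps c∈
    ... | pre , y , post , refl = rotated (post ++ pre) refl
            (subst IsRing (sym (flat-++ ((c , y) ∷ post) pre)) (rotateᵣ (flat pre) (flat ((c , y) ∷ post)) (subst IsRing (flat-++ pre _) i)))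
      where
      rotate-firsts : ∀ {x} → x ∈ firsts (((c , y) ∷ post) ++ pre) → x ∈ firsts (pre ++ (c , y) ∷ post)
      rotate-firsts {x} j = subst (x ∈_) (sym (firsts-++ pre _)) (∈-resp-↭ (rotate-perm (firsts pre) (firsts ((c , y) ∷ post))) (subst (x ∈_) (firsts-++ ((c , y) ∷ post) pre) j))
      rotate-seconds : ∀ {x} → x ∈ seconds (((c , y) ∷ post) ++ pre) → x ∈ seconds (pre ++ (c , y) ∷ post)
      rotate-seconds {x} j = subst (x ∈_) (sym (seconds-++ pre _)) (∈-resp-↭ (rotate-perm (seconds pre) (seconds ((c , y) ∷ post))) (subst (x ∈_) (seconds-++ ((c , y) ∷ post) pre) j))
      rest-length : length (post ++ pre) ≡ q
      rest-length = suc-injective (trans (cong suc (trans (length-++ post) (+-comm (length post) (length pre)))) (trans (trans (sym (+-suc (length pre) (length post))) (sym (length-++ pre))) len))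
      rotated : ∀ qs → qs ≡ post ++ pre → IsRing (flat ((c , y) ∷ qs)) → Structure a b q S
      rotated []       e _ = 1≰0 (≤-trans q≥1 (≤-reflexive (trans (sym rest-length) (cong length (sym e)))))
      rotated (p ∷ qs) e i′ = record
        { z = c ; y₁ = y ; y₂ = proj₂ (lastP p qs) ; X = firsts (p ∷ qs) ; Y = seconds ((c , y) ∷ p ∷ qs)
        ; X-length = trans (firsts-length (p ∷ qs)) (trans (cong length e) rest-length)
        ; Y-length = trans (seconds-length ((c , y) ∷ p ∷ qs)) (cong suc (trans (cong length e) rest-length))
        ; inside = ↭-⊑ (↭-sym (flat-perm ((c , y) ∷ p ∷ qs))) (↭-⊑ (proj₂ i′) L⊑S)
        ; X-clique = firsts-clique ((c , y) ∷ p ∷ qs) i′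
        ; Y-clique = seconds-clique ((c , y) ∷ p ∷ qs) i′
        ; cross = cross
        ; y₁∈ = here refl ; y₂∈ = there (last-∈ p qs)
        ; y₁≢y₂ = λ { refl → Unique-≢ seconds-unique ⊑-refl (last-∈ p qs) refl }
        ; zy₁ = first-edge c y (flat (p ∷ qs)) (proj₁ i′)
        ; zy₂ = E-sym (first-edge t′ c (y ∷ flat (initP p qs) ++ [ s′ ]) (proj₁ (rotateᵣ (front ++ [ s′ ]) (t′ ∷ []) (subst IsRing (trans (flat-snoc (c , y) (p ∷ qs)) (sym (++-assoc≡ front [ s′ ] _))) i′))))
        }
        where
        s′ t′ : V
        s′ = proj₁ (lastP p qs)
        t′ = proj₂ (lastP p qs)
        front : List V
        front = flat (initP (c , y) (p ∷ qs))
        last-∈ : ∀ p qs → proj₂ (lastP p qs) ∈ seconds (p ∷ qs)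
        last-∈ p []       = here refl
        last-∈ p (q ∷ qs) = there (last-∈ q qs)
        first-edge : ∀ u v l → Ring a (u ∷ v ∷ l) → Adj a u v
        first-edge u v l (e ◂ _) = e
        both-unique : Unique ((c ∷ firsts (p ∷ qs)) ++ seconds ((c , y) ∷ p ∷ qs))
        both-unique = Unique-⊑ unique (↭-⊑ (↭-sym (flat-perm ((c , y) ∷ p ∷ qs))) (↭-⊑ (proj₂ i′) L⊑S))
        seconds-unique : Unique (seconds ((c , y) ∷ p ∷ qs))
        seconds-unique = Unique-⊑ both-unique (⊑-dropˡ (c ∷ firsts (p ∷ qs)) _ ⊑-refl)
        cross : ∀ {x y′} → x ∈ firsts (p ∷ qs) → y′ ∈ seconds ((c , y) ∷ p ∷ qs) → Adj a x y′
        cross {x} {y′} x∈ y∈ with E-dich a≢b (λ { refl → ⊑-disjoint both-unique ⊑-refl (there x∈) y∈ })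
        ... | inj₁ h = h
        ... | inj₂ h = ⊥-elim (Unique-≢ both-unique ⊑-refl (∈-++⁺ˡ x∈)
                (sym (centre (rotate-firsts (there (subst (λ l → x ∈ firsts l) e x∈))) (rotate-seconds (subst (λ l → y′ ∈ y ∷ seconds l) e y∈)) h)))

    seconds-shift : ∀ x p ps → seconds (shift-pairs x p ps) ≡ firsts ps ++ [ x ]
    seconds-shift x p []       = refl
    seconds-shift x p (q ∷ ps) = cong (proj₁ q ∷_) (seconds-shift x q ps)

    shift-length : ∀ x p ps → length (shift-pairs x p ps) ≡ suc (length ps)
    shift-length x p []       = refl
    shift-length x p (q ∷ ps) = cong suc (shift-length x q ps)

    module _ (x y : V) (ps : List (V × V)) (i : IsRing (x ∷ y ∷ flat ps)) (len : length ps ≡ q) (q≥2 : 2 ≤ q) where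
      all shifted : List (V × V)
      all     = (x , y) ∷ ps
      shifted = shift-pairs x (x , y) ps

      XY⊑S : firsts all ++ seconds all ⊑ S
      XY⊑S = ↭-⊑ (↭-sym (flat-perm all)) (↭-⊑ (proj₂ i) L⊑S)

      j : ℕ
      j = proj₁ (2+ q≥2)

      two-edges-len = farkas-≡ 2 (λ j q → q := con 2 :+ j :⇒ ⊢ con 4 :+ ((con 1 :+ j) :+ j) := con 1 :+ 2 :* q) 0 (0 ∷ 2 ∷ [])

      X-long : 2 + suc j ≤ length (firsts all)
      X-long = ≤-reflexive (trans (cong suc (sym (proj₂ (2+ q≥2)))) (sym (trans (firsts-length all) (cong suc len))))

      Y-long : 2 + j ≤ length (seconds all)
      Y-long = ≤-trans (≤-reflexive (sym (proj₂ (2+ q≥2)))) (≤-trans (m≤n+m q 1) (≤-reflexive (sym (trans (seconds-length all) (cong suc len)))))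

      -- The two edges join all q + 1 vertices of one clique and q of the other to a cycle of length
      -- 2q + 1. Hence the `b`-edges between the cliques form a star.
      two-edges : ∀ {u u′ v v′} → u ∈ firsts all → u′ ∈ firsts all → v ∈ seconds all → v′ ∈ seconds all →
                  u ≢ u′ → v ≢ v′ → Adj b u v → Adj b u′ v′ → ⊥
      two-edges u∈ u′∈ v∈ v′∈ u≢ v≢ e e′ =
        none b (subst (λ n → Cycle b n S) (two-edges-len j q (proj₂ (2+ q≥2)))
          (two-edges-cycle (suc j) j unique (firsts-clique all i) (seconds-clique all i) XY⊑S u∈ u′∈ v∈ v′∈ u≢ v≢ e e′ X-long Y-long))

      shifted-ring : IsRing (flat shifted)
      shifted-ring = subst IsRing (sym (flat-shift x x y ps)) (rotateᵣ [ x ] (y ∷ flat ps) i)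

      last-first : ∀ {v} → v ∈ firsts ps ++ [ x ] → v ∈ x ∷ firsts ps
      last-first j with ∈-++⁻ (firsts ps) j
      ... | inj₁ k           = there k
      ... | inj₂ (here refl) = here refl

      structure-from : Star b (firsts all) (seconds all) → Structure a b q S
      structure-from (c , inj₁ (c∈ , centre)) = structure-at all i (cong suc len) c∈ centre
      -- The centre is among the `seconds`; pairing the cycle one position later moves it to the
      -- `firsts`.
      structure-from (c , inj₂ (c∈ , centre)) =
        structure-at shifted shifted-ring (trans (shift-length x (x , y) ps) (cong suc len))
          (subst (c ∈_) (sym (firsts-shift x (x , y) ps)) c∈)
          (λ {u} {v} u∈ v∈ e → centre (last-first (subst (v ∈_) (seconds-shift x (x , y) ps) v∈))
                                      (subst (u ∈_) (firsts-shift x (x , y) ps) u∈) (E-sym e))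

      structure : Structure a b q S
      structure = structure-from (star (here refl) two-edges)

  -- A monochromatic triangle among six vertices

  five = farkas 3 (λ s t l → con 5 :≤ l :⇒ s :+ t := l :⇒ s :≤ con 2 :⇒ t :≤ con 2 :⇒ ⊢⊥) 0 (1 ∷ 0 ∷ 1 ∷ 1 ∷ 1 ∷ [])

  E-count : ∀ {v} xs → (∀ {x} → x ∈ xs → v ≢ x) → ∀ {a b} → a ≢ b → cnt (E a v) xs + cnt (E b v) xs ≡ length xs
  E-count {v} xs h {a} {b} a≢b = length-cnt (E a v) (E b v) xs one
    where
    one : ∀ {x} → x ∈ xs → ⟦ E a v x ⟧ + ⟦ E b v x ⟧ ≡ 1
    one {x} x∈ with E-dich a≢b (h x∈)
    ... | inj₁ e rewrite e | Adj-not a≢b e = refl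
    ... | inj₂ e rewrite e | Adj-not (a≢b ∘ sym) e = refl

  triangle-perm₁ = shuffle 3 2 (λ v x y ws zs → v ◃ (x ◃ y ◃ ws) ⧺ zs ⇄ (x ◃ y ◃ v ◃ ε) ⧺ ws ⧺ zs)
  triangle-perm₂ = shuffle 4 2 (λ v x y z ws zs → v ◃ (x ◃ y ◃ z ◃ ws) ⧺ zs ⇄ (y ◃ z ◃ x ◃ ε) ⧺ v ◃ ws ⧺ zs)

  monochromatic-nbrs : ∀ {v S} c → Unique S → 3 ≤ cnt (E c v) S → ∃ λ c → Cycle c 3 (v ∷ S)
  monochromatic-nbrs {v} {S} c unique le with select (E c v) S
  ... | []              , zs , π , f , _ , len = ⊥-elim (1≰0 (≤-trans (s≤s z≤n) (≤-trans le (≤-reflexive (sym len)))))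
  ... | _ ∷ []          , zs , π , f , _ , len = ⊥-elim (1≰0 (s≤s⁻¹ (≤-trans (s≤s (s≤s z≤n)) (≤-trans le (≤-reflexive (sym len))))))
  ... | _ ∷ _ ∷ []      , zs , π , f , _ , len = ⊥-elim (1≰0 (s≤s⁻¹ (s≤s⁻¹ (≤-trans le (≤-reflexive (sym len))))))
  ... | p ∷ q ∷ r ∷ ys′ , zs , π , f , _ , len with edge-or-clique (≢-not ∘ sym) (p ∷ q ∷ r ∷ ys′) (Unique-⊑ unique (zs , π))
  ...   | inj₁ (x , y , ws , xy , σ) =
    c , cycle (x ∷ y ∷ v ∷ []) (f (∈-resp-↭ (↭-sym σ) (here refl)) ◂ xy ◂ edge (E-sym (f (∈-resp-↭ (↭-sym σ) (there (here refl)))))) refl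
          (ws ++ zs , ↭-trans (prep v (↭-trans π (++⁺ʳ zs σ))) (triangle-perm₁ v x y ws zs))
  ...   | inj₂ k with Unique-⊑ unique (zs , π)
  ...     | (p≢q All.∷ p≢r All.∷ _) AllPairs.∷ (q≢r All.∷ _) AllPairs.∷ _ =
    not c , cycle (q ∷ r ∷ p ∷ [])
      (k (here refl) (there (here refl)) p≢q ◂ k (there (here refl)) (there (there (here refl))) q≢r ◂ edge (k (there (there (here refl))) (here refl) (p≢r ∘ sym))) refl
      (v ∷ ys′ ++ zs , ↭-trans (prep v π) (triangle-perm₂ v p q r ys′ zs))

  triangle : ∀ {S} → Unique S → 6 ≤ length S → ∃ λ c → Cycle c 3 S
  triangle {v ∷ S} (h AllPairs.∷ unique) (s≤s big) with 3 ≤? cnt (E true v) S | 3 ≤? cnt (E false v) S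
  ... | yes i | _     = monochromatic-nbrs true unique i
  ... | no _  | yes j = monochromatic-nbrs false unique j
  ... | no i  | no j  = ⊥-elim (five (cnt (E true v) S) (cnt (E false v) S) (length S) big
                          (E-count S (All.lookup h) λ ()) (s≤s⁻¹ (≰⇒> i)) (s≤s⁻¹ (≰⇒> j)))

  -- Sets without a monochromatic cycle of length 2q + 1

  module NoMono {S : List V} (unique : Unique S) {q : ℕ} (q≥3 : 3 ≤ q) (large : 3 * q + 2 ≤ length S)
                (none : ∀ c → Cycle c (1 + 2 * q) S → ⊥) (no-structure : ∀ {a b} → a ≢ b → Structure a b q S → ⊥) where

    k≥3₁ = farkas 2 (λ q e → con 3 :≤ q :⇒ ⊢ con 3 :≤ con 1 :+ (q :+ e)) 2 (2 ∷ [])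
    six = farkas 2 (λ q s → con 3 :≤ q :⇒ 3 :* q :+ con 2 :≤ s :⇒ ⊢ con 6 :≤ s) 10 (18 ∷ 6 ∷ [])
    small-cycle = farkas 3 (λ q l s → 3 :* q :+ con 2 :≤ s :⇒ l :≤ 2 :* q :⇒ ⊢ 3 :* l :+ con 4 :≤ 2 :* s) 0 (2 ∷ 3 ∷ [])
    not-less = farkas 2 (λ q k → (con 1 :+ k) :≤ con 1 :+ 2 :* q :⇒ ⊢ k :≤ 2 :* q) 0 (1 ∷ [])

    odd-length = farkas-≡ 2 (λ e q → ⊢ con 1 :+ (2 :* e :+ (con 1 :+ 2 :* q)) := 2 :* (con 1 :+ (q :+ e))) 0 []
    even-length = farkas-≡ 2 (λ e q → ⊢ con 1 :+ (2 :* (con 1 :+ e) :+ (con 1 :+ 2 :* q)) := 2 :* (con 2 :+ (q :+ e))) 0 []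
    two-q = farkas-≡ 1 (λ q → ⊢ 2 :* q :+ con 2 := 2 :* (con 1 :+ q)) 0 []

    odd-step : ∀ {n k c} → n ≡ 2 * k → 3 ≤ k → (∀ c → Cycle c n S → ⊥) → Cycle c (suc n) S → ⊥
    odd-step {n} {k} {c} n≡ k≥3 nc C =
      let l , r , len , l⊑S = cycle-ring C
          open Rings (≢-not {c}) unique nc l⊑S len
          open Odd n≡ k≥3
          ps , w , l≡ , ps-length = odd-rest k l (trans len (cong suc n≡))
      in impossible {IsRing = IsRing} no-odd-ring ps l≡ (≤-trans k≥3 (≤-reflexive (sym ps-length))) (r , ↭-refl)
      where
      impossible : ∀ {IsRing : List V → Set} → (∀ {x₀ x₁ x₂ x₃ x₄ x₅} qs e → IsRing (x₀ ∷ x₁ ∷ x₂ ∷ x₃ ∷ x₄ ∷ x₅ ∷ flat qs ++ [ e ]) → ⊥) →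
                   ∀ ps {w l} → l ≡ flat ps ++ [ w ] → 3 ≤ length ps → IsRing l → ⊥
      impossible h (_ ∷ _ ∷ _ ∷ qs) {w} refl _ i = h qs w i
      impossible h (_ ∷ _ ∷ []) _ (s≤s (s≤s ()))
      impossible h (_ ∷ []) _ (s≤s ())

    even-step : ∀ {n k c} → suc (suc n) ≡ 2 * k → 3 ≤ k → (∀ c → Cycle c (suc n) S → ⊥) → (∀ c → Cycle c n S → ⊥) → Cycle c (suc (suc n)) S → ⊥
    even-step {n} {k} {c} n≡ k≥3 nc nc′ C =
      let l , r , len , l⊑S = cycle-ring C
          open Rings (≢-not {c}) unique nc l⊑S len
          open Even refl nc′
          ps , l≡ , ps-length = unflat k l (trans len n≡)
      in impossible {IsRing = IsRing} no-even-ring ps l≡ (≤-trans k≥3 (≤-reflexive (sym ps-length))) (r , ↭-refl)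
      where
      impossible : ∀ {IsRing : List V → Set} → (∀ {x₁ y₁ x₂ y₂ x₃ y₃} qs → IsRing (x₁ ∷ y₁ ∷ x₂ ∷ y₂ ∷ x₃ ∷ y₃ ∷ flat qs) → ⊥) →
                   ∀ ps {l} → l ≡ flat ps → 3 ≤ length ps → IsRing l → ⊥
      impossible h (_ ∷ _ ∷ _ ∷ qs) refl _ i = h qs i
      impossible h (_ ∷ _ ∷ []) _ (s≤s (s≤s ()))
      impossible h (_ ∷ []) _ (s≤s ())

    base-step : ∀ c → Cycle c (suc (1 + 2 * q)) S → ⊥
    base-step c C =
      let l , r , len , l⊑S = cycle-ring C
          ps , l≡ , ps-length = unflat (suc q) l (trans len (trans (+-comm 2 (2 * q)) (two-q q)))
      in no-structure (≢-not {c}) (build l r len l⊑S ps l≡ ps-length)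
      where
      q≥1 : 1 ≤ q
      q≥1 = ≤-trans (s≤s z≤n) q≥3
      q≥2 : 2 ≤ q
      q≥2 = ≤-trans (s≤s (s≤s z≤n)) q≥3
      build : ∀ l → Ring c l → length l ≡ suc (1 + 2 * q) → l ⊑ S → ∀ ps → l ≡ flat ps → length ps ≡ suc q → Structure c (not c) q S
      build l r len h ((x , y) ∷ ps) refl len′ =
        FromRing.structure (≢-not {c}) unique q≥1 none h len x y ps (r , ↭-refl) (suc-injective len′) q≥2

    long-step : ∀ d → (∀ c → Cycle c (suc (d + (1 + 2 * q))) S → ⊥) → (∀ c → Cycle c (d + (1 + 2 * q)) S → ⊥) →
                ∀ c → Cycle c (suc (suc (d + (1 + 2 * q)))) S → ⊥
    long-step d h₁ h₀ c with parity d
    ... | inj₁ (e , d≡)     = odd-step {k = 1 + (q + e)} (trans (cong (λ t → suc (t + (1 + 2 * q))) d≡) (odd-length e q)) (k≥3₁ q e q≥3) h₁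
    ... | inj₂ (zero , ())
    ... | inj₂ (suc e , d≡) = even-step {k = 2 + (q + e)} (trans (cong (λ t → suc (t + (1 + 2 * q))) d≡) (even-length e q)) (m≤n⇒m≤1+n (k≥3₁ q e q≥3)) h₁ h₀

    long : ∀ d c → Cycle c (d + (1 + 2 * q)) S → ⊥
    long zero          = none
    long (suc zero)    = base-step
    long (suc (suc d)) = long-step d (long (suc d)) (long d)

    -- Downward induction: once all lengths above k are excluded, `longer-cycle` excludes k, since k
    -- ≤ 2q gives 3k + 4 ≤ 2(3q + 2). The last length reached is that of a triangle.
    short : ∀ j c {k} → 3 ≤ k → 1 + 2 * q ≤ k + j → Cycle c k S → ⊥
    short zero c {k} k≥3 le C = long (k ∸ (1 + 2 * q)) c (subst (λ n → Cycle c n S) (sym (m∸n+n≡m (≤-trans le (≤-reflexive (+-identityʳ k))))) C)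
    short (suc j) c {k} k≥3 le C with 1 + 2 * q ≤? k
    ... | yes h = short zero c k≥3 (≤-trans h (≤-reflexive (sym (+-identityʳ k)))) C
    ... | no  h = longer-cycle (≢-not {c}) unique k≥3 (small-cycle q k (length S) large (not-less q k (≰⇒> h)))
            (λ c′ {k′} k<k′ → short j c′ (≤-trans k≥3 (≤-trans (m≤n+m k 1) k<k′)) (≤-trans le (≤-trans (≤-reflexive (+-suc k j)) (+-monoˡ-≤ j k<k′)))) C

    contradiction : ⊥
    contradiction = let c , C = triangle unique (six q (length S) q≥3 large) in short (1 + 2 * q) c ≤-refl (m≤n+m (1 + 2 * q) 3) C

  -- Vertices with many blue neighbours

  joined : Bool → List V → V → Bool
  joined b []       w = true
  joined b (x ∷ xs) w = E b w x ∧ joined b xs w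

  joined-∈ : ∀ {b xs w x} → joined b xs w ≡ true → x ∈ xs → Adj b w x
  joined-∈ h (here refl) = proj₁ (∧-true h)
  joined-∈ {b} {y ∷ xs} {w} h (there i) = joined-∈ {b} {xs} (proj₂ (∧-true {E b w y} h)) i

  joined-false : ∀ {b xs w} → joined b xs w ≡ false → ∃ λ x → x ∈ xs × E b w x ≡ false
  joined-false {b} {x ∷ xs} {w} h with bool? (E b w x)
  ... | inj₂ f = x , here refl , f
  ... | inj₁ t with y , i , f ← joined-false {b} {xs} {w} (trans (sym (cong (_∧ joined b xs w) t)) h) = y , there i , f

  fat-perm = shuffle 3 4 (λ w y x R new D Z → ((y ◃ x ◃ R) ⧺ w ◃ new ⧺ D) ⧺ Z ⇄ ((R ⧺ new) ⧺ w ◃ y ◃ x ◃ ε) ⧺ D ⧺ Z)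
  fat-len = farkas-≡ 4 (λ r q v s → v := r :+ r :⇒ con 1 :+ r := q :⇒ s := v :+ con 3 :⇒ ⊢ s := con 1 :+ 2 :* q) 0 (1 ∷ 0 ∷ 2 ∷ 0 ∷ 1 ∷ 0 ∷ [])
  -- The cycle alternates between the q + 1 clique vertices and q vertices of `W`, except for one
  -- edge inside the clique that makes its length odd.
  fat-clique : ∀ {b q A P W} → Unique A → P ++ W ⊑ A → Clique b P → length P ≡ 1 + q → 1 ≤ q → q ≤ length W →
               (∀ {w x} → w ∈ W → x ∈ P → Adj b w x) → Cycle b (1 + 2 * q) A
  fat-clique {P = []} _ _ _ ()
  fat-clique {P = _ ∷ []} _ _ _ refl ()
  fat-clique {W = []} _ _ _ _ q≥1 q≤ _ = 1≰0 (≤-trans q≥1 q≤)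
  fat-clique {b} {q} {A} {y ∷ x ∷ R} {w ∷ W} unique (Z , σ) k len _ q≤ j =
    let R-length = suc-injective len
        v , v∈ , woven new vs p τ nl ni = zigzag x R W (λ r∈ w∈ → E-sym (j (there w∈) (there r∈)))
          (s≤s⁻¹ (≤-trans (≤-reflexive R-length) q≤))
        D , δ = ⊑-dropʳ new [] ni
        vs-length = trans (↭-length τ) (trans (length-++ R) (cong (length R +_) nl))
    in cycle (vs ++ w ∷ y ∷ [ x ])
         (p ▸ E-sym (j (here refl) (there v∈)) ◂ j (here refl) (here refl) ◂ edge (k (here refl) (there (here refl)) (Unique-≢ unique (Z , σ) (here refl))))
         (fat-len (length R) q (length vs) _ vs-length R-length (length-++ vs))
         (↭-⊑ (++⁺ʳ (w ∷ y ∷ [ x ]) τ) (D ++ Z , ↭-trans σ (↭-trans (++⁺ʳ Z (prep y (prep x (++⁺ˡ R (prep w δ))))) (fat-perm w y x R new D Z))))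

  rim-perm = shuffle 4 4 (λ h s x₀ x R new D Z → (h ◃ s ◃ (x₀ ◃ x ◃ R) ⧺ new ⧺ D) ⧺ Z ⇄ (s ◃ x ◃ (R ⧺ new) ⧺ h ◃ ε) ⧺ x₀ ◃ D ⧺ Z)
  rim-len = farkas-≡ 4 (λ r q v s → v := r :+ r :⇒ con 1 :+ r := q :⇒ s := con 2 :+ (v :+ con 1) :⇒ ⊢ s := con 1 :+ 2 :* q) 0 (1 ∷ 0 ∷ 2 ∷ 0 ∷ 1 ∷ 0 ∷ [])

  -- A wheel with hub x₀ whose rim passes through the edge hs and alternates between a clique and vertices joined to it.
  clique-wheel : ∀ {b q A h s P W} → h ∷ s ∷ P ++ W ⊑ A → Unique A → Clique b P → length P ≡ 1 + q → 1 ≤ q → q ≤ 1 + length W →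
                 Adj b h s → (∀ {x} → x ∈ P → Adj b h x) → (∀ {x} → x ∈ P → Adj b s x) → (∀ {w x} → w ∈ W → x ∈ P → Adj b w x) →
                 ∃ λ x₀ → Σ (Cycle b (1 + 2 * q) A) λ C → ∀ {x} → x ∈ Cycle.verts C → Adj b x₀ x
  clique-wheel {P = []} _ _ _ ()
  clique-wheel {P = _ ∷ []} _ _ _ refl ()
  clique-wheel {b} {q} {A} {h} {s} {x₀ ∷ x ∷ R} {W} (Z , σ) unique k len _ q≤ hs hP sP j =
    let v , v∈ , woven new vs p τ nl ni = zigzag x R W (λ r∈ w∈ → E-sym (j w∈ (there r∈))) (s≤s⁻¹ (≤-trans (≤-reflexive R-length) q≤))
        D , δ = ⊑-dropʳ new [] ni
        vs-length = trans (↭-length τ) (trans (length-++ R) (cong (length R +_) nl))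
        len′ = cong (suc ∘ suc) (length-++ vs)
    in x₀ , cycle (s ∷ x ∷ vs ++ [ h ]) (hs ◂ sP (there (here refl)) ◂ p ▸ edge (E-sym (hP (there v∈))))
         (rim-len (length R) q (length vs) _ vs-length R-length len′)
         (↭-⊑ (prep s (prep x (++⁺ʳ [ h ] τ))) (x₀ ∷ D ++ Z , ↭-trans σ (↭-trans (++⁺ʳ Z (prep h (prep s (++⁺ˡ (x₀ ∷ x ∷ R) δ)))) (rim-perm h s x₀ x R new D Z))))
       , rim new (⊑-∈ (⊑-dropʳ new [] ni)) τ
    where
    R-length : suc (length R) ≡ q
    R-length = suc-injective len
    P-unique : Unique (x₀ ∷ x ∷ R)
    P-unique = Unique-⊑ unique (⊑-dropʳ _ W (⊑-dropˡ (h ∷ s ∷ []) _ (Z , σ)))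
    rim : ∀ {vs} new → (∀ {y} → y ∈ new → y ∈ W) → vs ↭ R ++ new → ∀ {y} → y ∈ s ∷ x ∷ vs ++ [ h ] → Adj b x₀ y
    rim new inW τ (here refl)         = E-sym (sP (here refl))
    rim new inW τ (there (here refl)) = k (here refl) (there (here refl)) (Unique-≢ P-unique ⊑-refl (here refl))
    rim {vs} new inW τ (there (there i)) with ∈-++⁻ vs i
    ... | inj₂ (here refl) = E-sym (hP (here refl))
    ... | inj₁ i′ with ∈-++⁻ R (∈-resp-↭ τ i′)
    ...   | inj₁ r = k (here refl) (there (there r)) (Unique-≢ P-unique ⊑-refl (there r))
    ...   | inj₂ n = E-sym (j (inW n) (here refl))

  module Neighbourhood {red blue : Bool} (red≢blue : red ≢ blue) {A : List V} (unique : Unique A) {q : ℕ} (q≥3 : 3 ≤ q)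
                       (A-length : length A ≡ 1 + 6 * q) (no-red : Cycle red (1 + 2 * q) A → ⊥)
                       (no-wheel : ∀ {h} (C : Cycle blue (1 + 2 * q) A) → (∀ {x} → x ∈ Cycle.verts C → Adj blue h x) → ⊥) where

    q≥1 : 1 ≤ q
    q≥1 = ≤-trans (s≤s z≤n) q≥3

    q≥2 : 2 ≤ q
    q≥2 = ≤-trans (s≤s (s≤s z≤n)) q≥3

    -- The field `third` serves to exchange roles: if `h` is itself a blue neighbour of another
    -- vertex with such cliques, then it puts `h` into a red clique of that size.
    record Cliques (h : V) : Set where
      field
        Q₁ Q₂     : List V
        Q₁-length : length Q₁ ≡ 2 + q
        Q₂-length : length Q₂ ≡ 2 + q
        Q₁-clique : Clique red Q₁
        Q₂-clique : Clique red Q₂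
        inside    : Q₁ ++ Q₂ ⊑ A
        blue-to   : ∀ {x} → x ∈ Q₁ ++ Q₂ → Adj blue h x
        third     : ∀ {x} → x ∈ A → Adj blue h x → ∃ λ Z → length Z ≡ 2 + q × Clique red Z × Z ⊑ A × x ∈ Z

    outside-count = farkas 7
      (λ a s n p o n′ q → a := con 1 :+ 6 :* q :⇒ a := s :+ n :⇒ n := con 1 :+ n′ :⇒ s := p :+ o :⇒ p := con 2 :+ 2 :* q :⇒ ⊢ 4 :* q :≤ con 2 :+ (o :+ n′))
      0 (0 ∷ 1 ∷ 1 ∷ 0 ∷ 1 ∷ 0 ∷ 1 ∷ 0 ∷ 1 ∷ 0 ∷ [])
    inside-count = farkas 4 (λ s p o q → 3 :* q :+ con 2 :≤ s :⇒ s := p :+ o :⇒ p := con 2 :+ 2 :* q :⇒ ⊢ q :≤ o) 0 (1 ∷ 1 ∷ 0 ∷ 1 ∷ 0 ∷ [])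
    structure-count = farkas-≡ 4 (λ x y q p → x := q :⇒ y := con 1 :+ q :⇒ p := con 1 :+ x :+ y :⇒ ⊢ p := con 2 :+ 2 :* q) 0 (1 ∷ 0 ∷ 1 ∷ 0 ∷ 1 ∷ 0 ∷ [])
    other-side = farkas 4 (λ o x y q → 4 :* q :≤ con 2 :+ o :⇒ o :≤ x :+ y :⇒ con 1 :+ x :≤ q :⇒ con 3 :≤ q :⇒ ⊢ q :≤ y) 7 (3 ∷ 3 ∷ 3 ∷ 1 ∷ [])
    small-side = farkas 4 (λ o x y q → q :≤ o :⇒ o :≤ x :+ y :⇒ con 1 :+ y :≤ q :⇒ ⊢ con 1 :≤ x) 0 (1 ∷ 1 ∷ 1 ∷ [])

    module Hub {h : V} {S N N′ : List V} (A-split : A ↭ S ++ N) (N-split : N ↭ h ∷ N′) (S-blue : ∀ {x} → x ∈ S → Adj blue h x)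
               (N-not-blue : ∀ {x} → x ∈ N → E blue h x ≡ false) (S-large : 3 * q + 2 ≤ length S) where

      S⊑A : S ⊑ A
      S⊑A = N , A-split

      S-unique : Unique S
      S-unique = Unique-⊑ unique S⊑A

      -- Red cycles are excluded in all of `A`, and a blue one in `S` would be the rim of a wheel
      -- with hub `h`.
      none : ∀ c → Cycle c (1 + 2 * q) S → ⊥
      none c C with c Bool.≟ red
      ... | yes refl = no-red (Cycle-⊑ S⊑A C)
      ... | no  c≢   = no-blue c (bool-third (c≢ ∘ sym) red≢blue) C
        where
        no-blue : ∀ c → c ≡ blue → Cycle c (1 + 2 * q) S → ⊥
        no-blue c refl C = no-wheel {h} (Cycle-⊑ S⊑A C) λ i → S-blue (⊑-∈ (Cycle.inside C) i)

      in-S : ∀ {x} → x ∈ A → Adj blue h x → x ∈ S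
      in-S x∈ e = [ id , (λ i → true≢false e (N-not-blue i)) ]′ (∈-++⁻ S (∈-resp-↭ A-split x∈))

      module Sides {a b} (a≢b : a ≢ b) (st : Structure a b q S) {O : List V} (S-split : S ↭ ((Structure.z st ∷ Structure.X st) ++ Structure.Y st) ++ O) where
        open Structure st

        XY : List V
        XY = (z ∷ X) ++ Y

        XY-length : length XY ≡ 2 + 2 * q
        XY-length = structure-count (length X) (length Y) q _ X-length Y-length (cong suc (length-++ X))

        O-large : q ≤ length O
        O-large = inside-count (length S) (length XY) (length O) q S-large (trans (↭-length S-split) (length-++ XY)) XY-length

        -- A vertex with an `a`-edge to either clique would close an `a`-cycle of length 2q + 1 by
        -- `Around.around`.
        sided : ∀ {B w} → w ∷ XY ⊑ B → Unique B → (Cycle a (1 + 2 * q) B → ⊥) → joined b (z ∷ X) w ≡ true ⊎ joined b Y w ≡ true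
        sided {B} {w} h u no-cycle = cases (bool? (joined b (z ∷ X) w)) (bool? (joined b Y w))
          where
          cases : joined b (z ∷ X) w ≡ true ⊎ joined b (z ∷ X) w ≡ false → joined b Y w ≡ true ⊎ joined b Y w ≡ false →
                  joined b (z ∷ X) w ≡ true ⊎ joined b Y w ≡ true
          cases (inj₁ t) _        = inj₁ t
          cases _        (inj₁ t) = inj₂ t
          cases (inj₂ f) (inj₂ g) =
            let x , x∈ , wx = joined-false {b} {z ∷ X} f
                y , y∈ , wy = joined-false {b} {Y} g
            in ⊥-elim (no-cycle (Around.around st q≥2 h x∈ y∈
                 (Adj-other a≢b (Unique-≢ u h (∈-++⁺ˡ x∈)) wx) (Adj-other a≢b (Unique-≢ u h (∈-++⁺ʳ (z ∷ X) y∈)) wy)))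

        sided-count : ∀ L → (∀ {w} → w ∈ L → joined b (z ∷ X) w ≡ true ⊎ joined b Y w ≡ true) →
                      length L ≤ cnt (joined b (z ∷ X)) L + cnt (joined b Y) L
        sided-count L f = cnt-cover (joined b (z ∷ X)) (joined b Y) L one
          where
          one : ∀ {w} → w ∈ L → 1 ≤ ⟦ joined b (z ∷ X) w ⟧ + ⟦ joined b Y w ⟧
          one {w} w∈ with f w∈
          ... | inj₁ t = ≤-trans (⟦⟧-true t) (m≤m+n _ _)
          ... | inj₂ t = ≤-trans (⟦⟧-true t) (m≤n+m _ _)

      blue-perm₀ = shuffle 1 3 (λ h XY O N → (XY ⧺ O) ⧺ h ◃ N ⇄ XY ⧺ h ◃ O ⧺ N)
      blue-perm₁ = shuffle 2 2 (λ h w XY Z → XY ⧺ h ◃ w ◃ Z ⇄ (w ◃ XY) ⧺ h ◃ Z)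
      blue-perm₂ = shuffle 2 4 (λ h s P P′ W D → (P ⧺ P′) ⧺ h ◃ s ◃ W ⧺ D ⇄ (h ◃ s ◃ P ⧺ W) ⧺ P′ ⧺ D)
      blue-perm₃ = shuffle 0 3 (λ P P′ R → (P ⧺ P′) ⧺ R ⇄ (P′ ⧺ P) ⧺ R)

      -- Blue cliques: some vertex of S outside the structure lies on the same side as q vertices.
      module BlueStructure (st : Structure red blue q S) {O : List V} (S-split : S ↭ ((Structure.z st ∷ Structure.X st) ++ Structure.Y st) ++ O) where
        open Structure st
        open Sides red≢blue st S-split

        rest : List V
        rest = O ++ N′

        A-split′ : A ↭ XY ++ h ∷ rest
        A-split′ = ↭-trans A-split (↭-trans (++⁺ S-split N-split) (blue-perm₀ h XY O N′))

        both : ∀ {w} → w ∈ rest → joined blue (z ∷ X) w ≡ true ⊎ joined blue Y w ≡ true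
        both {w} w∈ = let Z , π = ∈-take w∈ in
          sided (h ∷ Z , ↭-trans A-split′ (↭-trans (++⁺ˡ XY (prep h π)) (blue-perm₁ h w XY Z))) unique no-red

        total : 4 * q ≤ 2 + length rest
        total = ≤-trans (outside-count (length A) (length S) (length N) (length XY) (length O) (length N′) q A-length
                          (trans (↭-length A-split) (length-++ S)) (↭-length N-split) (trans (↭-length S-split) (length-++ XY)) XY-length)
                        (≤-reflexive (cong (2 +_) (sym (length-++ O))))

        -- The rim uses the blue edge from `h` to `s`, so `s` must come from `O`; the other vertices
        -- joined to the clique may lie anywhere in `rest`.
        wheel : ∀ P {P′ s} → Clique blue P → length P ≡ 1 + q → (∀ {x} → x ∈ P → Adj blue h x) → A ↭ (P ++ P′) ++ h ∷ rest →
                s ∈ O → joined blue P s ≡ true → q ≤ cnt (joined blue P) rest → ⊥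
        wheel P {P′} {s} k len hP π s∈ js q≤ =
          let Z , σ = ∈-take (∈-++⁺ˡ {ys = N′} s∈)
              W , D , τ , f , _ , W-length = select (joined blue P) Z
              c = trans (cnt-↭ (joined blue P) σ) (cong (λ t → ⟦ t ⟧ + cnt (joined blue P) Z) js)
              x₀ , C , hub = clique-wheel {P = P} {W = W}
                (P′ ++ D , ↭-trans π (↭-trans (++⁺ˡ (P ++ P′) (prep h (↭-trans σ (prep s τ)))) (blue-perm₂ h s P P′ W D)))
                unique k len q≥1 (≤-trans q≤ (≤-reflexive (trans c (cong suc (sym W-length)))))
                (S-blue (⊑-∈ (⊑-dropˡ XY _ ([] , ↭-trans S-split (↭-reflexive (sym (++-identityʳ≡ _))))) s∈))
                hP (λ i → joined-∈ js i) (λ w∈ i → joined-∈ (f w∈) i)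
          in no-wheel C hub

        wheel-X : ∀ {s} → s ∈ O → joined blue (z ∷ X) s ≡ true → q ≤ cnt (joined blue (z ∷ X)) rest → ⊥
        wheel-X = wheel (z ∷ X) X-clique (cong suc X-length) (λ i → S-blue (⊑-∈ inside (∈-++⁺ˡ i))) A-split′

        wheel-Y : ∀ {s} → s ∈ O → joined blue Y s ≡ true → q ≤ cnt (joined blue Y) rest → ⊥
        wheel-Y = wheel Y Y-clique Y-length (λ i → S-blue (⊑-∈ inside (∈-++⁺ʳ (z ∷ X) i))) (↭-trans A-split′ (blue-perm₃ (z ∷ X) Y _))

        all-O : ∀ p → (∀ {w} → w ∈ O → p w ≡ true) → q ≤ cnt p rest
        all-O p f = ≤-trans O-large (≤-trans (≤-reflexive (sym (cnt-all p O f)))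
                      (≤-trans (m≤m+n _ (cnt p N′)) (≤-reflexive (sym (cnt-++ p O N′)))))

        other-sided : ∀ {w} → w ∈ O → joined blue (z ∷ X) w ≡ false → joined blue Y w ≡ true
        other-sided w∈ f = [ (λ t → true≢false t f) , id ]′ (both (∈-++⁺ˡ w∈))

        other-sided′ : ∀ {w} → w ∈ O → joined blue Y w ≡ false → joined blue (z ∷ X) w ≡ true
        other-sided′ w∈ f = [ id , (λ t → true≢false t f) ]′ (both (∈-++⁺ˡ w∈))

        some-O : ∀ {o : List V} → q ≤ length o → ∃ λ s → s ∈ o
        some-O {[]}    le = 1≰0 (≤-trans q≥1 le)
        some-O {s ∷ _} _  = s , here refl

        many-X : q ≤ cnt (joined blue (z ∷ X)) rest →
                 (∃ λ s → s ∈ O × joined blue (z ∷ X) s ≡ true) ⊎ (∀ {s} → s ∈ O → joined blue (z ∷ X) s ≡ false) → ⊥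
        many-X m (inj₁ (s , s∈ , t)) = wheel-X s∈ t m
        many-X m (inj₂ f)            = let s , s∈ = some-O O-large in
          wheel-Y s∈ (other-sided s∈ (f s∈)) (all-O (joined blue Y) λ i → other-sided i (f i))

        few-X : ¬ q ≤ cnt (joined blue (z ∷ X)) rest →
                (∃ λ s → s ∈ O × joined blue Y s ≡ true) ⊎ (∀ {s} → s ∈ O → joined blue Y s ≡ false) → ⊥
        few-X m (inj₁ (s , s∈ , t)) = wheel-Y s∈ t (other-side (length rest) (cnt (joined blue (z ∷ X)) rest) (cnt (joined blue Y) rest) q total
                                        (sided-count rest both) (≰⇒> m) q≥3)
        few-X m (inj₂ f)            = m (all-O (joined blue (z ∷ X)) λ i → other-sided′ i (f i))

        -- A wheel needs a clique with q joined vertices in `rest`, at least one of them in `O`. As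
        -- `rest` has at least 4q - 2 vertices, some clique has q of them. If none of these is in
        -- `O`, then all of `O`, at least q vertices, is joined to the other clique.
        impossible : ⊥
        impossible = few-X (λ m → many-X m (find? (joined blue (z ∷ X)) O)) (find? (joined blue Y) O)

      red-perm₁ = shuffle 2 3 (λ w w′ P Q O → (P ⧺ Q) ⧺ w ◃ w′ ◃ O ⇄ ((w ◃ P) ⧺ w′ ◃ Q) ⧺ O)
      red-perm₂ = shuffle 0 4 (λ P P′ W D → (P ⧺ P′) ⧺ W ⧺ D ⇄ (P ⧺ W) ⧺ P′ ⧺ D)
      red-perm₃ = shuffle 1 3 (λ w P Q Z → (P ⧺ Q) ⧺ w ◃ Z ⇄ (w ◃ P) ⧺ Q ⧺ Z)
      red-perm₄ = shuffle 1 3 (λ w P Q Z → (P ⧺ Q) ⧺ w ◃ Z ⇄ (w ◃ Q) ⧺ P ⧺ Z)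
      red-perm₅ = shuffle 1 2 (λ w XY Z → XY ⧺ w ◃ Z ⇄ (w ◃ XY) ⧺ Z)

      module RedStructure (st : Structure blue red q S) {O : List V} (S-split : S ↭ ((Structure.z st ∷ Structure.X st) ++ Structure.Y st) ++ O) where
        open Structure st
        open Sides (red≢blue ∘ sym) st S-split

        both : ∀ {w} → w ∈ O → joined red (z ∷ X) w ≡ true ⊎ joined red Y w ≡ true
        both {w} w∈ = let Z , π = ∈-take w∈ in
          sided (Z , ↭-trans S-split (↭-trans (++⁺ˡ XY π) (red-perm₅ w XY Z))) S-unique (none blue)

        few : ∀ P {P′} → Clique red P → length P ≡ 1 + q → S ↭ (P ++ P′) ++ O → suc (cnt (joined red P) O) ≤ q
        few P {P′} k len π = ≰⇒> λ m → let W , D , τ , f , _ , W-length = select (joined red P) O in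
          id (none red (fat-clique S-unique (P′ ++ D , ↭-trans π (↭-trans (++⁺ˡ (P ++ P′) τ) (red-perm₂ P P′ W D))) k len q≥1
            (≤-trans m (≤-reflexive (sym W-length))) (λ w∈ i → joined-∈ (f w∈) i)))

        few-X : suc (cnt (joined red (z ∷ X)) O) ≤ q
        few-X = few (z ∷ X) X-clique (cong suc X-length) S-split

        few-Y : suc (cnt (joined red Y) O) ≤ q
        few-Y = few Y Y-clique Y-length (↭-trans S-split (blue-perm₃ (z ∷ X) Y O))

        extend-clique : ∀ {P w} → Clique red P → joined red P w ≡ true → Clique red (w ∷ P)
        extend-clique k j = clique-∷ (λ i _ → joined-∈ j i) k

        second-count = farkas 6
          (λ o o′ x y q c → q :≤ o :⇒ o := con 1 :+ o′ :⇒ o′ :≤ x :+ con 0 :⇒ c := con 1 :+ x :⇒ (con 1 :+ c) :≤ q :⇒ ⊢⊥)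
          0 (1 ∷ 1 ∷ 0 ∷ 1 ∷ 0 ∷ 1 ∷ 1 ∷ [])

        -- `O` has at least q vertices, each joined to one of the cliques, but fewer than q are
        -- joined to the same one. So both cliques can be enlarged by distinct vertices of `O`.
        cliques : Cliques h
        cliques = start (pick (joined red (z ∷ X)) O (small-side (length O) (cnt (joined red (z ∷ X)) O) (cnt (joined red Y) O) q O-large (sided-count O both) few-Y))
          where
          build : ∀ {w w′ o″} → joined red (z ∷ X) w ≡ true → joined red Y w′ ≡ true → O ↭ w ∷ w′ ∷ o″ → Cliques h
          build {w} {w′} {o″} jw jw′ π = record
            { Q₁ = w ∷ z ∷ X ; Q₂ = w′ ∷ Y ; Q₁-length = cong (suc ∘ suc) X-length ; Q₂-length = cong suc Y-length
            ; Q₁-clique = extend-clique X-clique jw ; Q₂-clique = extend-clique Y-clique jw′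
            ; inside = ⊑-trans Q⊑S S⊑A ; blue-to = λ i → S-blue (⊑-∈ Q⊑S i) ; third = λ x∈ e → third (∈-++⁻ XY (∈-resp-↭ S-split (in-S x∈ e))) }
            where
            Q⊑S : (w ∷ z ∷ X) ++ w′ ∷ Y ⊑ S
            Q⊑S = o″ , ↭-trans S-split (↭-trans (++⁺ˡ XY π) (red-perm₁ w w′ (z ∷ X) Y o″))
            Third : V → Set
            Third x = ∃ λ Z → length Z ≡ 2 + q × Clique red Z × Z ⊑ A × x ∈ Z
            in-XY : ∀ {x} → x ∈ z ∷ X ⊎ x ∈ Y → Third x
            in-XY (inj₁ j) = w ∷ z ∷ X , cong (suc ∘ suc) X-length , extend-clique X-clique jw , ⊑-trans (⊑-dropʳ (w ∷ z ∷ X) (w′ ∷ Y) Q⊑S) S⊑A , there j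
            in-XY (inj₂ j) = w′ ∷ Y , cong suc Y-length , extend-clique Y-clique jw′ , ⊑-trans (⊑-dropˡ (w ∷ z ∷ X) (w′ ∷ Y) Q⊑S) S⊑A , there j
            in-O : ∀ {x Z} → O ↭ x ∷ Z → joined red (z ∷ X) x ≡ true ⊎ joined red Y x ≡ true → Third x
            in-O {x} {Z} σ (inj₁ t) = x ∷ z ∷ X , cong (suc ∘ suc) X-length , extend-clique X-clique t ,
              ⊑-trans (Y ++ Z , ↭-trans S-split (↭-trans (++⁺ˡ XY σ) (red-perm₃ x (z ∷ X) Y Z))) S⊑A , here refl
            in-O {x} {Z} σ (inj₂ t) = x ∷ Y , cong suc Y-length , extend-clique Y-clique t ,
              ⊑-trans ((z ∷ X) ++ Z , ↭-trans S-split (↭-trans (++⁺ˡ XY σ) (red-perm₄ x (z ∷ X) Y Z))) S⊑A , here refl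
            third : ∀ {x} → x ∈ XY ⊎ x ∈ O → Third x
            third (inj₁ i) = in-XY (∈-++⁻ (z ∷ X) i)
            third (inj₂ i) = in-O (proj₂ (∈-take i)) (both i)

          second : ∀ {w o′} → joined red (z ∷ X) w ≡ true → O ↭ w ∷ o′ →
                   (∃ λ w′ → w′ ∈ o′ × joined red Y w′ ≡ true) ⊎ (∀ {v} → v ∈ o′ → joined red Y v ≡ false) → Cliques h
          second jw π (inj₁ (w′ , w′∈ , jw′)) = build jw jw′ (↭-trans π (prep _ (proj₂ (∈-take w′∈))))
          second {w} {o′} jw π (inj₂ f) = ⊥-elim (second-count (length O) (length o′) (cnt (joined red (z ∷ X)) o′) 0 q (cnt (joined red (z ∷ X)) O) O-large (↭-length π)
            (≤-trans (≤-reflexive (sym (cnt-all (joined red (z ∷ X)) o′ all-X))) (m≤m+n _ 0))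
            (trans (cnt-↭ (joined red (z ∷ X)) π) (cong (λ t → ⟦ t ⟧ + cnt (joined red (z ∷ X)) o′) jw)) few-X)
            where
            all-X : ∀ {v} → v ∈ o′ → joined red (z ∷ X) v ≡ true
            all-X v∈ = [ id , (λ t → true≢false t (f v∈)) ]′ (both (∈-resp-↭ (↭-sym π) (there v∈)))

          start : (∃₂ λ w o′ → joined red (z ∷ X) w ≡ true × O ↭ w ∷ o′) → Cliques h
          start (w , o′ , jw , π) = second jw π (find? (joined red Y) o′)

      -- `NoMono` delivers only a contradiction, hence the double negation.
      red-cliques : (Cliques h → ⊥) → ⊥
      red-cliques no-cliques = NoMono.contradiction S-unique q≥3 S-large none structure-free
        where
        blue-case : ∀ b → b ≡ blue → Structure red b q S → ⊥
        blue-case b refl st = BlueStructure.impossible st (proj₂ (Structure.inside st))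
        red-case : ∀ a b → a ≡ blue → b ≡ red → Structure a b q S → ⊥
        red-case a b refl refl st = no-cliques (RedStructure.cliques st (proj₂ (Structure.inside st)))
        structure-free : ∀ {a b} → a ≢ b → Structure a b q S → ⊥
        structure-free {a} {b} a≢b st with a Bool.≟ red
        ... | yes refl = blue-case b (bool-third a≢b red≢blue) st
        ... | no a≢red = red-case a b (bool-third (a≢red ∘ sym) red≢blue) (bool-third a≢b a≢red) st

    red-cliques : ∀ {h} → h ∈ A → 3 * q + 2 ≤ cnt (E blue h) A → (Cliques h → ⊥) → ⊥
    red-cliques {h} h∈ many = from (select (E blue h) A)
      where
      from : (∃₂ λ S N → A ↭ S ++ N × (∀ {y} → y ∈ S → E blue h y ≡ true) × (∀ {z} → z ∈ N → E blue h z ≡ false) × length S ≡ cnt (E blue h) A) →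
             (Cliques h → ⊥) → ⊥
      from (S , N , π , f , g , len) = Hub.red-cliques π (proj₂ (∈-take h∈N)) f g (≤-trans many (≤-reflexive (sym len)))
        where
        h∈N : h ∈ N
        h∈N = [ (λ i → ⊥-elim (Adj-≢ (f i) refl)) , id ]′ (∈-++⁻ S (∈-resp-↭ π h∈))

  -- Disjoint red cliques

  stretch-perm = shuffle 3 4 (λ d₀ d₁ x R new D Z → ((d₀ ◃ d₁ ◃ x ◃ R) ⧺ new ⧺ D) ⧺ Z ⇄ ((R ⧺ new) ⧺ d₀ ◃ d₁ ◃ x ◃ ε) ⧺ D ⧺ Z)
  stretch-len = farkas-≡ 4 (λ r q v s → v := r :+ r :⇒ con 1 :+ r := q :⇒ s := v :+ con 3 :⇒ ⊢ s := con 1 :+ 2 :* q) 0 (1 ∷ 0 ∷ 2 ∷ 0 ∷ 1 ∷ 0 ∷ [])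

  -- A clique with q + 2 vertices, extended by q − 1 common neighbours of consecutive vertices.
  stretch : ∀ {b q A d₀ d₁ P W} → Unique A → (d₀ ∷ d₁ ∷ P) ++ W ⊑ A → Clique b (d₀ ∷ d₁ ∷ P) → length P ≡ q → 1 ≤ q →
            (∀ {x y} → x ∈ P → y ∈ P → x ≢ y → q ≤ 1 + cnt (common b x y) W) → Cycle b (1 + 2 * q) A
  stretch {P = []} _ _ _ refl ()
  stretch {b} {q} {A} {d₀} {d₁} {x ∷ R} {W} unique (Z , σ) k len _ h =
    let v , v∈ , s = steps x R D-unique (λ i → i)
        woven new vs p τ nl ni = weave [] s (W , ↭-refl) ≤-refl
        D , δ = ⊑-dropʳ new [] ni
        vs-length = trans (↭-length τ) (trans (length-++ R) (cong (length R +_) nl))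
    in cycle (vs ++ d₀ ∷ d₁ ∷ [ x ])
         (p ▸ E-sym (k (here refl) (there (there v∈)) (Unique-≢ unique d⊑A (there v∈))) ◂
          k (here refl) (there (here refl)) (Unique-≢ unique d⊑A (here refl)) ◂
          edge (k (there (here refl)) (there (there (here refl))) (Unique-≢ unique (⊑-dropˡ [ d₀ ] _ d⊑A) (here refl))))
         (stretch-len (length R) q (length vs) _ vs-length len (length-++ vs))
         (↭-⊑ (++⁺ʳ (d₀ ∷ d₁ ∷ [ x ]) τ) (D ++ Z , ↭-trans σ (↭-trans (++⁺ʳ Z (++⁺ˡ (d₀ ∷ d₁ ∷ x ∷ R) δ)) (stretch-perm d₀ d₁ x R new D Z))))
    where
    d⊑A : d₀ ∷ d₁ ∷ x ∷ R ⊑ A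
    d⊑A = ⊑-dropʳ (d₀ ∷ d₁ ∷ x ∷ R) W (Z , σ)
    D-unique : Unique (x ∷ R)
    D-unique = Unique-⊑ unique (⊑-dropˡ (d₀ ∷ d₁ ∷ []) _ d⊑A)
    steps : ∀ y T → Unique (y ∷ T) → (∀ {u} → u ∈ y ∷ T → u ∈ x ∷ R) → ∃ λ v → v ∈ y ∷ T × Steps b (length R) W y T v (length T)
    steps y []      _ inP = y , here refl , done
    steps y (t ∷ T) (f AllPairs.∷ u) inP =
      let v , v∈ , s = steps t T u (inP ∘ there)
      in v , there v∈ , insert (s≤s⁻¹ (≤-trans (≤-reflexive len) (h (inP (here refl)) (inP (there (here refl))) (All.lookup f (here refl))))) s

  -- If `c` is not in `P`, an arbitrary vertex is removed, so that the remaining length is the same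
  -- in both cases.
  remove : ∀ c {n} P → Unique P → length P ≡ suc n → ∃₂ λ d P′ → P ↭ d ∷ P′ × length P′ ≡ n × (∀ {x} → x ∈ P′ → x ≢ c)
  remove c (p ∷ P) u len with bool? (mem (p ∷ P) c)
  ... | inj₁ t = let P′ , π = ∈-take (mem-∈ {p ∷ P} t) in
    c , P′ , π , suc-injective (trans (sym (↭-length π)) len) , λ x∈ e → Unique-≢ u (↭-⊑ (↭-sym π) ⊑-refl) x∈ (sym e)
  ... | inj₂ f = p , P , ↭-refl , suc-injective len , λ { x∈ refl → true≢false (∈-mem (there x∈)) f }

  remove₂ : ∀ c c′ {n} P → Unique P → length P ≡ suc (suc n) →
            ∃₂ λ d d′ → ∃ λ P′ → P ↭ d ∷ d′ ∷ P′ × length P′ ≡ n × (∀ {x} → x ∈ P′ → x ≢ c × x ≢ c′)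
  remove₂ c c′ P u len =
    let d , P₁ , π , len₁ , f = remove c P u len
        d′ , P₂ , ρ , len₂ , g = remove c′ P₁ (Unique-⊑ u (⊑-dropˡ [ d ] P₁ (↭-⊑ (↭-sym π) ⊑-refl))) len₁
    in d , d′ , P₂ , ↭-trans π (prep d ρ) , len₂ , λ i → f (∈-resp-↭ (↭-sym ρ) (there i)) , g i

  ⊑-disjoint-++ : ∀ xs {ys A} → Unique A → xs ⊑ A → ys ⊑ A → (∀ {x} → x ∈ xs → ¬ x ∈ ys) → xs ++ ys ⊑ A
  ⊑-disjoint-++ []       u h k d = k
  ⊑-disjoint-++ (x ∷ xs) {ys} u h k d =
    ∈-∷-⊑ (⊑-disjoint-++ xs u (⊑-dropˡ [ x ] xs h) k (d ∘ there)) (⊑-∈ h (here refl)) absent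
    where
    absent : ¬ x ∈ xs ++ ys
    absent i with ∈-++⁻ xs i
    ... | inj₁ j = Unique-≢ u h j refl
    ... | inj₂ j = d (here refl) j

  wheel-perm = shuffle 3 4 (λ w y z R new D Z → (w ◃ (y ◃ R) ⧺ z ◃ new ⧺ D) ⧺ Z ⇄ (y ◃ (R ⧺ new) ⧺ z ◃ w ◃ ε) ⧺ D ⧺ Z)

  module Three {red blue : Bool} (red≢blue : red ≢ blue) {A : List V} (unique : Unique A) {q : ℕ} (q≥3 : 3 ≤ q)
               (A-length : length A ≡ 1 + 6 * q) (no-red : Cycle red (1 + 2 * q) A → ⊥)
               (no-wheel : ∀ {h} (C : Cycle blue (1 + 2 * q) A) → (∀ {x} → x ∈ Cycle.verts C → Adj blue h x) → ⊥) where

    q≥1 : 1 ≤ q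
    q≥1 = ≤-trans (s≤s z≤n) q≥3

    disjoint-red-edges : ∀ {P Q x x′ y y′} → Clique red P → Clique red Q → length P ≡ 2 + q → length Q ≡ 2 + q → P ++ Q ⊑ A →
                         x ∈ P → x′ ∈ P → y ∈ Q → y′ ∈ Q → x ≢ x′ → y ≢ y′ → Adj red x y → Adj red x′ y′ → ⊥
    disjoint-red-edges kP kQ lP lQ h x∈ x′∈ y∈ y′∈ x≢ y≢ e e′ =
      let j , q≡ = 3+ q≥3 in
      -- All q + 2 vertices of `P` and q - 1 of `Q`, that is j = q - 3, add up to 2q + 1.
      no-red (subst (λ n → Cycle red n A) (count j q q≡)
        (two-edges-cycle q j unique kP kQ h x∈ x′∈ y∈ y′∈ x≢ y≢ e e′ (≤-reflexive (sym lP))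
          (≤-trans (s≤s (s≤s (≤-trans (m≤n+m j 3) (≤-reflexive (sym q≡))))) (≤-reflexive (sym lQ)))))
      where
      count = farkas-≡ 2 (λ j q → q := con 3 :+ j :⇒ ⊢ con 4 :+ (q :+ j) := con 1 :+ 2 :* q) 0 (0 ∷ 1 ∷ [])

    centre : ∀ {P Q} → Clique red P → Clique red Q → length P ≡ 2 + q → length Q ≡ 2 + q → P ++ Q ⊑ A →
             ∃ λ c → ∀ {x y} → x ∈ P → y ∈ Q → x ≢ c → y ≢ c → Adj red x y → ⊥
    centre {[]} _ _ ()
    centre {p ∷ P} {Q} kP kQ lP lQ h =
      from-star (star (here refl) (λ x∈ x′∈ y∈ y′∈ → disjoint-red-edges kP kQ lP lQ h x∈ x′∈ y∈ y′∈))
      where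
      from-star : Star red (p ∷ P) Q → ∃ λ c → ∀ {x y} → x ∈ p ∷ P → y ∈ Q → x ≢ c → y ≢ c → Adj red x y → ⊥
      from-star (c , inj₁ (_ , f)) = c , λ x∈ y∈ x≢c _ e → x≢c (f x∈ y∈ e)
      from-star (c , inj₂ (_ , f)) = c , λ x∈ y∈ _ y≢c e → y≢c (f x∈ y∈ e)

    wheel-len = farkas-≡ 4 (λ r q v s → v := r :+ r :⇒ con 1 :+ r := q :⇒ s := con 1 :+ (v :+ con 2) :⇒ ⊢ s := con 1 :+ 2 :* q) 0 (1 ∷ 0 ∷ 2 ∷ 0 ∷ 1 ∷ 0 ∷ [])
    -- The hub is `x`; the rim alternates between all of `Y` and all of `Z`, and `w` between `z` and
    -- `y` makes its length odd.
    tripartite-wheel : ∀ {Y Z w x y z} → w ∷ Y ++ Z ⊑ A → length Y ≡ q → length Z ≡ q →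
                       (∀ {y} → y ∈ Y → Adj blue x y) → (∀ {z} → z ∈ Z → Adj blue x z) → (∀ {y z} → y ∈ Y → z ∈ Z → Adj blue y z) →
                       y ∈ Y → z ∈ Z → Adj blue w x → Adj blue w y → Adj blue w z → ⊥
    tripartite-wheel {Y} {Z} {w} {x} {y} {z} (rest , σ) lY lZ xY xZ YZ y∈ z∈ wx wy wz =
      let R , π = ∈-take y∈
          Z′ , ρ = ∈-take z∈
          R-length = trans (sym (↭-length π)) lY
          v , v∈ , woven new vs p τ nl ni = zigzag y R Z′ (λ i j → YZ (∈-resp-↭ (↭-sym π) i) (∈-resp-↭ (↭-sym ρ) (there j)))
            (≤-reflexive (suc-injective (trans R-length (trans (sym lZ) (↭-length ρ)))))
          D , δ = ⊑-dropʳ new [] ni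
          vs-length = trans (↭-length τ) (trans (length-++ R) (cong (length R +_) nl))
          len = cong suc (length-++ vs)
      in no-wheel {x} (cycle (y ∷ vs ++ z ∷ [ w ]) (wy ◂ p ▸ YZ (∈-resp-↭ (↭-sym π) v∈) z∈ ◂ edge (E-sym wz))
           (wheel-len (length R) q (length vs) _ vs-length R-length len)
           (↭-⊑ (prep y (++⁺ʳ (z ∷ [ w ]) τ)) (D ++ rest , ↭-trans σ (↭-trans (++⁺ʳ rest (prep w (++⁺ π (↭-trans ρ (prep z δ))))) (wheel-perm w y z R new D rest)))))
           (hub (λ i → ∈-resp-↭ (↭-sym π) i) (λ i → ∈-resp-↭ (↭-sym ρ) (there (⊑-∈ (⊑-dropʳ new [] ni) i))) τ)
      where
      hub : ∀ {R vs new} → (∀ {u} → u ∈ y ∷ R → u ∈ Y) → (∀ {u} → u ∈ new → u ∈ Z) → vs ↭ R ++ new → ∀ {u} → u ∈ y ∷ vs ++ z ∷ [ w ] → Adj blue x u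
      hub inY inZ τ (here refl) = xY y∈
      hub {R} {vs} inY inZ τ (there i) with ∈-++⁻ vs i
      ... | inj₂ (here refl)         = xZ z∈
      ... | inj₂ (there (here refl)) = E-sym wx
      ... | inj₁ j with ∈-++⁻ R (∈-resp-↭ τ j)
      ...   | inj₁ k = xY (inY (there k))
      ...   | inj₂ k = xZ (inZ k)

    three-perm = shuffle 1 4 (λ w X Y Z O → (X ⧺ Y ⧺ Z) ⧺ w ◃ O ⇄ (w ◃ Y ⧺ Z) ⧺ X ⧺ O)
    three-perm₁ = shuffle 0 5 (λ P Q R W D → (P ⧺ Q ⧺ R) ⧺ W ⧺ D ⇄ (P ⧺ W) ⧺ Q ⧺ R ⧺ D)
    three-perm₂ = shuffle 0 5 (λ P Q R W D → (P ⧺ Q ⧺ R) ⧺ W ⧺ D ⇄ (Q ⧺ W) ⧺ P ⧺ R ⧺ D)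
    three-perm₃ = shuffle 0 5 (λ P Q R W D → (P ⧺ Q ⧺ R) ⧺ W ⧺ D ⇄ (R ⧺ W) ⧺ P ⧺ Q ⧺ D)
    pair₁₂ = shuffle 0 4 (λ P Q R O → (P ⧺ Q ⧺ R) ⧺ O ⇄ (P ⧺ Q) ⧺ R ⧺ O)
    pair₁₃ = shuffle 0 4 (λ P Q R O → (P ⧺ Q ⧺ R) ⧺ O ⇄ (P ⧺ R) ⧺ Q ⧺ O)
    pair₂₃ = shuffle 0 4 (λ P Q R O → (P ⧺ Q ⧺ R) ⧺ O ⇄ (Q ⧺ R) ⧺ P ⧺ O)
    three-count = farkas 9
      (λ a p r s o x y z q → a := con 1 :+ 6 :* q :⇒ a := (p :+ (r :+ s)) :+ o :⇒ p := con 2 :+ q :⇒ r := con 2 :+ q :⇒ s := con 2 :+ q :⇒ o :≤ x :+ (y :+ z) :⇒ con 2 :+ x :≤ q :⇒ con 2 :+ y :≤ q :⇒ con 2 :+ z :≤ q :⇒ ⊢⊥)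
      0 (0 ∷ 1 ∷ 1 ∷ 0 ∷ 1 ∷ 0 ∷ 1 ∷ 0 ∷ 1 ∷ 0 ∷ 1 ∷ 1 ∷ 1 ∷ 1 ∷ [])
    three-step = farkas 7 (λ a b c l d e f → con 1 :≤ a :+ (b :+ c) :⇒ l :≤ d :+ (e :+ f) :⇒ ⊢ con 1 :+ l :≤ (a :+ d) :+ ((b :+ e) :+ (c :+ f))) 0 (1 ∷ 1 ∷ [])

    cover₃ : ∀ p r s O → (∀ {x} → x ∈ O → p x ≡ true ⊎ r x ≡ true ⊎ s x ≡ true) → length O ≤ cnt p O + (cnt r O + cnt s O)
    cover₃ p r s []      h = z≤n
    cover₃ p r s (x ∷ O) h = three-step ⟦ p x ⟧ ⟦ r x ⟧ ⟦ s x ⟧ (length O) (cnt p O) (cnt r O) (cnt s O) (one (h (here refl))) (cover₃ p r s O (h ∘ there))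
      where
      one : p x ≡ true ⊎ r x ≡ true ⊎ s x ≡ true → 1 ≤ ⟦ p x ⟧ + (⟦ r x ⟧ + ⟦ s x ⟧)
      one (inj₁ t)        = ≤-trans (⟦⟧-true t) (m≤m+n _ _)
      one (inj₂ (inj₁ t)) = ≤-trans (⟦⟧-true t) (≤-trans (m≤m+n _ _) (m≤n+m _ ⟦ p x ⟧))
      one (inj₂ (inj₂ t)) = ≤-trans (⟦⟧-true t) (≤-trans (m≤n+m _ ⟦ r x ⟧) (m≤n+m _ ⟦ p x ⟧))

    -- Any q - 1 vertices joined to the core are common neighbours of all its pairs, and `stretch`
    -- would give a red cycle.
    few-joined : ∀ {P d₀ d₁ P′ O} → Clique red P → P ↭ d₀ ∷ d₁ ∷ P′ → length P′ ≡ q →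
                 (∀ W D → O ↭ W ++ D → P ++ W ⊑ A) → 2 + cnt (joined red P′) O ≤ q
    few-joined {P} {d₀} {d₁} {P′} {O = O} k π len inA with q ≤? 1 + cnt (joined red P′) O
    ... | no n  = ≰⇒> n
    ... | yes m with select (joined red P′) O
    ...   | W , D , τ , f , _ , W-length = ⊥-elim (no-red (stretch unique (↭-⊑ (++⁺ʳ W (↭-sym π)) (inA W D τ)) (Clique-⊑ (↭-⊑ (↭-sym π) ⊑-refl) k) len q≥1
            λ {x} {y} x∈ y∈ _ → ≤-trans m (s≤s (≤-reflexive (trans (sym W-length) (sym (cnt-all (common red x y) W
              λ w∈ → true-∧ (E-sym (joined-∈ (f w∈) x∈)) (E-sym (joined-∈ (f w∈) y∈)))))))))

    module _ {X Y Z O : List V} (π : A ↭ (X ++ Y ++ Z) ++ O) (lX : length X ≡ 2 + q) (lY : length Y ≡ 2 + q) (lZ : length Z ≡ 2 + q)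
             (kX : Clique red X) (kY : Clique red Y) (kZ : Clique red Z) where

      private
        h₁₂ : X ++ Y ⊑ A
        h₁₂ = Z ++ O , ↭-trans π (pair₁₂ X Y Z O)
        h₁₃ : X ++ Z ⊑ A
        h₁₃ = Y ++ O , ↭-trans π (pair₁₃ X Y Z O)
        h₂₃ : Y ++ Z ⊑ A
        h₂₃ = X ++ O , ↭-trans π (pair₂₃ X Y Z O)
        c₁₂ = centre kX kY lX lY h₁₂
        c₁₃ = centre kX kZ lX lZ h₁₃
        c₂₃ = centre kY kZ lY lZ h₂₃
        uX : Unique X
        uX = Unique-⊑ unique (⊑-dropʳ X Y h₁₂)
        uY : Unique Y
        uY = Unique-⊑ unique (⊑-dropˡ X Y h₁₂)
        uZ : Unique Z
        uZ = Unique-⊑ unique (⊑-dropˡ X Z h₁₃)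

      -- Two vertices are removed so that the centres of the red stars towards the other two cliques
      -- are avoided. Different cores are then joined by blue edges only.
      record Core (c c′ : V) (P : List V) : Set where
        field
          {d₀ d₁} : V
          core    : List V
          shape   : P ↭ d₀ ∷ d₁ ∷ core
          len     : length core ≡ q
          off     : ∀ {x} → x ∈ core → x ≢ c × x ≢ c′
        core-∈ : ∀ {x} → x ∈ core → x ∈ P
        core-∈ i = ∈-resp-↭ (↭-sym shape) (there (there i))
        core-⊑ : core ⊑ P
        core-⊑ = ⊑-dropˡ (d₀ ∷ d₁ ∷ []) core (↭-⊑ (↭-sym shape) ⊑-refl)

      core-of : ∀ c c′ P → Unique P → length P ≡ 2 + q → Core c c′ P
      core-of c c′ P u l = let d₀ , d₁ , P′ , π , len , f = remove₂ c c′ P u l in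
        record { core = P′ ; shape = π ; len = len ; off = f }

      private
        module X = Core (core-of (proj₁ c₁₂) (proj₁ c₁₃) X uX lX)
        module Y = Core (core-of (proj₁ c₁₂) (proj₁ c₂₃) Y uY lY)
        module Z = Core (core-of (proj₁ c₁₃) (proj₁ c₂₃) Z uZ lZ)

      blue-between : ∀ {P Q x y} → P ++ Q ⊑ A → x ∈ P → y ∈ Q → (Adj red x y → ⊥) → Adj blue x y
      blue-between {P} h x∈ y∈ f with E-dich red≢blue (λ { refl → ⊑-disjoint unique h x∈ y∈ })
      ... | inj₁ e = ⊥-elim (f e)
      ... | inj₂ e = e

      XY : ∀ {x y} → x ∈ X.core → y ∈ Y.core → Adj blue x y
      XY x∈ y∈ = blue-between h₁₂ (X.core-∈ x∈) (Y.core-∈ y∈) (proj₂ c₁₂ (X.core-∈ x∈) (Y.core-∈ y∈) (proj₁ (X.off x∈)) (proj₁ (Y.off y∈)))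

      XZ : ∀ {x y} → x ∈ X.core → y ∈ Z.core → Adj blue x y
      XZ x∈ y∈ = blue-between h₁₃ (X.core-∈ x∈) (Z.core-∈ y∈) (proj₂ c₁₃ (X.core-∈ x∈) (Z.core-∈ y∈) (proj₂ (X.off x∈)) (proj₁ (Z.off y∈)))

      YZ : ∀ {x y} → x ∈ Y.core → y ∈ Z.core → Adj blue x y
      YZ x∈ y∈ = blue-between h₂₃ (Y.core-∈ x∈) (Z.core-∈ y∈) (proj₂ c₂₃ (Y.core-∈ x∈) (Z.core-∈ y∈) (proj₂ (Y.off x∈)) (proj₂ (Z.off y∈)))

      placed : ∀ {w} → w ∈ O → joined red X.core w ≡ true ⊎ joined red Y.core w ≡ true ⊎ joined red Z.core w ≡ true
      placed {w} w∈ = place (bool? (joined red X.core w)) (bool? (joined red Y.core w)) (bool? (joined red Z.core w))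
        where
        away : ∀ {v} → v ∈ X ++ Y ++ Z → w ≢ v
        away i refl = ⊑-disjoint unique ([] , ↭-trans π (↭-reflexive (sym (++-identityʳ≡ _)))) i w∈
        around : w ∷ Y.core ++ Z.core ⊑ A
        around = let O′ , ρ = ∈-take w∈ in
          ⊑-trans (⊑-∷ w (⊑-++ Y.core-⊑ Z.core-⊑)) (X ++ O′ , ↭-trans π (↭-trans (++⁺ˡ (X ++ Y ++ Z) ρ) (three-perm w X Y Z O′)))
        blue-at : ∀ {v} → v ∈ X ++ Y ++ Z → E red w v ≡ false → Adj blue w v
        blue-at i f = Adj-other (red≢blue ∘ sym) (away i) f
        place : joined red X.core w ≡ true ⊎ joined red X.core w ≡ false → joined red Y.core w ≡ true ⊎ joined red Y.core w ≡ false →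
                joined red Z.core w ≡ true ⊎ joined red Z.core w ≡ false →
                joined red X.core w ≡ true ⊎ joined red Y.core w ≡ true ⊎ joined red Z.core w ≡ true
        place (inj₁ t) _        _        = inj₁ t
        place (inj₂ _) (inj₁ t) _        = inj₂ (inj₁ t)
        place (inj₂ _) (inj₂ _) (inj₁ t) = inj₂ (inj₂ t)
        place (inj₂ f) (inj₂ g) (inj₂ h) = ⊥-elim (meet (joined-false {red} {X.core} f) (joined-false {red} {Y.core} g) (joined-false {red} {Z.core} h))
          where
          meet : (∃ λ x → x ∈ X.core × E red w x ≡ false) → (∃ λ y → y ∈ Y.core × E red w y ≡ false) → (∃ λ z → z ∈ Z.core × E red w z ≡ false) → ⊥
          meet (x , x∈ , wx) (y , y∈ , wy) (z , z∈ , wz) =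
            tripartite-wheel around Y.len Z.len (XY x∈) (XZ x∈) YZ y∈ z∈
              (blue-at (∈-++⁺ˡ (X.core-∈ x∈)) wx) (blue-at (∈-++⁺ʳ X (∈-++⁺ˡ (Y.core-∈ y∈))) wy) (blue-at (∈-++⁺ʳ X (∈-++⁺ʳ Y (Z.core-∈ z∈))) wz)

      -- `O` has 6q + 1 - 3(q + 2) = 3q - 5 vertices, each joined in red to one of three cores, but
      -- a core admits at most q - 2 of them.
      three-cliques : ⊥
      three-cliques = three-count (length A) (length X) (length Y) (length Z) (length O) _ _ _ q A-length
        (trans (↭-length π) (trans (length-++ (X ++ Y ++ Z)) (cong (_+ length O) (trans (length-++ X) (cong (length X +_) (length-++ Y)))))) lX lY lZ
        (cover₃ (joined red X.core) (joined red Y.core) (joined red Z.core) O placed)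
        (few-joined kX X.shape X.len (λ W D τ → Y ++ Z ++ D , ↭-trans π (↭-trans (++⁺ˡ (X ++ Y ++ Z) τ) (three-perm₁ X Y Z W D))))
        (few-joined kY Y.shape Y.len (λ W D τ → X ++ Z ++ D , ↭-trans π (↭-trans (++⁺ˡ (X ++ Y ++ Z) τ) (three-perm₂ X Y Z W D))))
        (few-joined kZ Z.shape Z.len (λ W D τ → X ++ Y ++ D , ↭-trans π (↭-trans (++⁺ˡ (X ++ Y ++ Z) τ) (three-perm₃ X Y Z W D))))

  -- Two red cliques without disjoint short links

  is : V → V → Bool
  is c v = does (c ≟ v)

  is-false : ∀ {c v} → is c v ≡ false → v ≢ c
  is-false {c} {v} h = does-false (c ≟ v) h ∘ sym

  cnt-is : ∀ c {xs} → Unique xs → cnt (is c) xs ≤ 1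
  cnt-is c {[]}     u = z≤n
  cnt-is c {x ∷ xs} (f AllPairs.∷ u) with c ≟ x
  ... | no  _    = cnt-is c u
  ... | yes refl = s≤s (≤-reflexive (cnt-none (is c) xs λ {v} i → absent (All.lookup f i)))
    where
    absent : ∀ {v} → c ≢ v → is c v ≡ false
    absent {v} n with c ≟ v
    ... | yes e = ⊥-elim (n e)
    ... | no _  = refl

  sum-step = farkas 11
    (λ a b c d s l x y z w t → a :+ (b :+ c) :≤ con 1 :+ (d :+ 2 :* s) :⇒ x :+ (y :+ z) :≤ l :+ (w :+ 2 :* t) :⇒ ⊢ (a :+ x) :+ ((b :+ y) :+ (c :+ z)) :≤ (con 1 :+ l) :+ ((d :+ w) :+ 2 :* (s :+ t)))
    0 (1 ∷ 1 ∷ [])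

  sum-bound : ∀ p p′ e c xs → (∀ {v} → v ∈ xs → ⟦ p v ⟧ + (⟦ p′ v ⟧ + ⟦ e v ⟧) ≤ 1 + (⟦ p v ∧ p′ v ⟧ + 2 * ⟦ is c v ⟧)) →
              cnt p xs + (cnt p′ xs + cnt e xs) ≤ length xs + (cnt (λ v → p v ∧ p′ v) xs + 2 * cnt (is c) xs)
  sum-bound p p′ e c []       h = z≤n
  sum-bound p p′ e c (x ∷ xs) h = sum-step ⟦ p x ⟧ ⟦ p′ x ⟧ ⟦ e x ⟧ ⟦ p x ∧ p′ x ⟧ ⟦ is c x ⟧ (length xs)
    (cnt p xs) (cnt p′ xs) (cnt e xs) (cnt (λ v → p v ∧ p′ v) xs) (cnt (is c) xs) (h (here refl)) (sum-bound p p′ e c xs (h ∘ there))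

  -- If `s` is false, the third bit excludes the other two. At the exceptional vertex all three may
  -- be set, and 3 ≤ 1 + 2.
  three-bits : ∀ a b c s → (s ≡ false → c ≡ true → a ≡ true → ⊥) → (s ≡ false → c ≡ true → b ≡ true → ⊥) →
               ⟦ a ⟧ + (⟦ b ⟧ + ⟦ c ⟧) ≤ 1 + (⟦ a ∧ b ⟧ + 2 * ⟦ s ⟧)
  three-bits a     b     c     true  f g = ≤-trans (+-mono-≤ (⟦⟧≤1 a) (+-mono-≤ (⟦⟧≤1 b) (⟦⟧≤1 c))) (s≤s (m≤n+m 2 ⟦ a ∧ b ⟧))
  three-bits true  b     true  false f g = ⊥-elim (f refl refl refl)
  three-bits false true  true  false f g = ⊥-elim (g refl refl refl)
  three-bits false false true  false f g = ≤-refl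
  three-bits true  true  false false f g = ≤-refl
  three-bits true  false false false f g = ≤-refl
  three-bits false true  false false f g = ≤-refl
  three-bits false false false false f g = z≤n

  module Spread {red blue : Bool} (red≢blue : red ≢ blue) {A : List V} (unique : Unique A) {q : ℕ} (q≥3 : 3 ≤ q)
                (A-length : length A ≡ 1 + 6 * q) (no-red : Cycle red (1 + 2 * q) A → ⊥) {h : V} {O : List V} where

    q≥1 : 1 ≤ q
    q≥1 = ≤-trans (s≤s z≤n) q≥3

    outer-degree = farkas 7
      (λ t d e n s o q → 3 :* q :≤ con 1 :+ t :⇒ t := (d :+ e) :+ (n :+ o) :⇒ d :≤ con 1 :+ q :⇒ n := con 0 :⇒ e :+ s :≤ con 1 :⇒ ⊢ 2 :* q :+ s :≤ con 3 :+ o)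
      0 (1 ∷ 1 ∷ 0 ∷ 1 ∷ 1 ∷ 0 ∷ 1 ∷ [])
    outer-degree′ = farkas 6
      (λ t d e n o q → 3 :* q :≤ con 1 :+ t :⇒ t := (e :+ d) :+ (n :+ o) :⇒ d :≤ con 1 :+ q :⇒ n := con 0 :⇒ e := con 0 :⇒ ⊢ 2 :* q :≤ con 2 :+ o)
      0 (1 ∷ 1 ∷ 0 ∷ 1 ∷ 1 ∷ 0 ∷ 1 ∷ 0 ∷ [])
    common-count = farkas 7
      (λ x y z s l w q → 2 :* q :+ s :≤ con 3 :+ x :⇒ 2 :* q :+ s :≤ con 3 :+ y :⇒ 2 :* q :≤ con 2 :+ z :⇒ x :+ (y :+ z) :≤ l :+ (w :+ 2 :* s) :⇒ l :+ con 4 :≤ 4 :* q :⇒ con 3 :≤ q :⇒ ⊢ q :≤ con 1 :+ w)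
      0 (1 ∷ 1 ∷ 1 ∷ 1 ∷ 1 ∷ 1 ∷ [])
    O-count = farkas 5
      (λ a d e o q → a := con 1 :+ 6 :* q :⇒ a := (d :+ e) :+ (con 1 :+ o) :⇒ d := con 2 :+ q :⇒ e := con 2 :+ q :⇒ ⊢ o :+ con 4 :≤ 4 :* q)
      0 (1 ∷ 0 ∷ 0 ∷ 1 ∷ 0 ∷ 1 ∷ 0 ∷ 1 ∷ [])

    -- e has no red neighbour in the clique D and, apart from c, no common red neighbour in O with its vertices, which
    -- forces any two vertices of D to have many common red neighbours in O.
    module Saturate {D E′ : List V} (π : A ↭ (D ++ E′) ++ h ∷ O) (kD : Clique red D) (lD : length D ≡ 2 + q) (lE : length E′ ≡ 2 + q)
                    (h-blue : ∀ {x} → x ∈ D ++ E′ → Adj blue h x) (degree : ∀ {x} → x ∈ D ++ E′ → 3 * q ≤ 1 + cnt (E red x) A)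
                    {c e : V} (e∈ : e ∈ E′) (few : ∀ {d} → d ∈ D → cnt (E red d) E′ + cnt (is c) O ≤ 1)
                    (none : cnt (E red e) D ≡ 0) (apart : ∀ {v d} → v ∈ O → v ≢ c → d ∈ D → Adj red d v → Adj red e v → ⊥) where

      within : ∀ {P x} → length P ≡ 2 + q → x ∈ P → cnt (E red x) P ≤ 1 + q
      within {P} {x} l x∈ = let P′ , ρ = ∈-take x∈ in
        ≤-trans (≤-reflexive (trans (cnt-↭ (E red x) ρ) (cong (λ t → ⟦ t ⟧ + cnt (E red x) P′) E-irr)))
          (≤-trans (cnt≤length _ P′) (≤-reflexive (suc-injective (trans (sym (↭-length ρ)) l))))

      split-count : ∀ p → cnt p A ≡ (cnt p D + cnt p E′) + (⟦ p h ⟧ + cnt p O)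
      split-count p = trans (cnt-↭ p π) (trans (cnt-++ p (D ++ E′) (h ∷ O)) (cong (_+ (⟦ p h ⟧ + cnt p O)) (cnt-++ p D E′)))

      not-h : ∀ {x} → x ∈ D ++ E′ → ⟦ E red x h ⟧ ≡ 0
      not-h x∈ = cong ⟦_⟧ (Adj-not (red≢blue ∘ sym) (E-sym (h-blue x∈)))

      d-degree : ∀ {d} → d ∈ D → 2 * q + cnt (is c) O ≤ 3 + cnt (E red d) O
      d-degree {d} d∈ = outer-degree _ (cnt (E red d) D) (cnt (E red d) E′) ⟦ E red d h ⟧ (cnt (is c) O) (cnt (E red d) O) q
        (degree (∈-++⁺ˡ d∈)) (split-count (E red d)) (within lD d∈) (not-h (∈-++⁺ˡ d∈)) (few d∈)

      e-degree : 2 * q ≤ 2 + cnt (E red e) O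
      e-degree = outer-degree′ _ (cnt (E red e) E′) (cnt (E red e) D) ⟦ E red e h ⟧ (cnt (E red e) O) q
        (degree (∈-++⁺ʳ D e∈)) (split-count (E red e)) (within lE e∈) (not-h (∈-++⁺ʳ D e∈)) none

      -- `O` has 4q - 4 vertices, of which `e` has 2q - 2 as red neighbours and `d`, `d′` at least
      -- 2q - 3 each. If `c` lies in `O`, it costs two in the count, but `few` then raises the
      -- degrees of `d` and `d′` by one each. Either way 2q - 4 ≥ q - 1 common neighbours remain.
      many-common : ∀ {d d′} → d ∈ D → d′ ∈ D → q ≤ 1 + cnt (common red d d′) O
      many-common {d} {d′} d∈ d′∈ = common-count (cnt (E red d) O) (cnt (E red d′) O) (cnt (E red e) O) (cnt (is c) O) (length O) (cnt (common red d d′) O) q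
        (d-degree d∈) (d-degree d′∈) e-degree
        (sum-bound (E red d) (E red d′) (E red e) c O λ {v} v∈ → three-bits (E red d v) (E red d′ v) (E red e v) (is c v)
          (λ n ev dv → apart v∈ (is-false n) d∈ dv ev) (λ n ev dv → apart v∈ (is-false n) d′∈ dv ev))
        (O-count (length A) (length D) (length E′) (length O) q A-length
          (trans (↭-length π) (trans (length-++ (D ++ E′)) (cong (_+ length (h ∷ O)) (length-++ D)))) lD lE) q≥3

      saturate-perm = shuffle 1 3 (λ h D E O → (D ⧺ E) ⧺ h ◃ O ⇄ (D ⧺ O) ⧺ E ⧺ h ◃ ε)
      saturated : ⊥
      saturated =
        let d₀ , d₁ , P , ρ = two D (≤-trans (m≤m+n 2 q) (≤-reflexive (sym lD)))
            inD : ∀ {x} → x ∈ P → x ∈ D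
            inD i = ∈-resp-↭ (↭-sym ρ) (there (there i))
        in no-red (stretch unique (↭-⊑ (++⁺ʳ O (↭-sym ρ)) (E′ ++ [ h ] , ↭-trans π (saturate-perm h D E′ O)))
             (Clique-⊑ (↭-⊑ (↭-sym ρ) ⊑-refl) kD) (suc-injective (suc-injective (trans (sym (↭-length ρ)) lD))) q≥1
             (λ x∈ y∈ _ → many-common (inD x∈) (inD y∈)))

    ∈-two : ∀ {n} c (P : List V) → Unique P → length P ≡ 2 + n → ∃ λ e → e ∈ P × e ≢ c
    ∈-two c (x ∷ y ∷ P) u _ with x ≟ c
    ... | no  n    = x , here refl , n
    ... | yes refl = y , there (here refl) , λ e → Unique-≢ u ⊑-refl (here refl) (sym e)

    is-refl : ∀ {c v} → v ≡ c → is c v ≡ true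
    is-refl {c} refl with c ≟ c
    ... | yes _ = refl
    ... | no  n = ⊥-elim (n refl)

    -- Only `c` in `E′` is linked to `D`, so any other vertex of `E′` can be the `e` of `Saturate`.
    one-sided : ∀ {D E′ c} → A ↭ (D ++ E′) ++ h ∷ O → Clique red D → length D ≡ 2 + q → length E′ ≡ 2 + q →
                (∀ {x} → x ∈ D ++ E′ → Adj blue h x) → (∀ {x} → x ∈ D ++ E′ → 3 * q ≤ 1 + cnt (E red x) A) →
                (∀ {x y} → x ∈ E′ → y ∈ D → Adj red x y → x ≡ c) →
                (∀ {x y w} → x ∈ E′ → y ∈ D → w ∈ O → Adj red x w → Adj red w y → x ≡ c) → ⊥
    one-sided {D} {E′} {c} π kD lD lE h-blue degree direct-c via-c =
      let e , e∈ , e≢c = ∈-two c E′ E-unique lE in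
      Saturate.saturated π kD lD lE h-blue degree {c} e∈ few
        (cnt-none (E red e) D λ y∈ → no-edge e≢c e∈ y∈)
        (λ v∈ _ d∈ dv ev → e≢c (via-c e∈ d∈ v∈ ev (E-sym dv)))
      where
      E-unique : Unique E′
      E-unique = Unique-⊑ unique (⊑-dropˡ D E′ (h ∷ O , π))
      no-edge : ∀ {e y} → e ≢ c → e ∈ E′ → y ∈ D → E red e y ≡ false
      no-edge {e} {y} e≢c e∈ y∈ with bool? (E red e y)
      ... | inj₁ t = ⊥-elim (e≢c (direct-c e∈ y∈ t))
      ... | inj₂ f = f
      one-sided-perm = shuffle 1 3 (λ h D E O → (D ⧺ E) ⧺ h ◃ O ⇄ (E ⧺ O) ⧺ D ⧺ h ◃ ε)
      few : ∀ {d} → d ∈ D → cnt (E red d) E′ + cnt (is c) O ≤ 1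
      few {d} d∈ = ≤-trans (+-monoˡ-≤ _ (cnt-mono (E red d) (is c) E′ λ x∈ t → is-refl (direct-c x∈ d∈ (E-sym t))))
        (≤-trans (≤-reflexive (sym (cnt-++ (is c) E′ O)))
          (cnt-is c {E′ ++ O} (Unique-⊑ unique (D ++ [ h ] , ↭-trans π (one-sided-perm h D E′ O)))))

    module Links {X Y : List V} (π : A ↭ (X ++ Y) ++ h ∷ O) (kX : Clique red X) (kY : Clique red Y)
                 (lX : length X ≡ 2 + q) (lY : length Y ≡ 2 + q) (h-blue : ∀ {x} → x ∈ X ++ Y → Adj blue h x)
                 (degree : ∀ {x} → x ∈ X ++ Y → 3 * q ≤ 1 + cnt (E red x) A) where
      data Link : V → Maybe V → V → Set where
        bridge : ∀ {x y} → x ∈ X → y ∈ Y → Adj red x y → Link x nothing y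
        via    : ∀ {x y w} → x ∈ X → y ∈ Y → w ∈ O → Adj red x w → Adj red w y → Link x (just w) y

      mid : Maybe V → List V
      mid nothing  = []
      mid (just w) = [ w ]

      link-x : ∀ {x m y} → Link x m y → x ∈ X
      link-x (bridge i _ _)  = i
      link-x (via i _ _ _ _) = i

      link-y : ∀ {x m y} → Link x m y → y ∈ Y
      link-y (bridge _ j _)  = j
      link-y (via _ j _ _ _) = j

      link-path : ∀ {x m y} → Link x m y → Path red x (mid m ++ [ y ]) y
      link-path (bridge _ _ e)  = edge e
      link-path (via _ _ _ e f) = e ◂ edge f

      link-back : ∀ {x m y} → Link x m y → Path red y (mid m ++ [ x ]) x
      link-back (bridge _ _ e)  = edge (E-sym e)
      link-back (via _ _ _ e f) = E-sym f ◂ edge (E-sym e)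

      mid≤1 : ∀ m → length (mid m) ≤ 1
      mid≤1 nothing  = z≤n
      mid≤1 (just _) = ≤-refl

      link-len = farkas-≡ 5
        (λ w v i j q → i :+ (w :+ v) := q :⇒ q := con 3 :+ j :⇒ ⊢ (w :+ con 1) :+ ((j :+ con 1) :+ ((v :+ con 1) :+ (i :+ con 1))) := con 1 :+ 2 :* q)
        0 (1 ∷ 0 ∷ 0 ∷ 1 ∷ [])
      link-i = farkas 3 (λ i t q → i :+ t := q :⇒ ⊢ i :≤ q) 0 (1 ∷ 0 ∷ [])
      link-j = farkas 2 (λ j q → q := con 3 :+ j :⇒ ⊢ j :≤ q) 0 (0 ∷ 1 ∷ [])
      link-t = farkas 3 (λ w v q → w :≤ con 1 :⇒ v :≤ con 1 :⇒ con 3 :≤ q :⇒ ⊢ w :+ v :≤ q) 2 (3 ∷ 3 ∷ 2 ∷ [])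
      link-perm = shuffle 1 3 (λ h X Y O → (X ⧺ Y) ⧺ h ◃ O ⇄ ((X ⧺ Y) ⧺ O) ⧺ h ◃ ε)

      disjoint-links : ∀ {x m y x′ m′ y′} → Link x m y → Link x′ m′ y′ → x ≢ x′ → y ≢ y′ → mid m ++ mid m′ ⊑ O → ⊥
      disjoint-links {m = m} {m′ = m′} l l′ x≢ y≢ mids =
        let R , ρ = take₂ (link-x l) (link-x l′) x≢
            T , τ = take₂ (link-y l) (link-y l′) y≢
            j , q≡ = 3+ q≥3
            t = length (mid m) + length (mid m′)
            -- Besides the four ends and t middle vertices, the cycle takes i = q - t and j = q - 3
            -- further vertices from the cliques: 4 + t + (q - t) + (q - 3) = 2q + 1.
            i = q ∸ t
            i≡ = m∸n+n≡m (link-t (length (mid m)) (length (mid m′)) q (mid≤1 m) (mid≤1 m′) q≥3)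
        in no-red (subst (λ n → Cycle red n A)
             (link-len (length (mid m)) (length (mid m′)) i j q i≡ q≡)
             (join (mid m) (mid m′) i j unique kX kY
               (⊑-trans (⊑-++ (⊑-refl {X ++ Y}) mids) ([ h ] , ↭-trans π (link-perm h X Y O))) ρ τ (link-path l) (link-back l′)
               (≤-trans (link-i i t q i≡) (≤-reflexive (suc-injective (suc-injective (trans (sym lX) (↭-length ρ))))))
               (≤-trans (link-j j q q≡) (≤-reflexive (suc-injective (suc-injective (trans (sym lY) (↭-length τ))))))))

      same-middle : ∀ {x m y x′ m′ y′} → Link x m y → Link x′ m′ y′ → x ≢ x′ → y ≢ y′ → ∃ λ w → m ≡ just w × m′ ≡ just w
      same-middle l@(bridge _ _ _) l′@(bridge _ _ _) n k = ⊥-elim (disjoint-links l l′ n k (O , ↭-refl))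
      same-middle l@(bridge _ _ _) l′@(via _ _ w∈ _ _) n k = ⊥-elim (disjoint-links l l′ n k (∈-⊑ w∈))
      same-middle l@(via _ _ w∈ _ _) l′@(bridge _ _ _) n k = ⊥-elim (disjoint-links l l′ n k (∈-⊑ w∈))
      same-middle l@(via {w = w} _ _ w∈ _ _) l′@(via {w = w′} _ _ w′∈ _ _) n k with w ≟ w′
      ... | yes refl = w , refl , refl
      ... | no  w≢   = ⊥-elim (disjoint-links l l′ n k (pair-⊑ w∈ w′∈ w≢))

      -- Here no red edge joins `X` and `Y`, so any vertex of `Y` can be the `e` of `Saturate`, with
      -- `c` as the exception in `O`.
      through-O : ∀ c → (∀ {x m y} → Link x m y → m ≡ just c) → ⊥
      through-O c all = let e , e∈ , _ = ∈-two h Y (Unique-⊑ unique (⊑-dropˡ X Y (h ∷ O , π))) lY in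
        Saturate.saturated π kX lX lY h-blue degree {c} e∈
          (λ {d} d∈ → ≤-trans (≤-reflexive (cong (_+ cnt (is c) O) (cnt-none (E red d) Y λ y∈ → no-bridge d∈ y∈)))
                        (cnt-is c (Unique-⊑ unique (⊑-dropˡ [ h ] O (⊑-dropˡ (X ++ Y) (h ∷ O) ([] , ↭-trans π (↭-reflexive (sym (++-identityʳ≡ _)))))))))
          (cnt-none (E red e) X λ x∈ → sym-false (no-bridge x∈ e∈))
          (λ v∈ v≢c d∈ dv ev → v≢c (just-injective (all (via d∈ e∈ v∈ dv (E-sym ev)))))
        where
        no-bridge : ∀ {x y} → x ∈ X → y ∈ Y → E red x y ≡ false
        no-bridge {x} {y} x∈ y∈ with bool? (E red x y)
        ... | inj₂ f = f
        ... | inj₁ t with () ← all (bridge x∈ y∈ t)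
        sym-false : ∀ {x y} → E red x y ≡ false → E red y x ≡ false
        sym-false {x} {y} f with bool? (E red y x)
        ... | inj₂ g = g
        ... | inj₁ t = true≢false (E-sym t) f

      swap-sides = shuffle 0 3 (λ X Y R → (X ⧺ Y) ⧺ R ⇄ (Y ⧺ X) ⧺ R)
      swap-∈ : ∀ {x} → x ∈ Y ++ X → x ∈ X ++ Y
      swap-∈ i with ∈-++⁻ Y i
      ... | inj₁ j = ∈-++⁺ʳ X j
      ... | inj₂ j = ∈-++⁺ˡ j

      through-X : ∀ c → (∀ {x m y} → Link x m y → x ≡ c) → ⊥
      through-X c all = one-sided (↭-trans π (swap-sides X Y (h ∷ O))) kY lY lX (h-blue ∘ swap-∈) (degree ∘ swap-∈)
        (λ x∈ y∈ e → all (bridge x∈ y∈ e)) (λ x∈ y∈ w∈ e f → all (via x∈ y∈ w∈ e f))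

      through-Y : ∀ c → (∀ {x m y} → Link x m y → y ≡ c) → ⊥
      through-Y c all = one-sided π kX lX lY h-blue degree
        (λ y∈ x∈ e → all (bridge x∈ y∈ (E-sym e))) (λ y∈ x∈ w∈ e f → all (via x∈ y∈ w∈ (E-sym f) (E-sym e)))

      recombine : ∀ {x y x′ y′ w} → Link x (just w) y → Link x′ (just w) y′ → Link x (just w) y′
      recombine (via x∈ _ w∈ e _) (via _ y∈ _ _ f) = via x∈ y∈ w∈ e f

      -- Menger's theorem for one separating vertex.
      crossing : ∀ {x₁ m₁ y₁ x₂ m₂ y₂} → Link x₁ m₁ y₁ → Link x₂ m₂ y₂ → x₁ ≢ x₂ → y₁ ≢ y₂ → ⊥
      crossing {x₁} {m₁} {y₁} {x₂} {m₂} {y₂} l₁ l₂ x≢ y≢ with same-middle l₁ l₂ x≢ y≢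
      ... | w , refl , refl = through-O w meets
        where
        same : ∀ {x m y x′ y′} → Link x m y → Link x′ (just w) y′ → x ≢ x′ → y ≢ y′ → m ≡ just w
        same l l′ n k with same-middle l l′ n k
        ... | _ , e , refl = e
        meets : ∀ {x m y} → Link x m y → m ≡ just w
        meets {x} {m} {y} l with x ≟ x₁ | y ≟ y₁ | x ≟ x₂ | y ≟ y₂
        ... | no n     | no k     | _        | _        = same l l₁ n k
        ... | yes refl | _        | _        | no k     = same l l₂ x≢ k
        ... | yes refl | no k     | _        | yes refl = same l (recombine l₂ l₁) x≢ k
        ... | yes refl | yes refl | _        | yes e    = ⊥-elim (y≢ e)
        ... | no n     | yes refl | no k     | _        = same l l₂ k y≢
        ... | no n     | yes refl | yes refl | _        = same l (recombine l₁ l₂) n y≢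

      -- By `crossing` any two links share an end. If some link does not start at x₁, then all links
      -- end at y₁; in either case one vertex separates the cliques.
      separate : ∀ {x₁ m₁ y₁} → Link x₁ m₁ y₁ → ⊥
      separate {x₁} {m₁} {y₁} l₁ = through-X x₁ all-x
        where
        all-y : ∀ {x₂ m₂} → Link x₂ m₂ y₁ → x₂ ≢ x₁ → ∀ {x m y} → Link x m y → y ≡ y₁
        all-y l₂ n {x} {m} {y} l₃ with y ≟ y₁ | x ≟ x₁
        ... | yes e | _        = e
        ... | no k  | no n′    = ⊥-elim (crossing l₁ l₃ (n′ ∘ sym) (k ∘ sym))
        ... | no k  | yes refl with same-middle l₂ l₃ n (k ∘ sym)
        ...   | _ , refl , refl = ⊥-elim (crossing l₁ (recombine l₂ l₃) (n ∘ sym) (k ∘ sym))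
        all-x : ∀ {x m y} → Link x m y → x ≡ x₁
        all-x {x} {m} {y} l₂ with x ≟ x₁ | y ≟ y₁
        ... | yes e | _        = e
        ... | no n  | no k     = ⊥-elim (crossing l₁ l₂ (n ∘ sym) (k ∘ sym))
        ... | no n  | yes refl = ⊥-elim (through-Y y₁ (all-y l₂ n))

      contradiction : ⊥
      -- Without links the condition on the separating vertex is vacuous, and `h` is an arbitrary
      -- choice.
      contradiction = through-O h λ l → ⊥-elim (separate l)

  -- Odd red cycles

  or-step = farkas 6 (λ a b c x y z → a :≤ b :+ c :⇒ x :≤ y :+ z :⇒ ⊢ a :+ x :≤ (b :+ y) :+ (c :+ z)) 0 (1 ∷ 1 ∷ [])

  cnt-⊎ : ∀ p r s xs → (∀ {x} → x ∈ xs → p x ≡ true → r x ≡ true ⊎ s x ≡ true) → cnt p xs ≤ cnt r xs + cnt s xs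
  cnt-⊎ p r s []       h = z≤n
  cnt-⊎ p r s (x ∷ xs) h = or-step ⟦ p x ⟧ ⟦ r x ⟧ ⟦ s x ⟧ (cnt p xs) (cnt r xs) (cnt s xs) (one (bool? (p x))) (cnt-⊎ p r s xs (h ∘ there))
    where
    one : p x ≡ true ⊎ p x ≡ false → ⟦ p x ⟧ ≤ ⟦ r x ⟧ + ⟦ s x ⟧
    one (inj₂ f) = ≤-trans (≤-reflexive (cong ⟦_⟧ f)) z≤n
    one (inj₁ t) with h (here refl) t
    ... | inj₁ u = ≤-trans (⟦⟧≤1 (p x)) (≤-trans (⟦⟧-true u) (m≤m+n _ _))
    ... | inj₂ u = ≤-trans (⟦⟧≤1 (p x)) (≤-trans (⟦⟧-true u) (m≤n+m _ _))

  pick-avoiding : ∀ p u v xs → Unique xs → 3 ≤ cnt p xs → ∃ λ x → x ∈ xs × p x ≡ true × x ≢ u × x ≢ v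
  pick-avoiding p u v xs unique le = found (find? (λ x → p x ∧ (not (is u x) ∧ not (is v x))) xs)
    where
    found : (∃ λ x → x ∈ xs × p x ∧ (not (is u x) ∧ not (is v x)) ≡ true) ⊎ (∀ {x} → x ∈ xs → p x ∧ (not (is u x) ∧ not (is v x)) ≡ false) →
            ∃ λ x → x ∈ xs × p x ≡ true × x ≢ u × x ≢ v
    found (inj₁ (x , x∈ , e)) = let px , e′ = ∧-true {p x} e ; nu , nv = ∧-true {not (is u x)} e′ in
      x , x∈ , px , is-false (not-true nu) , is-false (not-true nv)
    found (inj₂ f) = ⊥-elim (1≰0 (s≤s⁻¹ (s≤s⁻¹ (≤-trans le (≤-trans (cnt-⊎ p (is u) (is v) xs one) (+-mono-≤ (cnt-is u unique) (cnt-is v unique)))))))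
      where
      one : ∀ {x} → x ∈ xs → p x ≡ true → is u x ≡ true ⊎ is v x ≡ true
      one {x} x∈ px with bool? (is u x) | bool? (is v x)
      ... | inj₁ t | _      = inj₁ t
      ... | inj₂ _ | inj₁ t = inj₂ t
      ... | inj₂ g | inj₂ h = true≢false (true-∧ px (true-∧ (not-false g) (not-false h))) (f x∈)

  not-both-of-three : ∀ a b c → ¬ (a ≡ true × b ≡ true) → ¬ (a ≡ true × c ≡ true) → ¬ (b ≡ true × c ≡ true) → ⟦ a ⟧ + (⟦ b ⟧ + ⟦ c ⟧) ≤ 1
  not-both-of-three true  true  c     f g h = ⊥-elim (f (refl , refl))
  not-both-of-three true  false true  f g h = ⊥-elim (g (refl , refl))
  not-both-of-three true  false false f g h = ≤-refl
  not-both-of-three false b     c     f g h = not-both b c h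

  module OddCycle {red : Bool} {A : List V} (unique : Unique A) {q p : ℕ} (q≥3 : 3 ≤ q) (p≥1 : 1 ≤ p) (p<q : suc p ≤ q)
                  (A-length : length A ≡ 1 + 6 * q) (degree : ∀ {x} → x ∈ A → 3 * q ≤ 1 + cnt (E red x) A)
                  (none : Cycle red (3 + 2 * p) A → ⊥)
                  {x₀ : V} {C U : List V} (C-path : Path red x₀ C x₀) (C-length : length C ≡ 1 + 2 * p) (A-split : A ↭ C ++ U) where

    U⊑A : U ⊑ A
    U⊑A = C , ↭-trans A-split (swap-sides C U)
      where
      swap-sides = shuffle 0 2 (λ C U → C ⧺ U ⇄ U ⧺ C)

    U-unique : Unique U
    U-unique = Unique-⊑ unique U⊑A

    beyond : ∀ {x W D L D′} → Path red x L x → length L ≡ 3 + 2 * p → W ⊑ U → C ↭ D ++ D′ → L ↭ W ++ D → ⊥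
    beyond {W = W} {D} {L} {D′} P len (Z , σ) π ρ = none (cycle L P len (↭-⊑ ρ
      (D′ ++ Z , ↭-trans A-split (↭-trans (++⁺ π σ) (beyond-perm W D D′ Z)))))
      where
      beyond-perm = shuffle 0 4 (λ W D D′ Z → (D ⧺ D′) ⧺ W ⧺ Z ⇄ (W ⧺ D) ⧺ D′ ⧺ Z)

    triple-⊑ : ∀ {u v w} → u ∈ U → v ∈ U → w ∈ U → u ≢ v → u ≢ w → v ≢ w → u ∷ v ∷ w ∷ [] ⊑ U
    triple-⊑ u∈ v∈ w∈ u≢v u≢w v≢w = ∈-∷-⊑ (pair-⊑ v∈ w∈ v≢w) u∈ λ { (here e) → u≢v e ; (there (here e)) → u≢w e }

    U-∈A : ∀ {u} → u ∈ U → u ∈ A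
    U-∈A u∈ = ⊑-∈ U⊑A u∈

    split-degree : ∀ {x} → x ∈ A → 3 * q ≤ 1 + (cnt (E red x) C + cnt (E red x) U)
    split-degree {x} x∈ = ≤-trans (degree x∈) (≤-reflexive (cong suc (trans (cnt-↭ (E red x) A-split) (cnt-++ (E red x) C U))))

    inner : ∀ {x} → x ∈ C → cnt (E red x) C ≤ 2 * p
    inner {x} x∈ = let C′ , π = ∈-take x∈ in
      ≤-trans (≤-reflexive (trans (cnt-↭ (E red x) π) (cong (λ t → ⟦ t ⟧ + cnt (E red x) C′) E-irr)))
        (≤-trans (cnt≤length _ C′) (≤-reflexive (suc-injective (trans (sym (↭-length π)) C-length))))

    outer-nbrs = farkas 4 (λ c u q p → 3 :* q :≤ con 1 :+ (c :+ u) :⇒ c :≤ 2 :* p :⇒ (con 1 :+ p) :≤ q :⇒ con 3 :≤ q :⇒ ⊢ con 3 :≤ u) 3 (3 ∷ 3 ∷ 6 ∷ 3 ∷ [])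
    nbr-sum = farkas 9
      (λ a b c u v w l q p → 3 :* q :≤ con 1 :+ (a :+ u) :⇒ 3 :* q :≤ con 1 :+ (b :+ v) :⇒ 3 :* q :≤ con 1 :+ (c :+ w) :⇒ c :≤ 2 :* p :⇒ u :+ (v :+ w) :≤ l :⇒ l :+ 2 :* p := 6 :* q :⇒ 2 :* a :≤ con 2 :+ 2 :* p :⇒ 2 :* b :≤ con 1 :+ 2 :* p :⇒ (con 1 :+ p) :≤ q :⇒ con 3 :≤ q :⇒ ⊢⊥)
      0 (2 ∷ 2 ∷ 2 ∷ 2 ∷ 2 ∷ 2 ∷ 0 ∷ 1 ∷ 1 ∷ 4 ∷ 2 ∷ [])
    U-count = farkas-≡ 4 (λ a u q p → a := con 1 :+ 6 :* q :⇒ a := (con 1 :+ 2 :* p) :+ u :⇒ ⊢ u :+ 2 :* p := 6 :* q) 0 (1 ∷ 0 ∷ 0 ∷ 1 ∷ [])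
    half-one = farkas 5 (λ x y c l p → x :+ 2 :* c :≤ l :+ y :⇒ x :≤ con 1 :⇒ y :≤ con 1 :⇒ l := 2 :* p :⇒ ⊢ 2 :* (x :+ c) :≤ con 2 :+ 2 :* p) 0 (1 ∷ 1 ∷ 1 ∷ 1 ∷ 0 ∷ [])
    half-two = farkas 4
      (λ y c l p → con 1 :+ 2 :* c :≤ l :+ y :⇒ y :≤ con 1 :⇒ con 1 :+ l := 2 :* p :⇒ ⊢ 2 :* (con 0 :+ (con 1 :+ c)) :≤ con 1 :+ 2 :* p)
      0 (1 ∷ 1 ∷ 1 ∷ 0 ∷ [])

    -- `u₀` is exempt because it may already be spent on an insertion at another edge of the cycle.
    Free : V → V → List V → V → Set
    Free u₀ x l y = ∀ {u} → u ∈ U → u ≢ u₀ → Consecutive red (E red u) (E red u) x l y → ⊥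

    sparse : ∀ {x l y u₀ u} → Free u₀ x l y → Path red x l y → u ∈ U → u ≢ u₀ → ⟦ E red u x ⟧ + 2 * cnt (E red u) l ≤ length l + ⟦ E red u y ⟧
    sparse {u = u} free P u∈ n = cases (scan (E red u) P)
      where
      cases : Consecutive red (E red u) (E red u) _ _ _ ⊎ _ → _
      cases (inj₁ s) = ⊥-elim (free u∈ n s)
      cases (inj₂ h) = h

    -- For u next to x₁ and u′ next to x₃, the neighbourhoods of u, u′ and x₂ outside C are disjoint.
    module At {x₁ x₂ x₃ : V} {l : List V} {u₀ : V} (e₁₂ : Adj red x₁ x₂) (e₂₃ : Adj red x₂ x₃) (P : Path red x₃ l x₁)
              (perm : x₂ ∷ x₃ ∷ l ↭ C) (free : Free u₀ x₂ (x₃ ∷ l) x₁) where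

      l-length : 2 + length l ≡ 1 + 2 * p
      l-length = trans (↭-length perm) C-length

      x₁∈ : x₁ ∈ C
      x₁∈ = ∈-resp-↭ perm (there (last∈ P))
      x₂∈ : x₂ ∈ C
      x₂∈ = ∈-resp-↭ perm (here refl)
      x₃∈ : x₃ ∈ C
      x₃∈ = ∈-resp-↭ perm (there (here refl))
      C-∈A : ∀ {x} → x ∈ C → x ∈ A
      C-∈A x∈ = ∈-resp-↭ (↭-sym A-split) (∈-++⁺ˡ x∈)

      outer : ∀ {x} → x ∈ C → 3 ≤ cnt (E red x) U
      outer {x} x∈ = outer-nbrs (cnt (E red x) C) (cnt (E red x) U) q p (split-degree (C-∈A x∈)) (inner x∈) p<q q≥3

      at-perm₁ = shuffle 2 1 (λ x₂ x₃ l → x₂ ◃ x₃ ◃ l ⇄ (x₃ ◃ l) ⧺ x₂ ◃ ε)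
      at-perm₂ = shuffle 4 1 (λ u v x₂ x₃ l → x₂ ◃ v ◃ u ◃ x₃ ◃ l ⇄ (v ◃ u ◃ ε) ⧺ x₂ ◃ x₃ ◃ l)

      -- On `C`, `u` has at most p + 1 red neighbours, u′ at most p and x₂ at most 2p. The three
      -- disjoint sets in `U` thus have at least 3(3q - 1) - 4p - 1 = 9q - 4p - 4 elements in all,
      -- more than the 6q - 2p of `U` since p < q and q ≥ 3.
      clash : ∀ {u u′} → u ∈ U → u ≢ u₀ → Adj red x₁ u → u′ ∈ U → u′ ≢ u₀ → u ≢ u′ → Adj red x₃ u′ → ⊥
      clash {u} {u′} u∈ u≢ e u′∈ u′≢ n e′ =
        nbr-sum (cnt (E red u) C) (cnt (E red u′) C) (cnt (E red x₂) C) (cnt (E red u) U) (cnt (E red u′) U) (cnt (E red x₂) U) (length U) q p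
          (split-degree (U-∈A u∈)) (split-degree (U-∈A u′∈)) (split-degree (C-∈A x₂∈)) (inner x₂∈)
          (cnt-disjoint₃ (E red u) (E red u′) (E red x₂) U λ {v} v∈ → not-both-of-three (E red u v) (E red u′ v) (E red x₂ v)
            (λ { (a , b) → beyond {W = u ∷ v ∷ u′ ∷ []} (e ◂ a ◂ E-sym b ◂ E-sym e′ ◂ P) (cong (λ n → 2 + n) l-length)
                   (triple-⊑ u∈ v∈ u′∈ (Adj-≢ a) n (Adj-≢ b ∘ sym)) (↭-trans (↭-sym perm) (at-perm₁ x₂ x₃ l)) ↭-refl })
            (λ { (a , b) → beyond {W = u ∷ v ∷ []} {D = x₂ ∷ x₃ ∷ l} {D′ = []} (e ◂ a ◂ E-sym b ◂ e₂₃ ◂ P) (cong (λ n → 2 + n) l-length)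
                   (pair-⊑ u∈ v∈ (Adj-≢ a)) (↭-trans (↭-sym perm) (↭-reflexive (sym (++-identityʳ≡ _)))) ↭-refl })
            (λ { (a , b) → beyond {W = v ∷ u′ ∷ []} {D = x₂ ∷ x₃ ∷ l} {D′ = []} (e₁₂ ◂ b ◂ E-sym a ◂ E-sym e′ ◂ P) (cong (λ n → 2 + n) l-length)
                   (pair-⊑ v∈ u′∈ (Adj-≢ a ∘ sym)) (↭-trans (↭-sym perm) (↭-reflexive (sym (++-identityʳ≡ _)))) (at-perm₂ u′ v x₂ x₃ l) }))
          (U-count (length A) (length U) q p A-length A-length′)
          u-half u′-half p<q q≥3
        where
        A-length′ : length A ≡ (1 + 2 * p) + length U
        A-length′ = trans (↭-length A-split) (trans (length-++ C) (cong (_+ length U) C-length))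
        u-half : 2 * cnt (E red u) C ≤ 2 + 2 * p
        u-half = ≤-trans (≤-reflexive (cong (2 *_) (sym (cnt-↭ (E red u) perm))))
          (half-one ⟦ E red u x₂ ⟧ ⟦ E red u x₁ ⟧ (cnt (E red u) (x₃ ∷ l)) (length (x₃ ∷ l)) p
            (sparse free (e₂₃ ◂ P) u∈ u≢) (⟦⟧≤1 _) (⟦⟧≤1 _) (suc-injective l-length))
        u′≁x₂ : E red u′ x₂ ≡ false
        u′≁x₂ with bool? (E red u′ x₂)
        ... | inj₂ f = f
        ... | inj₁ t = ⊥-elim (free u′∈ u′≢ (consec [] l stop e₂₃ P t (E-sym e′) refl))
        free′ : Free u₀ x₃ l x₁
        free′ w∈ n s = free w∈ n (consec-∷ e₂₃ s)
        u′-half : 2 * cnt (E red u′) C ≤ 1 + 2 * p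
        u′-half = ≤-trans (≤-reflexive (cong (2 *_) (trans (sym (cnt-↭ (E red u′) perm))
                    (cong₂ (λ s t → ⟦ s ⟧ + (⟦ t ⟧ + cnt (E red u′) l)) u′≁x₂ (E-sym e′)))))
          (half-two ⟦ E red u′ x₁ ⟧ (cnt (E red u′) l) (length l) p
            (subst (λ t → ⟦ t ⟧ + 2 * cnt (E red u′) l ≤ length l + ⟦ E red u′ x₁ ⟧) (E-sym e′) (sparse free′ P u′∈ u′≢)) (⟦⟧≤1 _) (suc-injective l-length))

      contradiction : ⊥
      contradiction =
        let u , u∈ , e , u≢ , _ = pick-avoiding (E red x₁) u₀ u₀ U U-unique (outer x₁∈)
            u′ , u′∈ , e′ , u′≢ , n = pick-avoiding (E red x₃) u₀ u U U-unique (outer x₃∈)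
        in clash u∈ u≢ e u′∈ u′≢ (n ∘ sym) e′

    long-enough = farkas 2 (λ l p → con 1 :+ l := con 1 :+ 2 :* p :⇒ con 1 :≤ p :⇒ l :≤ con 0 :⇒ ⊢⊥) 0 (0 ∷ 1 ∷ 2 ∷ 1 ∷ [])

    with-free : ∀ {x₁ x₂} u₀ → (c : CycleAt red x₁ x₂ C) → Free u₀ x₂ (CycleAt.rest c) x₁ → ⊥
    with-free u₀ (at []       stop        forth perm) free = long-enough 0 p (trans (↭-length perm) C-length) p≥1 z≤n
    with-free u₀ (at (x₃ ∷ l) (e₂₃ ◂ P) forth perm) free = At.contradiction forth e₂₃ P perm free

    ends-joined-perm = shuffle 4 2 (λ u₀ x₂ u t pre post → u₀ ◃ (x₂ ◃ pre) ⧺ u ◃ t ◃ post ⇄ (u₀ ◃ u ◃ ε) ⧺ x₂ ◃ pre ⧺ t ◃ post)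
    -- Insertions at two different edges would lengthen the cycle by two. So when `u₀` fits into one
    -- edge, no other vertex fits into another, which is `Free`.
    ends-joined : ∀ {u₀ x₁ x₂} → CycleAt red x₁ x₂ C → u₀ ∈ U → Adj red u₀ x₁ → Adj red u₀ x₂ → ⊥
    ends-joined {u₀} {x₁} {x₂} c@(at rest back forth perm) u₀∈ e₁ e₂ = with-free u₀ c free
      where
      free : Free u₀ x₂ rest x₁
      free {u} u∈ n (consec {t} {t′} pre post before joint after ut ut′ shape) =
        beyond {W = u₀ ∷ u ∷ []} {D = x₂ ∷ rest} {D′ = []} (E-sym e₁ ◂ e₂ ◂ before ▸ E-sym ut ◂ ut′ ◂ after)
          (trans (↭-length (ends-joined-perm u₀ x₂ u t′ pre post)) (cong (λ n → 2 + n) (trans (cong (λ l → length (x₂ ∷ l)) (sym shape)) (trans (↭-length perm) C-length))))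
          (pair-⊑ u₀∈ u∈ (n ∘ sym)) (↭-trans (↭-sym perm) (↭-reflexive (sym (++-identityʳ≡ _))))
          (↭-trans (ends-joined-perm u₀ x₂ u t′ pre post) (↭-reflexive (cong (λ l → u₀ ∷ u ∷ x₂ ∷ l) (sym shape))))

    rotate-perm′ = shuffle 2 2 (λ x₂ v pre post → v ◃ post ⧺ x₂ ◃ pre ⇄ x₂ ◃ pre ⧺ v ◃ post)
    no-cycle : ∀ {x₁ x₂} → CycleAt red x₁ x₂ C → ⊥
    -- `x₁` lies on `C`, so this choice of the exempt vertex exempts nothing in `U`.
    no-cycle {x₁} {x₂} c@(at rest back forth perm) = with-free x₁ c free
      where
      free : Free x₁ x₂ rest x₁
      free {u} u∈ n (consec {t} {t′} pre post before joint after ut ut′ refl) =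
        ends-joined (at (post ++ x₂ ∷ pre) (after ▸ forth ◂ before) joint (↭-trans (rotate-perm′ x₂ t′ pre post) perm)) u∈ ut ut′

    some-vertex : ∃ λ x → x ∈ C
    some-vertex = nonempty C C-length
      where
      nonempty : ∀ l → length l ≡ 1 + 2 * p → ∃ λ x → x ∈ l
      nonempty (x ∷ _) _ = x , here refl

    contradiction : ⊥
    contradiction = let x , x∈ = some-vertex ; x′ , c = cycle-at C-path x∈ in no-cycle c

  -- The contradiction inside one neighbourhood

  ≤-split : ∀ {m n} → m ≤ n → ∃ λ d → m + d ≡ n
  ≤-split {m} {n} h = n ∸ m , m+[n∸m]≡n h

  module NoWheel {red blue : Bool} (red≢blue : red ≢ blue) {A : List V} (unique : Unique A) {q : ℕ} (q≥3 : 3 ≤ q)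
                 (A-length : length A ≡ 1 + 6 * q) (no-red : Cycle red (1 + 2 * q) A → ⊥)
                 (no-wheel : ∀ {h} (C : Cycle blue (1 + 2 * q) A) → (∀ {x} → x ∈ Cycle.verts C → Adj blue h x) → ⊥) where

    private
      module Nbhd = Neighbourhood red≢blue unique q≥3 A-length no-red no-wheel
    open Nbhd using (Cliques)

    degree-bound = farkas 5
      (λ r b a l q → a := con 1 :+ 6 :* q :⇒ a := con 1 :+ l :⇒ r :+ b := l :⇒ con 1 :+ b :≤ 3 :* q :+ con 2 :⇒ ⊢ 3 :* q :≤ con 1 :+ r)
      0 (0 ∷ 1 ∷ 1 ∷ 0 ∷ 0 ∷ 1 ∷ 1 ∷ [])

    degree : ∀ {x} → x ∈ A → ¬ 3 * q + 2 ≤ cnt (E blue x) A → 3 * q ≤ 1 + cnt (E red x) A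
    degree {x} x∈ few = let A′ , π = ∈-take x∈ in
      degree-bound (cnt (E red x) A) (cnt (E blue x) A) (length A) (length A′) q A-length (↭-length π)
        (trans (cong₂ _+_ (dropped π) (dropped π)) (E-count A′ (Unique-≢ unique (⊑-↭ ⊑-refl π)) red≢blue)) (≰⇒> few)
      where
      dropped : ∀ {A′ b} → A ↭ x ∷ A′ → cnt (E b x) A ≡ cnt (E b x) A′
      dropped {A′} {b} π = trans (cnt-↭ (E b x) π) (cong (λ t → ⟦ t ⟧ + cnt (E b x) A′) E-irr)

    hub-perm = shuffle 1 3 (λ h X Y O → h ◃ (X ⧺ Y) ⧺ O ⇄ (X ⧺ Y) ⧺ h ◃ O)
    third-perm = shuffle 0 4 (λ X Y Z O → (Z ⧺ X ⧺ Y) ⧺ O ⇄ (X ⧺ Y ⧺ Z) ⧺ O)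

    -- If a vertex x of the two cliques also has many blue neighbours, then `third` for x puts `h`
    -- into a red clique. Its other vertices are red to `h`, whereas `Q₁` and `Q₂` are blue to `h`,
    -- so the three cliques are disjoint. If there is no such x, all vertices of both cliques have
    -- large red degree and `Spread` applies.
    no-hub : ∀ {h} → h ∈ A → 3 * q + 2 ≤ cnt (E blue h) A → ⊥
    no-hub {h} h∈ many = Nbhd.red-cliques h∈ many impossible
      where
      impossible : Cliques h → ⊥
      impossible C = cases (find? (λ x → does (3 * q + 2 ≤? cnt (E blue x) A)) (Q₁ ++ Q₂))
        where
        open Nbhd.Cliques C
        h∉ : ¬ h ∈ Q₁ ++ Q₂
        h∉ i = Adj-≢ (blue-to i) refl

        with-third : ∀ {x} → x ∈ Q₁ ++ Q₂ → Cliques x → ⊥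
        with-third {x} x∈ C′ =
          let Z , lZ , kZ , Z⊑ , h∈Z = Nbhd.Cliques.third C′ h∈ (E-sym (blue-to x∈))
              O , π = ⊑-disjoint-++ Z unique Z⊑ inside λ z∈ z∈′ → E-excl red≢blue (kZ h∈Z z∈ λ { refl → h∉ z∈′ }) (blue-to z∈′)
          in Three.three-cliques red≢blue unique q≥3 A-length no-red no-wheel
               (↭-trans π (third-perm Q₁ Q₂ Z O)) Q₁-length Q₂-length lZ Q₁-clique Q₂-clique kZ

        cases : (∃ λ x → x ∈ Q₁ ++ Q₂ × does (3 * q + 2 ≤? cnt (E blue x) A) ≡ true) ⊎
                (∀ {x} → x ∈ Q₁ ++ Q₂ → does (3 * q + 2 ≤? cnt (E blue x) A) ≡ false) → ⊥
        cases (inj₁ (x , x∈ , e)) = Nbhd.red-cliques (⊑-∈ inside x∈) (does-true (3 * q + 2 ≤? cnt (E blue x) A) e) (with-third x∈)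
        cases (inj₂ none) =
          let O , π = ∈-∷-⊑ inside h∈ h∉ in
          Spread.Links.contradiction red≢blue unique q≥3 A-length no-red (↭-trans π (hub-perm h Q₁ Q₂ O)) Q₁-clique Q₂-clique Q₁-length Q₂-length blue-to
            λ {x} x∈ → degree (⊑-∈ inside x∈) (does-false (3 * q + 2 ≤? cnt (E blue x) A) (none x∈))

    red-degree : ∀ {x} → x ∈ A → 3 * q ≤ 1 + cnt (E red x) A
    red-degree x∈ = degree x∈ (no-hub x∈)

    -- `d` counts the lengthenings by two that lead to the forbidden length 2q + 1.
    no-odd-cycle : ∀ d p → p + d ≡ q → 1 ≤ p → Cycle red (1 + 2 * p) A → ⊥
    no-odd-cycle zero    p e p≥1 C = no-red (subst (λ n → Cycle red (1 + 2 * n) A) (trans (sym (+-identityʳ p)) e) C)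
    no-odd-cycle (suc d) p e p≥1 (cycle l P len (U , π)) =
      OddCycle.contradiction unique q≥3 p≥1 (≤-trans (m≤m+n (suc p) d) (≤-reflexive e′)) A-length red-degree
        (λ C → no-odd-cycle d (suc p) e′ (s≤s z≤n) (subst (λ n → Cycle red n A) (next p) C)) P len π
      where
      e′ : suc p + d ≡ q
      e′ = trans (sym (+-suc p d)) e
      next = farkas-≡ 1 (λ p → ⊢ con 3 :+ 2 :* p := con 1 :+ 2 :* (con 1 :+ p)) 0 []

    no-triangle : Cycle red 3 A → ⊥
    no-triangle = let d , e = ≤-split (≤-trans (s≤s z≤n) q≥3) in no-odd-cycle d 1 e ≤-refl

    clique-perm = shuffle 3 2 (λ x t h us R → h ◃ x ◃ t ◃ us ⧺ R ⇄ (x ◃ us ⧺ t ◃ ε) ⧺ h ◃ R)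
    clique-perm′ = shuffle 3 2 (λ x t h us R → h ◃ x ◃ t ◃ us ⧺ R ⇄ ((us ⧺ t ◃ ε) ⧺ x ◃ ε) ⧺ h ◃ R)

    no-blue-clique : ∀ k T → 1 + 2 * q ≡ 2 + k → 3 + k ≤ length T → T ⊑ A → Clique blue T → ⊥
    no-blue-clique k (h ∷ x ∷ t ∷ R) e (s≤s (s≤s (s≤s le))) T⊑ κ =
      no-wheel (cycle ((us ++ [ t ]) ++ [ x ]) (clique-walk x us t uq (Clique-⊑ rim κ) ▸ edge (κ (there (there (here refl))) (there (here refl)) (x≢t ∘ sym)))
                  (trans (length-++ (us ++ [ t ])) (trans (cong (_+ 1) (trans (length-++ us) (cong (_+ 1) (length-take≡ k R le)))) (trans (two-more k) (sym e))))
                  (⊑-trans (h ∷ drop k R , rim-↭) T⊑))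
        λ {v} v∈ → κ (here refl) (⊑-∈ (h ∷ drop k R , rim-↭) v∈) (h≢ v∈)
      where
      us : List V
      us = take k R
      T-↭ : h ∷ x ∷ t ∷ R ↭ h ∷ x ∷ t ∷ us ++ drop k R
      T-↭ = prep h (prep x (prep t (take-drop k R)))
      rim-↭ : h ∷ x ∷ t ∷ R ↭ ((us ++ [ t ]) ++ [ x ]) ++ h ∷ drop k R
      rim-↭ = ↭-trans T-↭ (clique-perm′ x t h us (drop k R))
      rim : x ∷ us ++ [ t ] ⊑ h ∷ x ∷ t ∷ R
      rim = h ∷ drop k R , ↭-trans T-↭ (clique-perm x t h us (drop k R))
      uq : Unique (x ∷ us ++ [ t ])
      uq = Unique-⊑ unique (⊑-trans rim T⊑)
      x≢t : x ≢ t
      x≢t = Unique-≢ unique (⊑-trans rim T⊑) (∈-++⁺ʳ us (here refl))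
      two-more = farkas-≡ 1 (λ k → ⊢ k :+ con 1 :+ con 1 := con 2 :+ k) 0 []

      h≢ : ∀ {v} → v ∈ (us ++ [ t ]) ++ [ x ] → h ≢ v
      h≢ v∈ refl = ⊑-disjoint unique (⊑-trans ([] , ↭-trans rim-↭ (↭-reflexive (sym (++-identityʳ≡ _)))) T⊑) v∈ (here refl)

    blue-size = farkas 3 (λ k q t → con 1 :+ 2 :* q := con 2 :+ k :⇒ 3 :* q :≤ con 1 :+ t :⇒ con 3 :≤ q :⇒ ⊢ con 3 :+ k :≤ t) 0 (0 ∷ 1 ∷ 1 ∷ 1 ∷ [])

    contradiction : ⊥
    contradiction = start A refl
      where
      at-vertex : ∀ y → y ∈ A → ⊥
      at-vertex y y∈ =
        let T , Z , π , f , _ , len = select (E red y) A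
            T⊑ = Z , π
            k , e = pred q (≤-trans (s≤s z≤n) q≥3)
        in cases T⊑ (λ i → f i) (≤-trans (red-degree y∈) (≤-reflexive (cong suc (sym len)))) k e (edge-or-clique (red≢blue ∘ sym) T (Unique-⊑ unique T⊑))
        where
        pred : ∀ q → 1 ≤ q → ∃ λ k → 1 + 2 * q ≡ 2 + k
        pred (suc j) _ = 1 + 2 * j , eq j
          where
          eq = farkas-≡ 1 (λ j → ⊢ con 1 :+ 2 :* (con 1 :+ j) := con 3 :+ 2 :* j) 0 []

        cases : ∀ {T} → T ⊑ A → (∀ {x} → x ∈ T → Adj red y x) → 3 * q ≤ 1 + length T → ∀ k → 1 + 2 * q ≡ 2 + k →
                (∃₂ λ x z → ∃ λ zs → Adj red x z × T ↭ x ∷ z ∷ zs) ⊎ Clique blue T → ⊥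
        cases {S} T⊑ f large k e (inj₂ κ) = no-blue-clique k S e (blue-size k q (length S) e large q≥3) T⊑ κ
        cases T⊑ f large k e (inj₁ (x , z , zs , xz , σ)) =
          no-triangle (cycle (y ∷ x ∷ z ∷ []) (E-sym yz ◂ yx ◂ edge xz) refl
            (∈-∷-⊑ (⊑-trans (zs , σ) T⊑) y∈ λ { (here e) → Adj-≢ yx e ; (there (here e)) → Adj-≢ yz e }))
          where
          yx : Adj red y x
          yx = f (∈-resp-↭ (↭-sym σ) (here refl))
          yz : Adj red y z
          yz = f (∈-resp-↭ (↭-sym σ) (there (here refl)))
      start : ∀ B → A ≡ B → ⊥
      start []      refl = 1≰0 (≤-trans (s≤s z≤n) (≤-reflexive (sym A-length)))
      start (y ∷ B) e    = at-vertex y (subst (y ∈_) (sym e) (here refl))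

-- From colourings to graphs and back to wheels

open import Data.Fin using (zero; suc)

cycleAdj? : ∀ m i j → Dec (CycleAdj m i j)
cycleAdj? (suc k) i j = (toℕ j ℕ.≟ suc (toℕ i) % suc k) ⊎-dec (toℕ i ℕ.≟ suc (toℕ j) % suc k)

wheel? : ∀ n u v → Dec (Wheel n u v)
wheel? (suc m) zero    zero    = no λ ()
wheel? (suc m) zero    (suc j) = yes tt
wheel? (suc m) (suc i) zero    = yes tt
wheel? (suc m) (suc i) (suc j) = cycleAdj? m i j

anyVec? : ∀ {N} k {P : Vec (Fin N) k → Set} → Decidable P → Dec (∃ P)
anyVec? zero    P? = map′ (λ p → Vec.[] , p) (λ { (Vec.[] , p) → p }) (P? Vec.[])
anyVec? (suc k) P? = map′ (λ { (i , v , p) → i Vec.∷ v , p }) (λ { (i Vec.∷ v , p) → i , v , p })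
  (Fin.any? λ i → anyVec? k λ v → P? (i Vec.∷ v))

-- Without function extensionality the search runs over tables of values.
hasCopy? : ∀ {N k} (c : Colouring N) b {G : Graph k} → (∀ u v → Dec (G u v)) → Dec (HasCopy c b G)
hasCopy? {N} {k} c b {G} G? = map′
  (λ { (v , inj , adj) → Vec.lookup v , inj _ _ , adj })
  (λ { (f , inj , adj) → Vec.tabulate f , (λ i j e → inj (trans (sym (lookup∘tabulate f i)) (trans e (lookup∘tabulate f j)))) ,
       λ i j g → trans (cong₂ (colour c) (lookup∘tabulate f i) (lookup∘tabulate f j)) (adj i j g) })
  (anyVec? k λ v →
    (Fin.all? λ i → Fin.all? λ j → (Vec.lookup v i Fin.≟ Vec.lookup v j) →-dec (i Fin.≟ j)) ×-dec
    (Fin.all? λ i → Fin.all? λ j → G? i j →-dec (colour c (Vec.lookup v i) (Vec.lookup v j) Bool.≟ b)))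

module Ramsey {N : ℕ} (c : Colouring (suc N)) where

  private
    -- The diagonal, where the colouring is arbitrary, is removed so that each colour class is
    -- irreflexive.
    shade : Bool → Fin (suc N) → Fin (suc N) → Bool
    shade b x y = not (does (x Fin.≟ y)) ∧ does (colour c x y Bool.≟ b)

    elim : ∀ b x y → shade b x y ≡ true → x ≢ y × colour c x y ≡ b
    elim b x y e with x Fin.≟ y | colour c x y Bool.≟ b
    elim b x y () | yes _ | _
    elim b x y () | no _  | no _
    elim b x y e  | no n  | yes k = n , k

    intro : ∀ b x y → x ≢ y → colour c x y ≡ b → shade b x y ≡ true
    intro b x y n k with x Fin.≟ y | colour c x y Bool.≟ b
    ... | yes e | _     = ⊥-elim (n e)
    ... | no _  | yes _ = refl
    ... | no _  | no n′ = ⊥-elim (n′ k)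

  graph : TwoColouring
  graph = record
    { V      = Fin (suc N)
    ; _≟_    = Fin._≟_
    ; E      = shade
    ; E-sym  = λ {b} {x} {y} e → let n , k = elim b x y e in intro b y x (n ∘ sym) (trans (symmetric c y x) k)
    ; E-irr  = λ {b} {x} → irreflexive b x
    ; E-dich = dichotomy
    ; E-excl = λ {a} {b} {x} {y} a≢b e f → a≢b (trans (sym (proj₂ (elim a x y e))) (proj₂ (elim b x y f)))
    }
    where
    irreflexive : ∀ b x → shade b x x ≡ false
    irreflexive b x with x Fin.≟ x
    ... | yes _ = refl
    ... | no n  = ⊥-elim (n refl)
    dichotomy : ∀ {a b x y} → a ≢ b → x ≢ y → shade a x y ≡ true ⊎ shade b x y ≡ true
    dichotomy {a} {b} {x} {y} a≢b n = cases (colour c x y Bool.≟ a)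
      where
      cases : Dec (colour c x y ≡ a) → shade a x y ≡ true ⊎ shade b x y ≡ true
      cases (yes k) = inj₁ (intro a x y n k)
      cases (no  k) = inj₂ (intro b x y n (bool-third (k ∘ sym) a≢b))

  open Graph graph
  open TwoColouring graph using (E; E-sym)
  open Lists (Fin (suc N))

  colour-of : ∀ {b x y} → Adj b x y → colour c x y ≡ b
  colour-of {b} {x} {y} e = proj₂ (elim b x y e)

  along : ∀ {b x l z} → Path b x l z → ∀ i j → toℕ j ≡ suc (toℕ i) → Adj b (lookup l i) (lookup l j)
  along (_ ◂ e ◂ _) zero    (suc zero) refl = e
  along (_ ◂ p)     (suc i) (suc j)    eq   = along p i j (ℕ.suc-injective eq)

  onward : ∀ {b x l z} → Path b x l z → ∀ j → toℕ j ≡ 0 → Adj b x (lookup l j)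
  onward (e ◂ _) zero refl = e

  at-end : ∀ {b x l z} → Path b x l z → ∀ i → suc (toℕ i) ≡ length l → lookup l i ≡ z
  at-end (_ ◂ stop)  zero    _  = refl
  at-end (_ ◂ p@(_ ◂ _)) (suc i) eq = at-end p i (ℕ.suc-injective eq)

  -- The wrap-around edge is the first edge of the path: it leaves the base point, which is also the
  -- last vertex of the list.
  rim : ∀ {b x y l} → Path b x (y ∷ l) x → ∀ i j → toℕ j ≡ suc (toℕ i) % suc (length l) → Adj b (lookup (y ∷ l) i) (lookup (y ∷ l) j)
  rim {b} {x} {y} {l} p i j e = cases (ℕ.m≤n⇒m<n∨m≡n (Fin.toℕ<n i))
    where
    cases : suc (toℕ i) < suc (length l) ⊎ suc (toℕ i) ≡ suc (length l) → Adj b (lookup (y ∷ l) i) (lookup (y ∷ l) j)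
    cases (inj₁ lt) = along p i j (trans e (m<n⇒m%n≡m lt))
    cases (inj₂ eq) = subst (λ v → Adj b v (lookup (y ∷ l) j)) (sym (at-end p i eq))
      (onward p j (trans e (trans (cong (_% suc (length l)) eq) (n%n≡0 (suc (length l))))))

  lookup-injective : ∀ {l : List (Fin (suc N))} → Unique l → ∀ i j → lookup l i ≡ lookup l j → i ≡ j
  lookup-injective {_ ∷ _} u                zero    zero    e = refl
  lookup-injective {_ ∷ l} (f AllPairs.∷ _) zero    (suc j) e = ⊥-elim (All.lookup f (∈-lookup j) e)
  lookup-injective {_ ∷ l} (f AllPairs.∷ _) (suc i) zero    e = ⊥-elim (All.lookup f (∈-lookup i) (sym e))
  lookup-injective {_ ∷ l} (_ AllPairs.∷ u) (suc i) (suc j) e = cong suc (lookup-injective u i j e)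

  copy : ∀ {b h x l} → Path b x l x → Unique l → (∀ {y} → y ∈ l → Adj b h y) → HasCopy c b (Wheel (suc (length l)))
  copy {b} {h} {x} {l} p unique spoke = f , (λ {i} {j} → injective i j) , adjacent
    where
    f : Fin (suc (length l)) → Fin (suc N)
    f zero    = h
    f (suc i) = lookup l i
    injective : ∀ i j → f i ≡ f j → i ≡ j
    injective zero    zero    e = refl
    injective zero    (suc j) e = ⊥-elim (Adj-≢ (spoke (∈-lookup j)) e)
    injective (suc i) zero    e = ⊥-elim (Adj-≢ (spoke (∈-lookup i)) (sym e))
    injective (suc i) (suc j) e = cong suc (lookup-injective unique i j e)
    rim-colour : ∀ {l} → Path b x l x → ∀ i j → CycleAdj (length l) i j → colour c (lookup l i) (lookup l j) ≡ b
    rim-colour {_ ∷ _} p i j (inj₁ e) = colour-of (rim p i j e)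
    rim-colour {_ ∷ _} p i j (inj₂ e) = colour-of (E-sym (rim p j i e))
    adjacent : ∀ i j → Wheel (suc (length l)) i j → colour c (f i) (f j) ≡ b
    adjacent zero    (suc j) _ = colour-of (spoke (∈-lookup j))
    adjacent (suc i) zero    _ = colour-of (E-sym (spoke (∈-lookup i)))
    adjacent (suc i) (suc j) a = rim-colour p i j a

  module _ {q : ℕ} (q≥3 : 3 ≤ q) (N-value : N ≡ 1 + 12 * q) (no-copy : ∀ b → HasCopy c b (Wheel (2 + 2 * q)) → ⊥) where

    others : List (Fin (suc N))
    others = tabulate suc

    all-unique : Unique (zero ∷ others)
    all-unique = allFin⁺ (suc N)

    no-wheel : ∀ {A b h} → Unique A → (C : Cycle b (1 + 2 * q) A) → (∀ {x} → x ∈ Cycle.verts C → Adj b h x) → ⊥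
    no-wheel {b = b} unique (cycle l p len l⊑) spoke =
      no-copy b (subst (λ n → HasCopy c b (Wheel (suc n))) len (copy p (Unique-⊑ unique l⊑) spoke))

    few : ∀ b → ¬ 1 + 6 * q ≤ cnt (E b zero) others
    few b many =
      let B , Z , π , f , _ , len = select (E b zero) others
          A = take (1 + 6 * q) B
          A⊑B = drop (1 + 6 * q) B , take-drop (1 + 6 * q) B
          unique = Unique-⊑ (Unique-⊑ all-unique (⊑-dropˡ (zero ∷ []) others ⊑-refl)) (⊑-trans A⊑B (Z , π))
      in NoWheel.contradiction (≢-not {b}) {A = A} unique q≥3 (length-take≡ (1 + 6 * q) B (≤-trans many (≤-reflexive (sym len))))
           (λ C → no-wheel {h = zero} unique C λ i → f (⊑-∈ (⊑-trans (Cycle.inside C) A⊑B) i))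
           (no-wheel unique)

    two-colours = farkas 5
      (λ s t l n q → s :+ t := l :⇒ l := n :⇒ n := con 1 :+ 12 :* q :⇒ con 1 :+ s :≤ con 1 :+ 6 :* q :⇒ con 1 :+ t :≤ con 1 :+ 6 :* q :⇒ ⊢⊥)
      0 (0 ∷ 1 ∷ 0 ∷ 1 ∷ 0 ∷ 1 ∷ 1 ∷ 1 ∷ [])

    impossible : ⊥
    impossible = two-colours (cnt (E true zero) others) (cnt (E false zero) others) (length others) N q
      (E-count others (Unique-≢ all-unique ⊑-refl) λ ()) (length-tabulate suc) N-value (≰⇒> (few true)) (≰⇒> (few false))

theorem8 : (n : ℕ) → 8 ≤ n → 2 ∣ n →
    Σ ℕ (λ N → N ≤ 6 * n ∸ 10 × RamseyProp (Wheel n) (Wheel n) N)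
theorem8 n n≥8 (divides k n≡) = at k (trans n≡ (*-comm k 2)) n≥8
  where
  order = farkas-≡ 1 (λ q → ⊢ 6 :* (2 :* (con 1 :+ q)) := con 10 :+ (con 2 :+ 12 :* q)) 0 []
  even = farkas-≡ 1 (λ q → ⊢ 2 :* (con 1 :+ q) := con 2 :+ 2 :* q) 0 []
  large = farkas 1 (λ q → con 8 :≤ 2 :* (con 1 :+ q) :⇒ ⊢ con 3 :≤ q) 1 (1 ∷ [])

  at : ∀ {n} k → n ≡ 2 * k → 8 ≤ n → Σ ℕ (λ N → N ≤ 6 * n ∸ 10 × RamseyProp (Wheel n) (Wheel n) N)
  at zero    refl ()
  at (suc q) refl n≥8 = 2 + 12 * q ,
    ≤-reflexive (sym (trans (cong (_∸ 10) (order q)) (m+n∸m≡n 10 (2 + 12 * q)))) ,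
    λ c → subst (λ m → HasCopy c true (Wheel m) ⊎ HasCopy c false (Wheel m)) (sym (even q)) (copies c (hasCopy? c true (wheel? _)) (hasCopy? c false (wheel? _)))
    where
    copies : ∀ c → Dec (HasCopy c true (Wheel (2 + 2 * q))) → Dec (HasCopy c false (Wheel (2 + 2 * q))) →
             HasCopy {2 + 12 * q} c true (Wheel (2 + 2 * q)) ⊎ HasCopy c false (Wheel (2 + 2 * q))
    copies c (yes r) _       = inj₁ r
    copies c (no _)  (yes b) = inj₂ b
    -- The argument only refutes the absence of both wheels; deciding each of them turns this into
    -- the disjunction.
    copies c (no r)  (no b)  = ⊥-elim (Ramsey.impossible c (large q n≥8) refl λ { true → r ; false → b })
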